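{- Let $a\ge 3$ be an integer. Let $M_{a-2}=M_{a-2}^1\cup M_{a-2}^2$ (union of multisets) be the multiset of $(a-2)$-colored degrees where $M_{a-2}^1$ consists of the tuple $(2,1,\dots,1)$ (one entry $2$ followed by $a-3$ entries $1$) with multiplicity $3$, and $$M_{a-2}^2=\{(\delta_1,\dots,\delta_{a-2}) : \exists\, i\in\{2,\dots,a-2\},\ \delta_j=0 \text{ for all } j<i,\ \delta_i=i+1,\ \delta_j=1 \text{ for all } j>i\}.$$ Then $M_{a-2}$ is an extended profile of $\mathcal{S}(K_a)$, where $K_a$ is the complete graph on $a$ vertices. Moreover, for a host graph $G$ with ordered edges $e_1,\dots,e_m$ and maximum frontier size $w=\max_{i\in[m]}|F_i|$, there is an algorithm to construct an $(a-1)$-DD $\mathbf{Z}^{a-1}(\mathcal{C}_{M_{a-2}}^*)$ over $E(G)$, i.e. one representing the family of all $(a-2)$-colored subgraphs of $G$ satisfying $\mathcal{C}_{M_{a-2}}^*$, with width at most $$2^{O(a\,w\log w)}\,\bigl(3\cdot 2^{a-2}-a\bigr)^{w}.$$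
   Context: All graphs are finite and simple; $[k]=\{1,\dots,k\}$; $\mathbb{N}$ is the set of non-negative integers; the number $c$ of colors is always a positive integer; $O(\cdot)$ is the usual big-O notation. Subdivisions. Subdividing an edge $\{u,v\}$ means removing it, adding a new vertex $x$ and the edges $\{u,x\},\{v,x\}$. A subdivision of $H$ is any graph obtained from $H$ by subdividing edges an arbitrary number (possibly zero) of times. $\mathcal{S}(H)$ is the family of subdivisions of $H$ (considered up to isomorphism). Colored graphs. A $c$-colored subset over a finite set $E$ is a $c$-tuple $(D_1,\dots,D_c)$ of pairwise disjoint subsets of $E$. A $c$-colored graph is a finite vertex set $U$ together with a $c$-colored subset $(D_1,\dots,D_c)$ over the set of unordered pairs of distinct elements of $U$; edges in $D_i$ have color $i$. Its underlying graph is obtained by forgetting colors; it is a $c$-colorized graph of $F$ if its underlying graph is isomorphic to $F$. A $c$-colored degree is a tuple in $\mathbb{N}^c$. The colored degree of a vertex $u$ is the $c$-tuple $(\delta_1,\dots,\delta_c)$ where $\delta_i$ is the number of color-$i$ edges incident to $u$. $\mathrm{DS}(F^c)$ is the multiset of colored degrees of all vertices of $F^c$. The color-$i$ subgraph of $F^c$ consists of the color-$i$ edges and their endpoints. Extended profile. Let $\Delta^c$ be the set of the $c$ tuples in $\mathbb{N}^c$ with one entry equal to $2$ and all other entries $0$. For a multiset $M$ of $c$-colored degrees, a $c$-colored graph $F^c$ satisfies $\mathcal{C}_M^*$ if and only if (a) $\mathrm{DS}(F^c)$ is obtained by adding to $M$ an arbitrary number (possibly zero) of elements of $\Delta^c$,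 repetitions allowed, and (b) for each $i\in[c]$ the color-$i$ subgraph of $F^c$ is connected. $M$ is an extended profile of $\mathcal{S}(H)$ if for every graph $F$: $F$ belongs to $\mathcal{S}(H)$ if and only if there exists a $c$-colorized graph $F^c$ of $F$ satisfying $\mathcal{C}_M^*$. Colored subgraphs of $G$. A $c$-colored subgraph of $G$ is identified with a $c$-colored subset $(D_1,\dots,D_c)$ over $E(G)$; it stands for the edge-induced $c$-colored graph whose vertices are the endpoints of edges in $D_1\cup\dots\cup D_c$. Frontier. The $i$-th frontier $F_i$ is the set of vertices of $G$ incident both to some edge in $\{e_1,\dots,e_{i-1}\}$ and to some edge in $\{e_i,\dots,e_m\}$. Decision diagrams. A $(c+1)$-DD over $E=\{e_1,\dots,e_m\}$ is a finite directed acyclic graph with a unique root node and two terminal nodes $\top,\bot$ (no outgoing arcs). Each non-terminal node $\alpha$ has a label $\ell(\alpha)\in[m]$ and exactly $c+1$ outgoing arcs, called its $0$-arc, $1$-arc, ..., $c$-arc; each arc from $\alpha$ points to a terminal node or to a non-terminal node with label $\ell(\alpha)+1$. A directed path from the root to $\top$ represents the $c$-colored subset $(B_1,\dots,B_c)$ with $B_j=\{e_{\ell(\beta)} : \text{the path uses the } j\text{ -arc of } \beta\}$. The DD represents the family of all $c$-colored subsets represented by its root-to-$\top$ paths. Its width is the maximum number of nodes with the same label. -}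

module Defs where

open import Data.Bool.Base using (Bool; false; T; _∧_; if_then_else_)
open import Data.Bool.Properties using (T?; T-∧)
open import Data.Empty using (⊥)
open import Data.Fin.Base using (Fin; zero; suc; toℕ)
open import Data.Fin.Properties using (_≟_; any?; _≤?_; _<?_)
open import Data.List.Base using (List; _++_; length; filter; lookup; map; replicate; allFin)
open import Data.List.Extrema.Nat using (max)
open import Data.List.Relation.Binary.Permutation.Propositional using (_↭_)
open import Data.List.Relation.Unary.All using (All)
open import Data.Nat.Base using (ℕ; suc; _+_; _<ᵇ_; _≡ᵇ_)
import Data.Nat.Properties as ℕ
open import Data.Product.Base using (Σ-syntax; ∃-syntax; _×_; _,_; proj₁; proj₂; swap)
open import Data.Sum.Base using (_⊎_; inj₁; inj₂)
import Data.Sum.Base as Sum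
open import Data.Vec.Base using (Vec)
import Data.Vec.Base as Vec
open import Function.Base using (_∘_)
open import Function.Bundles using (_⇔_; _↔_; Inverse; Equivalence)
open import Relation.Binary.Construct.Closure.ReflexiveTransitive using (Star)
open import Relation.Binary.PropositionalEquality.Core using (_≡_; _≢_; refl; sym; subst)
open import Relation.Nullary using (Dec; ¬_)
open import Relation.Nullary.Decidable using (⌊_⌋; _×-dec_; _⊎-dec_; ¬?; toWitness; fromWitness)

------------------------------------------------------------------------
-- Graphs

record Graph : Set where
  field
    order      : ℕ
    adj        : Fin order → Fin order → Bool
    adj-sym    : ∀ {u v} → T (adj u v) → T (adj v u)
    adj-irrefl : ∀ {u} → ¬ T (adj u u)

  Vertex : Set
  Vertex = Fin order

  Adj : Vertex → Vertex → Set
  Adj u v = T (adj u v)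

open Graph public using (Vertex; Adj)

record _≅_ (G H : Graph) : Set where
  field
    bijection : Vertex G ↔ Vertex H
  open Inverse bijection public using (to)
  field
    preserves : ∀ u v → Adj G u v ⇔ Adj H (to u) (to v)

Connected : Graph → Set
Connected G = ∀ u v → Star (Adj G) u v

complete : ℕ → Graph
complete n = record
  { order      = n
  ; adj        = λ u v → ⌊ ¬? (u ≟ v) ⌋
  ; adj-sym    = λ {u} {v} p → fromWitness {a? = ¬? (v ≟ u)} λ v≡u → toWitness {a? = ¬? (u ≟ v)} p (sym v≡u)
  ; adj-irrefl = λ {u} p → toWitness {a? = ¬? (u ≟ u)} p refl
  }

-- Equality of unordered pairs.
_≐_ : ∀ {n} → Fin n × Fin n → Fin n × Fin n → Set
(u , v) ≐ (x , y) = (u ≡ x × v ≡ y) ⊎ (u ≡ y × v ≡ x)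

_≐?_ : ∀ {n} (p q : Fin n × Fin n) → Dec (p ≐ q)
(u , v) ≐? (x , y) = (u ≟ x ×-dec v ≟ y) ⊎-dec (u ≟ y ×-dec v ≟ x)

≐-swapˡ : ∀ {n} {u v : Fin n} {q} → (u , v) ≐ q → (v , u) ≐ q
≐-swapˡ = Sum.swap ∘ Sum.map swap swap

-- The pair {u , v} is removed, the new vertex is zero, and an old vertex x
-- becomes suc x.
module _ (G : Graph) (u v : Vertex G) where
  open Graph G using (order; adj; adj-sym; adj-irrefl)

  adj′ : Fin (suc order) → Fin (suc order) → Bool
  adj′ zero    zero    = false
  adj′ zero    (suc y) = ⌊ (y ≟ u) ⊎-dec (y ≟ v) ⌋
  adj′ (suc x) zero    = ⌊ (x ≟ u) ⊎-dec (x ≟ v) ⌋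
  adj′ (suc x) (suc y) = adj x y ∧ ⌊ ¬? ((x , y) ≐? (u , v)) ⌋

  adj′-sym : ∀ x y → T (adj′ x y) → T (adj′ y x)
  adj′-sym zero    (suc y) p = p
  adj′-sym (suc x) zero    p = p
  adj′-sym (suc x) (suc y) p =
    let q , r = Equivalence.to T-∧ p in
    Equivalence.from T-∧
      ( adj-sym q
      , fromWitness {a? = ¬? ((y , x) ≐? (u , v))}
          (toWitness {a? = ¬? ((x , y) ≐? (u , v))} r ∘ ≐-swapˡ) )

  adj′-irrefl : ∀ x → ¬ T (adj′ x x)
  adj′-irrefl (suc x) p = adj-irrefl (proj₁ (Equivalence.to T-∧ p))

  subdivide : Graph
  subdivide = record
    { order      = suc order
    ; adj        = adj′
    ; adj-sym    = λ {x} {y} → adj′-sym x y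
    ; adj-irrefl = λ {x} → adj′-irrefl x
    }

data Subdivision (H : Graph) : Graph → Set where
  none : Subdivision H H
  step : ∀ {G} → Subdivision H G → (u v : Vertex G) → Adj G u v →
         Subdivision H (subdivide G u v)

_∈𝒮_ : Graph → Graph → Set
F ∈𝒮 H = ∃[ G ] Subdivision H G × F ≅ G

nonIsolated : (G : Graph) → List (Vertex G)
nonIsolated G = filter (λ u → any? λ v → T? (Graph.adj G u v)) (allFin (Graph.order G))

-- The edges of G and their endpoints.
edgeInduced : Graph → Graph
edgeInduced G = record
  { order      = length vs
  ; adj        = λ i j → adj (lookup vs i) (lookup vs j)
  ; adj-sym    = adj-sym
  ; adj-irrefl = adj-irrefl
  }
  where
  open Graph G
  vs = nonIsolated G

------------------------------------------------------------------------
-- Colored graphs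

record ColoredSubset (c : ℕ) (E : Set) : Set where
  field
    part     : Fin c → E → Bool
    disjoint : ∀ {i j e} → T (part i e) → T (part j e) → i ≡ j

-- As with adj above, a set of unordered pairs of distinct elements is given
-- as a symmetric and irreflexive set of ordered pairs.
record ColoredGraph (c : ℕ) : Set where
  field
    order        : ℕ
    edges        : ColoredSubset c (Fin order × Fin order)
  open ColoredSubset edges public using (part; disjoint)
  field
    edges-sym    : ∀ {i u v} → T (part i (u , v)) → T (part i (v , u))
    edges-irrefl : ∀ {i u} → ¬ T (part i (u , u))

module _ {c : ℕ} (F : ColoredGraph c) where
  open ColoredGraph F

  colored? : ∀ u v → Dec (∃[ i ] T (part i (u , v)))
  colored? u v = any? λ i → T? (part i (u , v))

  underlying : Graph
  underlying = record
    { order      = order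
    ; adj        = λ u v → ⌊ colored? u v ⌋
    ; adj-sym    = λ {u} {v} p → let i , q = toWitness {a? = colored? u v} p in
                                 fromWitness {a? = colored? v u} (i , edges-sym q)
    ; adj-irrefl = λ {u} p → edges-irrefl (proj₂ (toWitness {a? = colored? u u} p))
    }

  colorSubgraph : Fin c → Graph
  colorSubgraph i = edgeInduced record
    { order      = order
    ; adj        = λ u v → part i (u , v)
    ; adj-sym    = edges-sym
    ; adj-irrefl = edges-irrefl
    }

  coloredDegree : Fin order → Vec ℕ c
  coloredDegree u = Vec.tabulate λ i →
    length (filter (λ v → T? (part i (u , v))) (allFin order))

  -- Multisets are lists up to permutation.
  DS : List (Vec ℕ c)
  DS = map coloredDegree (allFin order)

  coloredEdgeInduced : ColoredGraph c
  coloredEdgeInduced = record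
    { order        = length vs
    ; edges        = record
      { part     = λ i (x , y) → part i (lookup vs x , lookup vs y)
      ; disjoint = disjoint
      }
    ; edges-sym    = edges-sym
    ; edges-irrefl = edges-irrefl
    }
    where vs = nonIsolated underlying

------------------------------------------------------------------------
-- Extended profiles

IsΔ : ∀ {c} → Vec ℕ c → Set
IsΔ d = ∃[ i ] Vec.lookup d i ≡ 2 × (∀ j → j ≢ i → Vec.lookup d j ≡ 0)

-- 𝒞* M F is the condition written C*_M for F.
record 𝒞* {c : ℕ} (M : List (Vec ℕ c)) (F : ColoredGraph c) : Set where
  field
    degrees   : ∃[ L ] All IsΔ L × DS F ↭ M ++ L
    connected : ∀ i → Connected (colorSubgraph F i)

IsExtendedProfile : ∀ {c} → List (Vec ℕ c) → Graph → Set
IsExtendedProfile {c} M H =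
  ∀ F → F ∈𝒮 H ⇔ (Σ[ Fᶜ ∈ ColoredGraph c ] underlying Fᶜ ≅ F × 𝒞* M Fᶜ)

-- Position of a tuple entry, counted from 1.
index : ∀ {c} → Fin c → ℕ
index i = suc (toℕ i)

M¹ : (c : ℕ) → List (Vec ℕ c)
M¹ c = replicate 3 (Vec.tabulate λ j → if index j ≡ᵇ 1 then 2 else 1)

δ : ∀ {c} → Fin c → Vec ℕ c
δ i = Vec.tabulate λ j →
  if index j <ᵇ index i then 0 else
  if index j ≡ᵇ index i then index i + 1 else 1

-- Distinct i give distinct tuples, so each tuple occurs once.
M² : (c : ℕ) → List (Vec ℕ c)
M² c = map δ (filter (λ i → 2 ℕ.≤? index i) (allFin c))

M : (c : ℕ) → List (Vec ℕ c)
M c = M¹ c ++ M² c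

------------------------------------------------------------------------
-- Host graphs with ordered edges

record OrderedGraph : Set where
  field
    graph      : Graph
    size       : ℕ
    edge       : Fin size → Vertex graph × Vertex graph
    sound      : ∀ i → Adj graph (proj₁ (edge i)) (proj₂ (edge i))
    exhaustive : ∀ {u v} → Adj graph u v → ∃[ i ] (u , v) ≐ edge i
    distinct   : ∀ {i j} → edge i ≐ edge j → i ≡ j

  Incident : Vertex graph → Fin size → Set
  Incident u i = u ≡ proj₁ (edge i) ⊎ u ≡ proj₂ (edge i)

  incident? : ∀ u i → Dec (Incident u i)
  incident? u i = (u ≟ proj₁ (edge i)) ⊎-dec (u ≟ proj₂ (edge i))

  frontier : Fin size → List (Vertex graph)
  frontier i = filter
    (λ u → any? (λ j → (j <? i) ×-dec incident? u j) ×-dec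
           any? (λ j → (i ≤? j) ×-dec incident? u j))
    (allFin (Graph.order graph))

  maxFrontier : ℕ
  maxFrontier = max 0 (map (length ∘ frontier) (allFin size))

≐-unique : ∀ {n} {p q r : Fin n × Fin n} → p ≐ q → p ≐ r → q ≐ r
≐-unique (inj₁ (refl , refl)) s                    = s
≐-unique (inj₂ (refl , refl)) (inj₁ (refl , refl)) = inj₂ (refl , refl)
≐-unique (inj₂ (refl , refl)) (inj₂ (refl , refl)) = inj₁ (refl , refl)

module _ {c : ℕ} (G : OrderedGraph) (D : ColoredSubset c (Fin (OrderedGraph.size G))) where
  open OrderedGraph G
  open ColoredSubset D

  colorOf? : ∀ i p → Dec (∃[ e ] p ≐ edge e × T (part i e))
  colorOf? i p = any? λ e → (p ≐? edge e) ×-dec T? (part i e)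

  noLoop : ∀ {u} e → ¬ (u , u) ≐ edge e
  noLoop e (inj₁ (refl , q)) = Graph.adj-irrefl graph (subst (Adj graph (proj₁ (edge e))) (sym q) (sound e))
  noLoop e (inj₂ (refl , q)) = Graph.adj-irrefl graph (subst (λ x → Adj graph x (proj₂ (edge e))) (sym q) (sound e))

  -- All vertices of G, with only the edges in D.
  spanningSubgraph : ColoredGraph c
  spanningSubgraph = record
    { order        = Graph.order graph
    ; edges        = record
      { part     = λ i p → ⌊ colorOf? i p ⌋
      ; disjoint = λ {i} {j} {p} x y →
          let e , p≐e , e∈i = toWitness {a? = colorOf? i p} x
              f , p≐f , f∈j = toWitness {a? = colorOf? j p} y
          in disjoint (subst (T ∘ part i) (distinct {e} {f} (≐-unique p≐e p≐f)) e∈i) f∈j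
      }
    ; edges-sym    = λ {i} {u} {v} x →
        let e , p≐e , e∈i = toWitness {a? = colorOf? i (u , v)} x
        in fromWitness {a? = colorOf? i (v , u)} (e , ≐-swapˡ p≐e , e∈i)
    ; edges-irrefl = λ {i} {u} x →
        let e , p≐e , _ = toWitness {a? = colorOf? i (u , u)} x
        in noLoop e p≐e
    }

  coloredSubgraph : ColoredGraph c
  coloredSubgraph = coloredEdgeInduced spanningSubgraph

------------------------------------------------------------------------
-- Decision diagrams

data Node (s : ℕ) : Set where
  ⊤ₙ ⊥ₙ : Node s
  inner : Fin s → Node s

-- DD c m is the type of (c+1)-DDs over a set of m edges. The label condition
-- on arcs already makes the diagram acyclic. Uniqueness of the root is about
-- nodes without incoming arcs, the terminals excepted.
record DD (c m : ℕ) : Set where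
  field
    inners      : ℕ
    label       : Fin inners → Fin m
    arc         : Fin inners → Fin (suc c) → Node inners
    arc-label   : ∀ {α j β} → arc α j ≡ inner β → toℕ (label β) ≡ suc (toℕ (label α))
    root        : Node inners
    root-source : ∀ α j → arc α j ≢ root
    root-unique : ∀ α → inner α ≢ root → ∃[ β ] ∃[ j ] arc β j ≡ inner α

  data Path : Node inners → Set where
    end  : Path ⊤ₙ
    step : ∀ α j → Path (arc α j) → Path (inner α)

  -- The path uses the j-arc of some node labelled e.
  Uses : ∀ {ν} → Path ν → Fin (suc c) → Fin m → Set
  Uses end          j e = ⊥
  Uses (step α k p) j e = (k ≡ j × label α ≡ e) ⊎ Uses p j e

  _represents_ : ∀ {ν} → Path ν → ColoredSubset c (Fin m) → Set
  p represents B = ∀ j e → T (ColoredSubset.part B j e) ⇔ Uses p (suc j) e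

  Represents : (ColoredSubset c (Fin m) → Set) → Set
  Represents 𝓕 = ∀ B → 𝓕 B ⇔ (Σ[ p ∈ Path root ] p represents B)

  width : ℕ
  width = max 0 (map (λ i → length (filter (λ α → label α ≟ i) (allFin inners))) (allFin m))

module Submission where

-- Number the vertices of K_a from 0. Colour 1 is the triangle 0, 1, 2, and
-- colour i ≥ 2 is the star joining the vertex i + 1 to all smaller vertices.
-- This colouring has the degrees M, and subdividing a coloured edge only adds
-- an element of Δ. Conversely, a vertex of F outside M whose two neighbours are
-- not adjacent can be suppressed. If every such vertex lies on a triangle, then
-- counting the edges at the centre of its star shows that there is none, and
-- the degrees M force K_a.
--
-- The diagram is the minimal one: its nodes are the distinct residuals of the
-- family with respect to colourings of e₁, …, eᵢ₋₁. A nonempty residual is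
-- determined by the degrees and the components that the colouring induces on
-- the frontier, by the components that miss the frontier and by the elements of
-- M already used. An admissible degree has at most one entry above 1, so that
-- it takes O(a) bits, and components take a w log w bits. For w ≤ 1 the bound
-- is too small for this count, but the family is then empty, because the ends
-- of the first edge of colour 1 have a further edge each.

open import Defs
open import Data.Nat.Base using (_*_; _∸_; _^_; _≤_)
open import Data.Nat.Logarithm using (⌈log₂_⌉)
open import Data.Product using (Σ-syntax; ∃-syntax; _×_)
open import Data.Bool.Base using (Bool; true; false; T; if_then_else_; _∧_; _∨_)
open import Data.Bool.Properties as Bool using (T?; T-∧; T-∨)
open import Data.Empty using (⊥; ⊥-elim)
open import Data.Fin.Base using (Fin; zero; suc; toℕ; punchIn; punchOut; fromℕ<; inject≤; combine)
open import Data.Fin.Properties as Fin using (_≟_; any?; all?; punchIn-injective; punchInᵢ≢i; punchIn-punchOut)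
open import Data.List.Base as List using (List; []; _∷_; _++_; length; filter; map; allFin; tabulate; lookup; replicate; deduplicate; concat)
open import Data.List.Extrema.Nat using (max; max≤v⁺; xs≤max)
open import Data.List.Membership.Propositional using (_∈_)
import Data.List.Membership.DecPropositional as DecMembership
open import Data.List.Membership.Propositional.Properties
open import Data.List.Properties as List using (length-map; length-++; length-tabulate; filter-all; map-tabulate; map-++; ++-assoc)
open import Data.List.Relation.Binary.Permutation.Propositional using (_↭_; ↭-refl; ↭-trans; ↭-prep; ↭-sym; ↭-reflexive; ↭⇒↭ₛ; swap; module PermutationReasoning)
open import Data.List.Relation.Binary.Permutation.Propositional.Properties as ↭ using (∈-resp-↭; shift; ↭-length; ↭-map-inv; All-resp-↭)
import Data.List.Relation.Binary.Permutation.Setoid.Properties as ↭ₛ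
open import Data.List.Relation.Binary.Subset.Propositional using (_⊆_)
open import Data.List.Relation.Unary.All as All using (All; []; _∷_)
import Data.List.Relation.Unary.All.Properties as All
open import Data.List.Relation.Unary.AllPairs using ([]; _∷_)
open import Data.List.Relation.Unary.Any as Any using (here; there)
open import Data.List.Relation.Unary.Any.Properties using (lookup-index)
open import Data.List.Relation.Unary.Unique.Propositional using (Unique)
import Data.List.Relation.Unary.Unique.DecPropositional.Properties as DecUnique
import Data.List.Relation.Unary.Unique.Propositional.Properties as Unique
open import Data.Maybe.Base using (Maybe; just; nothing; fromMaybe)
open import Data.Nat.Base using (ℕ; zero; suc; _+_; _<_; s≤s; z≤n; _<ᵇ_; _≡ᵇ_; _⊔_; ⌈_/2⌉; ⌊_/2⌋; NonZero; >-nonZero)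
open import Data.Nat.Induction using (<-wellFounded)
open import Data.Nat.Logarithm using (⌈log₂⌉-mono-≤)
open import Data.Nat.Logarithm.Core using (⌈log2⌉)
import Data.Nat.Properties as ℕ
open import Data.Nat.Tactic.RingSolver using (solve-∀)
open import Data.Product using (∃; ∃₂; _,_; proj₁; proj₂)
import Data.Product.Properties as Product
open import Data.Sum.Base as Sum using (_⊎_; inj₁; inj₂; [_,_]′)
open import Data.Unit.Base using (tt)
open import Data.Vec.Base as Vec using (Vec)
import Data.Vec.Properties as Vec
open import Function.Base using (_∘_; id; _on_)
open import Function.Bundles using (_⇔_; Equivalence; mk⇔; mk↔ₛ′; Inverse)
open import Function.Definitions using (Injective)
open import Induction.WellFounded using (Acc; acc)
open import Level using (0ℓ)
open import Relation.Binary.Construct.Closure.ReflexiveTransitive using (Star; ε; _◅_; _◅◅_; gmap; reverse)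
open import Relation.Binary.Core using (Rel)
open import Relation.Binary.Definitions using (tri<; tri≈; tri>; DecidableEquality; Decidable; Symmetric)
open import Relation.Binary.PropositionalEquality
open import Relation.Nullary using (Dec; ¬_; contradiction; yes; no)
open import Relation.Nullary.Decidable using (⌊_⌋; _×-dec_; _⊎-dec_; _→-dec_; ¬?; toWitness; fromWitness; map′)
import Relation.Unary as U

-- Simplicity of graphs is the obstacle to the converse: a vertex whose two neighbours are adjacent
-- cannot be suppressed without doubling an edge. The edge that closes its triangle turns out to
-- have the colour of the other two, because two vertices of M are linked, directly or through the
-- vertex to be suppressed, in one colour only. The contradiction can therefore be sought inside a
-- single colour class. In a star the centre gets one neighbour too many; the first colour has no
-- centre, and there the triangle would be the whole class, with no room for the three vertices of M
-- that it must contain. In the diagram, connectedness has to be judged before all edges are read. A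
-- component that misses every edge still to come can never be joined to another one, so it must be
-- its whole colour class, and the colour can get no further edge. Hence two bits per colour suffice
-- beyond the partition of the frontier: whether such a component exists, and whether the colour is
-- connected so far.

private variable
  A B           : Set
  c k l n N N′ : ℕ

-- Counting

module _ {A : Set} where

  -- Each member of `xs` is cut out of `ys` where it occurs; by uniqueness the remaining members
  -- survive the cut. Later this splits the vertices into a distinguished list and the rest.
  Unique-complement : ∀ {xs ys : List A} → Unique xs → xs ⊆ ys → ∃[ zs ] ys ↭ xs ++ zs
  Unique-complement {ys = ys} [] _ = ys , ↭-refl
  Unique-complement {xs = x ∷ xs} (x∉ ∷ u) xs⊆ys with ∈-∃++ (xs⊆ys (here refl))
  ... | as , bs , refl =
    let zs , p = Unique-complement u λ {y} y∈ → drop-x y∈ (∈-resp-↭ (shift x as bs) (xs⊆ys (there y∈)))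
    in zs , ↭-trans (shift x as bs) (↭-prep x p)
    where
    drop-x : ∀ {y} → y ∈ xs → y ∈ x ∷ as ++ bs → y ∈ as ++ bs
    drop-x y∈ (here y≡x) = contradiction (sym y≡x) (All.lookup x∉ y∈)
    drop-x y∈ (there q)  = q

  Unique-length : ∀ {xs ys : List A} → Unique xs → xs ⊆ ys → length xs ≤ length ys
  Unique-length {xs} {ys} u s =
    let zs , p = Unique-complement u s
    in subst (length xs ≤_) (sym (trans (↭-length p) (length-++ xs))) (ℕ.m≤m+n _ _)

sat : (Fin n → Bool) → List (Fin n)
sat {n} P = filter (λ v → T? (P v)) (allFin n)

# : (Fin n → Bool) → ℕ
# P = length (sat P)

sat-unique : (P : Fin n → Bool) → Unique (sat P)
sat-unique {n} P = Unique.filter⁺ (T? ∘ P) {xs = allFin n} (Unique.allFin⁺ n)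

∈-sat⁺ : (P : Fin n → Bool) → ∀ {v} → T (P v) → v ∈ sat P
∈-sat⁺ P = ∈-filter⁺ (T? ∘ P) (∈-allFin _)

∈-sat⁻ : (P : Fin n → Bool) → ∀ {v} → v ∈ sat P → T (P v)
∈-sat⁻ {n} P = proj₂ ∘ ∈-filter⁻ (T? ∘ P) {xs = allFin n}

#-full : # {n} (λ _ → true) ≡ n
#-full {n} = trans (cong length (filter-all (λ _ → T? true) {xs = allFin n} (All.universal _ _))) (length-tabulate {n = n} id)

#-inj : (P : Fin l → Bool) (Q : Fin n → Bool) (f : Fin l → Fin n) → Injective _≡_ _≡_ f →
        (∀ i → T (P i) → T (Q (f i))) → # P ≤ # Q
#-inj P Q f inj PQ = subst (_≤ # Q) (length-map f (sat P))
  (Unique-length (Unique.map⁺ inj (sat-unique P)) λ v∈ →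
    let i , i∈ , eq = ∈-map⁻ f v∈ in subst (_∈ sat Q) (sym eq) (∈-sat⁺ Q (PQ i (∈-sat⁻ P i∈))))

#-sur : (P : Fin l → Bool) (Q : Fin n → Bool) (f : Fin l → Fin n) →
        (∀ v → T (Q v) → ∃[ i ] f i ≡ v × T (P i)) → # Q ≤ # P
#-sur P Q f QP = subst (# Q ≤_) (length-map f (sat P))
  (Unique-length (sat-unique Q) λ v∈ →
    let i , eq , p = QP _ (∈-sat⁻ Q v∈) in subst (_∈ map f (sat P)) eq (∈-map⁺ f (∈-sat⁺ P p)))

#-bij : (P : Fin l → Bool) (Q : Fin n → Bool) (f : Fin l → Fin n) → Injective _≡_ _≡_ f →
        (∀ i → T (P i) → T (Q (f i))) → (∀ v → T (Q v) → ∃[ i ] f i ≡ v × T (P i)) → # P ≡ # Q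
#-bij P Q f inj PQ QP = ℕ.≤-antisym (#-inj P Q f inj PQ) (#-sur P Q f QP)

#-cong : (P Q : Fin n → Bool) → (∀ v → T (P v) ⇔ T (Q v)) → # P ≡ # Q
#-cong P Q P⇔Q = #-bij P Q id id (Equivalence.to ∘ P⇔Q) λ v q → v , refl , Equivalence.from (P⇔Q v) q

#-≥ : (Q : Fin n → Bool) (g : Fin k → Fin n) → Injective _≡_ _≡_ g → (∀ j → T (Q (g j))) → k ≤ # Q
#-≥ Q g inj q = subst (_≤ # Q) #-full (#-inj (λ _ → true) Q g inj λ j _ → q j)

#-≤ : (Q : Fin n → Bool) (g : Fin k → Fin n) → (∀ v → T (Q v) → ∃[ j ] g j ≡ v) → # Q ≤ k
#-≤ Q g sur = subst (# Q ≤_) #-full (#-sur (λ _ → true) Q g λ v q → let j , eq = sur v q in j , eq , tt)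

#-enum : (Q : Fin n → Bool) (g : Fin k → Fin n) → Injective _≡_ _≡_ g → (∀ j → T (Q (g j))) →
         (∀ v → T (Q v) → ∃[ j ] g j ≡ v) → # Q ≡ k
#-enum Q g inj q sur = ℕ.≤-antisym (#-≤ Q g sur) (#-≥ Q g inj q)

#≡0 : (P : Fin n → Bool) → (∀ v → ¬ T (P v)) → # P ≡ 0
#≡0 P ¬p = ℕ.n≤0⇒n≡0 (#-≤ P (λ ()) λ v p → contradiction p (¬p v))

#≡0⁻ : (P : Fin n → Bool) → # P ≡ 0 → ∀ v → ¬ T (P v)
#≡0⁻ P eq v p = contradiction (subst (1 ≤_) eq (∈-length (∈-sat⁺ P p))) λ ()

#>0 : (P : Fin n → Bool) → 0 < # P → ∃[ v ] T (P v)
#>0 P lt with sat P in eq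
... | v ∷ _ = v , ∈-sat⁻ P (subst (v ∈_) (sym eq) (here refl))

#≡1 : (P : Fin n → Bool) → # P ≡ 1 → ∃[ u ] T (P u) × (∀ v → T (P v) → v ≡ u)
#≡1 P eq with sat P in e
#≡1 P refl | u ∷ [] = u , ∈-sat⁻ P (subst (u ∈_) (sym e) (here refl)) , λ v p → only (subst (v ∈_) e (∈-sat⁺ P p))
  where
  only : ∀ {v} → v ∈ u ∷ [] → v ≡ u
  only (here eq) = eq

#≡2 : (P : Fin n → Bool) → # P ≡ 2 →
      ∃₂ λ u v → u ≢ v × T (P u) × T (P v) × (∀ w → T (P w) → w ≡ u ⊎ w ≡ v)
#≡2 P eq with sat P in e | sat-unique P
#≡2 P refl | u ∷ v ∷ [] | (u≢v ∷ []) ∷ _ =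
  u , v , u≢v ,
  ∈-sat⁻ P (subst (u ∈_) (sym e) (here refl)) ,
  ∈-sat⁻ P (subst (v ∈_) (sym e) (there (here refl))) ,
  λ w p → only (subst (w ∈_) e (∈-sat⁺ P p))
  where
  only : ∀ {w} → w ∈ u ∷ v ∷ [] → w ≡ u ⊎ w ≡ v
  only (here eq)         = inj₁ eq
  only (there (here eq)) = inj₂ eq

#-⊎ : (P Q R : Fin n → Bool) → (∀ v → T (P v) ⇔ (T (Q v) ⊎ T (R v))) →
      (∀ v → T (Q v) → ¬ T (R v)) → # P ≡ # Q + # R
#-⊎ P Q R P⇔ dis = trans (ℕ.≤-antisym
  (Unique-length (sat-unique P) λ v∈ →
    [ ∈-++⁺ˡ ∘ ∈-sat⁺ Q , ∈-++⁺ʳ (sat Q) ∘ ∈-sat⁺ R ]′ (Equivalence.to (P⇔ _) (∈-sat⁻ P v∈)))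
  (Unique-length (Unique.++⁺ (sat-unique Q) (sat-unique R) λ (q , r) → dis _ (∈-sat⁻ Q q) (∈-sat⁻ R r)) λ v∈ →
    ∈-sat⁺ P (Equivalence.from (P⇔ _)
      (Sum.map (∈-sat⁻ Q) (∈-sat⁻ R) (∈-++⁻ (sat Q) v∈)))))
  (length-++ (sat Q))

-- If P failed at `g j`, the other k ∸ 1 values of g would still cover P, against the count. This is
-- how adjacency is read off from a degree.
#-full-cover : (P : Fin n → Bool) (g : Fin k → Fin n) → (∀ v → T (P v) → ∃[ j ] g j ≡ v) → # P ≡ k →
               ∀ j → T (P (g j))
#-full-cover {k = suc k} P g sur eq j with T? (P (g j))
... | yes p = p
... | no ¬p = contradiction (subst (_≤ k) eq (#-≤ P (g ∘ punchIn j) sur′)) ℕ.1+n≰n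
  where
  sur′ : ∀ v → T (P v) → ∃[ i ] g (punchIn j i) ≡ v
  sur′ v p with sur v p
  ... | i , refl = punchOut {i = j} {j = i} (λ { refl → ¬p p }) , cong g (punchIn-punchOut _)

-- The degrees in M

-- Connectedness of the graph formed by the edges and their endpoints: asking for an edge at both
-- ends replaces the passage to the list of non-isolated vertices.
ConnOn : (A → A → Set) → Set
ConnOn E = ∀ u v → ∃ (E u) → ∃ (E v) → Star E u v

module _ (f : A → B) (f-inj : Injective _≡_ _≡_ f) (E : B → B → Set) (E-sym : ∀ {u v} → E u v → E v u)
         (onto : ∀ {u v} → E u v → ∃[ a ] f a ≡ u) where

  Star-on : ∀ {u v a b} → f a ≡ u → f b ≡ v → Star E u v → Star (E on f) a b
  Star-on refl q ε with refl ← f-inj q = ε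
  Star-on refl q (e ◅ p) with d , refl ← onto (E-sym e) = e ◅ Star-on refl q p

  ConnOn-on : ConnOn E ⇔ ConnOn (E on f)
  ConnOn-on = mk⇔ (λ h a b (_ , e) (_ , e′) → Star-on refl refl (h (f a) (f b) (_ , e) (_ , e′))) from
    where
    from : ConnOn (E on f) → ConnOn E
    from h u v (_ , e) (_ , e′) with onto e | onto (E-sym e) | onto e′ | onto (E-sym e′)
    ... | a , refl | a′ , refl | b , refl | b′ , refl = gmap f id (h a b (a′ , e) (b′ , e′))

lookup-injective : {xs : List A} → Unique xs → Injective _≡_ _≡_ (lookup xs)
lookup-injective {xs = _ ∷ _} u {zero}  {zero}  eq = refl
lookup-injective (x∉ ∷ u) {zero}  {suc j} eq = contradiction eq (All.lookup x∉ (∈-lookup j))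
lookup-injective (x∉ ∷ u) {suc i} {zero}  eq = contradiction (sym eq) (All.lookup x∉ (∈-lookup i))
lookup-injective (x∉ ∷ u) {suc i} {suc j} eq = cong suc (lookup-injective u eq)

∈⇒lookup : {xs : List A} {x : A} → x ∈ xs → ∃[ i ] lookup xs i ≡ x
∈⇒lookup p = Any.index p , sym (lookup-index p)

module _ (G : Graph) where
  private
    adj? = λ u → any? λ v → T? (Graph.adj G u v)

  nonIsolated-unique : Unique (nonIsolated G)
  nonIsolated-unique = Unique.filter⁺ adj? {xs = allFin _} (Unique.allFin⁺ _)

  ∈-nonIsolated⁺ : ∀ {u v} → Adj G u v → u ∈ nonIsolated G
  ∈-nonIsolated⁺ e = ∈-filter⁺ adj? (∈-allFin _) (_ , e)

  ∈-nonIsolated⁻ : ∀ {u} → u ∈ nonIsolated G → ∃[ v ] Adj G u v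
  ∈-nonIsolated⁻ = proj₂ ∘ ∈-filter⁻ adj? {xs = allFin _}

  Connected-edgeInduced : Connected (edgeInduced G) ⇔ ConnOn (Adj G)
  Connected-edgeInduced = mk⇔
    (λ h → Equivalence.from onVs λ a b _ _ → h a b)
    (λ h a b → Star-on f f-inj (Adj G) (Graph.adj-sym G) onto refl refl
      (h (f a) (f b) (∈-nonIsolated⁻ (∈-lookup a)) (∈-nonIsolated⁻ (∈-lookup b))))
    where
    f = lookup (nonIsolated G)
    f-inj = lookup-injective nonIsolated-unique
    onto : ∀ {u v} → Adj G u v → ∃[ a ] f a ≡ u
    onto e = ∈⇒lookup (∈-nonIsolated⁺ e)
    onVs = ConnOn-on f f-inj (Adj G) (Graph.adj-sym G) onto

module ColoredGraphProperties {c : ℕ} (F : ColoredGraph c) where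
  open ColoredGraph F public

  V : Set
  V = Fin order

  E : Fin c → V → V → Set
  E γ u v = T (part γ (u , v))

  deg : Fin c → V → ℕ
  deg γ u = # λ v → part γ (u , v)

  lookup-coloredDegree : ∀ u γ → Vec.lookup (coloredDegree F u) γ ≡ deg γ u
  lookup-coloredDegree u γ = Vec.lookup∘tabulate _ γ

  Connected-colorSubgraph : ∀ γ → Connected (colorSubgraph F γ) ⇔ ConnOn (E γ)
  Connected-colorSubgraph γ = Connected-edgeInduced record
    { order = order ; adj = λ u v → part γ (u , v) ; adj-sym = edges-sym ; adj-irrefl = edges-irrefl }

-- The members of M (1 + n) other than the three copies of (2,1,…,1) are
-- δ i for i = 2, …, 1 + n; the k-th member, counted from 0, has the leading
-- entry at position k ∸ 2, counted from 0.
mdeg : Fin (3 + n) → Fin (suc n) → ℕ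
mdeg k γ = if toℕ γ <ᵇ toℕ k ∸ 2 then 0 else
           if toℕ γ ≡ᵇ toℕ k ∸ 2 then 2 + (toℕ k ∸ 2) else 1

M≡mdeg : ∀ n → M (suc n) ≡ map (Vec.tabulate ∘ mdeg) (allFin (3 + n))
M≡mdeg n = cong (M¹ (suc n) ++_) (begin
  map δ (filter (λ i → 2 ℕ.≤? index i) (allFin (suc n)))
    ≡⟨ cong (map δ) (filter-all (λ i → 2 ℕ.≤? index i) {xs = tabulate suc} (All.tabulate⁺ λ _ → s≤s (s≤s z≤n))) ⟩
  map δ (tabulate suc)
    ≡⟨ map-tabulate suc δ ⟩
  tabulate (δ ∘ suc)
    ≡⟨ List.tabulate-cong (λ i → Vec.tabulate-cong λ j →
         cong (λ x → if index j <ᵇ index (suc i) then 0 else if index j ≡ᵇ index (suc i) then x else 1)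
              (ℕ.+-comm (index (suc i)) 1)) ⟩
  tabulate (λ i → Vec.tabulate (mdeg (suc (suc (suc i)))))
    ≡⟨ map-tabulate +3 (Vec.tabulate ∘ mdeg) ⟨
  map (Vec.tabulate ∘ mdeg) (tabulate +3) ∎)
  where
  open ≡-Reasoning
  +3 : Fin n → Fin (3 + n)
  +3 i = suc (suc (suc i))

map-allFin : (f : Fin k → A) → map f (allFin k) ≡ tabulate f
map-allFin f = map-tabulate (λ i → i) f

-- The colour in which vertex k has its leading degree, `2 + lev k`. Truncated subtraction gives the
-- three triangle vertices the common level 0.
lev : Fin (3 + n) → ℕ
lev k = toℕ k ∸ 2

lev< : (k : Fin (3 + n)) → lev k < suc n
lev< k = s≤s (ℕ.∸-monoˡ-≤ 2 (Fin.toℕ≤pred[n] k))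

-- The centre of the star of colour γ; for the first colour it is just one of the triangle vertices,
-- which serves as a base point.
hub : Fin (suc n) → Fin (3 + n)
hub γ = suc (suc γ)

-- A positive level contains a single vertex, whereas level 0 is shared by three.
lev≡⇒hub : (k : Fin (3 + n)) (γ : Fin (suc n)) → 0 < toℕ γ → lev k ≡ toℕ γ → k ≡ hub γ
lev≡⇒hub zero          γ pos eq = contradiction (subst (0 <_) (sym eq) pos) λ ()
lev≡⇒hub (suc zero)    γ pos eq = contradiction (subst (0 <_) (sym eq) pos) λ ()
lev≡⇒hub (suc (suc k)) γ pos eq = cong hub (Fin.toℕ-injective eq)

module _ (k : Fin (3 + n)) (γ : Fin (suc n)) where

  mdeg-< : toℕ γ < lev k → mdeg k γ ≡ 0
  mdeg-< lt with toℕ γ <ᵇ lev k | ℕ.<⇒<ᵇ lt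
  ... | true | _ = refl

  private
    not-< : ∀ {i j} → ¬ i < j → (i <ᵇ j) ≡ false
    not-< {i} {j} ≮ with i <ᵇ j | ℕ.<ᵇ⇒< i j
    ... | false | _ = refl
    ... | true  | f = contradiction (f tt) ≮

    not-≡ : ∀ {i j} → i ≢ j → (i ≡ᵇ j) ≡ false
    not-≡ {i} {j} ≢ with i ≡ᵇ j | ℕ.≡ᵇ⇒≡ i j
    ... | false | _ = refl
    ... | true  | f = contradiction (f tt) ≢

    is-≡ : ∀ i → (i ≡ᵇ i) ≡ true
    is-≡ zero    = refl
    is-≡ (suc i) = is-≡ i

  mdeg-≡ : toℕ γ ≡ lev k → mdeg k γ ≡ 2 + (lev k)
  mdeg-≡ eq rewrite sym eq | not-< (ℕ.n≮n (toℕ γ)) | is-≡ (toℕ γ) = refl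

  mdeg-> : lev k < toℕ γ → mdeg k γ ≡ 1
  mdeg-> gt rewrite not-< (ℕ.<⇒≯ gt) | not-≡ (ℕ.>⇒≢ gt) = refl

  mdeg>0 : 0 < mdeg k γ → lev k ≤ toℕ γ
  mdeg>0 pos with toℕ γ ℕ.<? lev k
  ... | yes lt = contradiction (subst (0 <_) (mdeg-< lt) pos) λ ()
  ... | no ≮ = ℕ.≮⇒≥ ≮

-- 𝒞*, with the permutation replaced by an embedding of M into the vertices.
record Good {n} (F : ColoredGraph (suc n)) : Set where
  open ColoredGraphProperties F
  field
    mv     : Fin (3 + n) → V
    mv-inj : Injective _≡_ _≡_ mv
    degM   : ∀ k γ → deg γ (mv k) ≡ mdeg k γ
    other  : ∀ x → (∃[ k ] mv k ≡ x) ⊎ (∃[ γ ] deg γ x ≡ 2 × (∀ γ′ → γ′ ≢ γ → deg γ′ x ≡ 0))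
    conn   : ∀ γ → ConnOn (E γ)

Unique-++ˡ : ∀ {xs ys : List A} → Unique (xs ++ ys) → Unique xs
Unique-++ˡ {xs = []} _ = []
Unique-++ˡ {xs = x ∷ xs} (x∉ ∷ u) = All.++⁻ˡ xs x∉ ∷ Unique-++ˡ u

Unique-++-disjoint : ∀ {xs ys : List A} → Unique (xs ++ ys) → ∀ {x} → x ∈ xs → ¬ x ∈ ys
Unique-++-disjoint {xs = x ∷ xs} (x∉ ∷ u) (here refl) y∈ = All.lookup (All.++⁻ʳ xs x∉) y∈ refl
Unique-++-disjoint (_ ∷ u) (there x∈) y∈ = Unique-++-disjoint u x∈ y∈

tabulate-injective : {f : Fin n → A} → Unique (tabulate f) → Injective _≡_ _≡_ f
tabulate-injective {n = suc _} u {zero}  {zero}  eq = refl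
tabulate-injective (f∉ ∷ u) {zero}  {suc j} eq = contradiction eq (All.lookup f∉ (∈-tabulate⁺ j))
tabulate-injective (f∉ ∷ u) {suc i} {zero}  eq = contradiction (sym eq) (All.lookup f∉ (∈-tabulate⁺ i))
tabulate-injective (f∉ ∷ u) {suc i} {suc j} eq = cong suc (tabulate-injective u eq)

module _ {A B : Set} (f : A → B) where
  map-++⁻ : ∀ xs ys zs → map f xs ≡ ys ++ zs →
            ∃₂ λ us vs → xs ≡ us ++ vs × map f us ≡ ys × map f vs ≡ zs
  map-++⁻ xs [] zs eq = [] , xs , refl , refl , eq
  map-++⁻ (x ∷ xs) (y ∷ ys) zs eq =
    let e , es = List.∷-injective eq
        us , vs , p , q , r = map-++⁻ xs ys zs es
    in x ∷ us , vs , cong (x ∷_) p , cong₂ _∷_ e q , r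

  map-tabulate⁻ : ∀ {n xs} {g : Fin n → B} → map f xs ≡ tabulate g →
                  ∃[ h ] xs ≡ tabulate h × (∀ i → f (h i) ≡ g i)
  map-tabulate⁻ {zero}  {[]}     eq = (λ ()) , refl , λ ()
  map-tabulate⁻ {suc n} {x ∷ xs} eq =
    let e , es = List.∷-injective eq
        h , p , q = map-tabulate⁻ es
    in (λ { zero → x ; (suc i) → h i }) , cong (x ∷_) p , λ { zero → e ; (suc i) → q i }

Unique-resp-↭ : ∀ {xs ys : List A} → xs ↭ ys → Unique xs → Unique ys
Unique-resp-↭ p = ↭ₛ.Unique-resp-↭ (setoid _) (↭⇒↭ₛ p)

module _ {n : ℕ} {F : ColoredGraph (suc n)} where
  open ColoredGraphProperties F

  -- `↭-map-inv` lifts the permutation of degrees to one of the vertices. The part of the vertex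
  -- list that lies over M becomes `mv`, and the part over `L` consists of the vertices with a
  -- degree in Δ.
  𝒞*⇒Good : 𝒞* (M (suc n)) F → Good F
  𝒞*⇒Good h
    with L , allΔ , perm ← 𝒞*.degrees h
    with ys , eq , σ ← ↭-map-inv (coloredDegree F) perm
    with us , vs , refl , p , refl ← map-++⁻ (coloredDegree F) ys _ L (trans (sym eq) (cong (_++ L) (M≡mdeg n)))
    with mv , refl , mv-deg ← map-tabulate⁻ (coloredDegree F) {g = Vec.tabulate ∘ mdeg} (trans p (map-allFin (Vec.tabulate ∘ mdeg)))
    = record
    { mv = mv
    ; mv-inj = tabulate-injective {f = mv} (Unique-++ˡ (Unique-resp-↭ σ (Unique.allFin⁺ _)))
    ; degM = λ k γ → trans (sym (lookup-coloredDegree (mv k) γ))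
               (trans (cong (λ d → Vec.lookup d γ) (mv-deg k)) (Vec.lookup∘tabulate (mdeg k) γ))
    ; other = λ x → [ inj₁ ∘ isMv , inj₂ ∘ isΔ ]′ (∈-++⁻ (tabulate mv) (∈-resp-↭ σ (∈-allFin x)))
    ; conn = λ γ → Equivalence.to (Connected-colorSubgraph γ) (𝒞*.connected h γ)
    }
    where
    isMv : ∀ {x} → x ∈ tabulate mv → ∃[ k ] mv k ≡ x
    isMv x∈ = let k , e = ∈-tabulate⁻ {f = mv} x∈ in k , sym e
    isΔ : ∀ {x} → x ∈ vs → ∃[ γ ] deg γ x ≡ 2 × (∀ γ′ → γ′ ≢ γ → deg γ′ x ≡ 0)
    isΔ {x} x∈ =
      let γ , two , zeros = All.lookup (All.map⁻ allΔ) x∈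
      in γ , trans (sym (lookup-coloredDegree x γ)) two ,
         λ γ′ ne → trans (sym (lookup-coloredDegree x γ′)) (zeros γ′ ne)

  Good⇒𝒞* : Good F → 𝒞* (M (suc n)) F
  Good⇒𝒞* g = record
    { degrees = map (coloredDegree F) rest , All.map⁺ (All.tabulate isΔ) , (begin
        map (coloredDegree F) (allFin order)
          ↭⟨ ↭.map⁺ (coloredDegree F) (proj₂ compl) ⟩
        map (coloredDegree F) (tabulate mv ++ rest)
          ≡⟨ map-++ _ (tabulate mv) rest ⟩
        map (coloredDegree F) (tabulate mv) ++ map (coloredDegree F) rest
          ≡⟨ cong (_++ map (coloredDegree F) rest) mv-degrees ⟩
        M (suc n) ++ map (coloredDegree F) rest ∎)
    ; connected = λ γ → Equivalence.from (Connected-colorSubgraph γ) (conn γ)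
    }
    where
    open Good g
    open PermutationReasoning
    compl : ∃[ zs ] allFin order ↭ tabulate mv ++ zs
    compl = Unique-complement (Unique.tabulate⁺ {f = mv} mv-inj) λ _ → ∈-allFin _
    rest = proj₁ compl
    disjoint′ : ∀ {x} → x ∈ rest → ∀ k → mv k ≢ x
    disjoint′ x∈ k refl = Unique-++-disjoint (Unique-resp-↭ (proj₂ compl) (Unique.allFin⁺ _)) (∈-tabulate⁺ {f = mv} k) x∈
    isΔ : ∀ {x} → x ∈ rest → IsΔ (coloredDegree F x)
    isΔ {x} x∈ with other x
    ... | inj₁ (k , eq) = contradiction eq (disjoint′ x∈ k)
    ... | inj₂ (γ , two , zeros) = γ , trans (lookup-coloredDegree x γ) two ,
          λ γ′ ne → trans (lookup-coloredDegree x γ′) (zeros γ′ ne)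
    mv-degrees : map (coloredDegree F) (tabulate mv) ≡ M (suc n)
    mv-degrees = trans (map-tabulate mv (coloredDegree F))
      (trans (List.tabulate-cong λ k → Vec.tabulate-cong {g = mdeg k} λ γ → degM k γ)
      (sym (trans (M≡mdeg n) (map-allFin (Vec.tabulate ∘ mdeg)))))

-- Subdividing and suppressing

⌊⌋⁺ : {P : Set} (P? : Dec P) → P → T ⌊ P? ⌋
⌊⌋⁺ P? = fromWitness {a? = P?}

⌊⌋⁻ : {P : Set} (P? : Dec P) → T ⌊ P? ⌋ → P
⌊⌋⁻ P? = toWitness {a? = P?}

module _ (F : ColoredGraph c) where
  open ColoredGraphProperties F

  Adj-underlying : ∀ u v → Adj (underlying F) u v ⇔ (∃[ i ] E i u v)
  Adj-underlying u v = mk⇔ (⌊⌋⁻ (colored? F u v)) (⌊⌋⁺ (colored? F u v))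

≅-sym : ∀ {G H} → G ≅ H → H ≅ G
≅-sym {G} {H} φ = record
  { bijection = mk↔ₛ′ from to strictlyInverseʳ strictlyInverseˡ
  ; preserves = λ u v → mk⇔
      (λ e → Equivalence.from (preserves (from u) (from v))
        (subst₂ (Adj H) (sym (strictlyInverseˡ u)) (sym (strictlyInverseˡ v)) e))
      (λ e → subst₂ (Adj H) (strictlyInverseˡ u) (strictlyInverseˡ v) (Equivalence.to (preserves (from u) (from v)) e))
  }
  where
  open _≅_ φ using (bijection; preserves)
  open Inverse bijection

≅-trans : ∀ {G H K} → G ≅ H → H ≅ K → G ≅ K
≅-trans φ ψ = record
  { bijection = mk↔ₛ′ (ψ.to ∘ φ.to) (φ.from ∘ ψ.from)
      (λ y → trans (cong ψ.to (φ.strictlyInverseˡ _)) (ψ.strictlyInverseˡ y))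
      (λ x → trans (cong φ.from (ψ.strictlyInverseʳ _)) (φ.strictlyInverseʳ x))
  ; preserves = λ u v → mk⇔
      (Equivalence.to (_≅_.preserves ψ _ _) ∘ Equivalence.to (_≅_.preserves φ u v))
      (Equivalence.from (_≅_.preserves φ u v) ∘ Equivalence.from (_≅_.preserves ψ _ _))
  }
  where
  module φ = Inverse (_≅_.bijection φ)
  module ψ = Inverse (_≅_.bijection ψ)

module _ {G H : Graph} (φ : G ≅ H) (u v : Vertex G) where
  open _≅_ φ using (bijection; preserves)
  open Inverse bijection

  private
    to-inj : ∀ {x y} → to x ≡ to y → x ≡ y
    to-inj {x} {y} e = trans (sym (strictlyInverseʳ x)) (trans (cong from e) (strictlyInverseʳ y))

    to⁺ : Fin (suc (Graph.order G)) → Fin (suc (Graph.order H))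
    to⁺ zero    = zero
    to⁺ (suc x) = suc (to x)

    from⁺ : Fin (suc (Graph.order H)) → Fin (suc (Graph.order G))
    from⁺ zero    = zero
    from⁺ (suc x) = suc (from x)

    ends : ∀ x → T ⌊ (x ≟ u) ⊎-dec (x ≟ v) ⌋ ⇔ T ⌊ (to x ≟ to u) ⊎-dec (to x ≟ to v) ⌋
    ends x = mk⇔
      (⌊⌋⁺ ((to x ≟ to u) ⊎-dec (to x ≟ to v)) ∘ Sum.map (cong to) (cong to) ∘ ⌊⌋⁻ ((x ≟ u) ⊎-dec (x ≟ v)))
      (⌊⌋⁺ ((x ≟ u) ⊎-dec (x ≟ v)) ∘ Sum.map to-inj to-inj ∘ ⌊⌋⁻ ((to x ≟ to u) ⊎-dec (to x ≟ to v)))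

    ≐-to⁺ : ∀ {x y} → (x , y) ≐ (u , v) → (to x , to y) ≐ (to u , to v)
    ≐-to⁺ = Sum.map (λ (p , q) → cong to p , cong to q) (λ (p , q) → cong to p , cong to q)

    ≐-to⁻ : ∀ {x y} → (to x , to y) ≐ (to u , to v) → (x , y) ≐ (u , v)
    ≐-to⁻ = Sum.map (λ (p , q) → to-inj p , to-inj q) (λ (p , q) → to-inj p , to-inj q)

    preserves⁺ : ∀ x y → Adj (subdivide G u v) x y ⇔ Adj (subdivide H (to u) (to v)) (to⁺ x) (to⁺ y)
    preserves⁺ zero    zero    = mk⇔ id id
    preserves⁺ zero    (suc y) = ends y
    preserves⁺ (suc x) zero    = ends x
    preserves⁺ (suc x) (suc y) = mk⇔
      (λ p → let q , r = Equivalence.to T-∧ p in Equivalence.from T-∧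
        (Equivalence.to (preserves x y) q ,
         ⌊⌋⁺ (¬? ((to x , to y) ≐? (to u , to v))) (⌊⌋⁻ (¬? ((x , y) ≐? (u , v))) r ∘ ≐-to⁻)))
      (λ p → let q , r = Equivalence.to T-∧ p in Equivalence.from T-∧
        (Equivalence.from (preserves x y) q ,
         ⌊⌋⁺ (¬? ((x , y) ≐? (u , v))) (⌊⌋⁻ (¬? ((to x , to y) ≐? (to u , to v))) r ∘ ≐-to⁺)))

  subdivide-≅ : subdivide G u v ≅ subdivide H (to u) (to v)
  subdivide-≅ = record
    { bijection = mk↔ₛ′ to⁺ from⁺
        (λ { zero → refl ; (suc y) → cong suc (strictlyInverseˡ y) })
        (λ { zero → refl ; (suc x) → cong suc (strictlyInverseʳ x) })
    ; preserves = preserves⁺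
    }

-- F arises from F′ by subdividing the edge {u , v} of colour γ; the new
-- vertex is x, and ι embeds the old ones.
record Subdivided (F′ F : ColoredGraph c) (γ : Fin c) (u v : Fin (ColoredGraph.order F′)) : Set where
  private
    module F′ = ColoredGraphProperties F′
    module F  = ColoredGraphProperties F
  field
    x     : F.V
    ι     : F′.V → F.V
    ι-inj : Injective _≡_ _≡_ ι
    ι≢x   : ∀ p → ι p ≢ x
    view  : ∀ y → y ≡ x ⊎ (∃[ p ] ι p ≡ y)
    edge  : F′.E γ u v
    old   : ∀ i p q → F.E i (ι p) (ι q) ⇔ (F′.E i p q × ¬ (p , q) ≐ (u , v))
    new   : ∀ i q → F.E i (ι q) x ⇔ (i ≡ γ × (q ≡ u ⊎ q ≡ v))

module SubdividedProperties {F′ F : ColoredGraph c} {γ : Fin c} {u v} (S : Subdivided F′ F γ u v) where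
  open Subdivided S
  private
    module F′ = ColoredGraphProperties F′
    module F  = ColoredGraphProperties F

  u≢v : u ≢ v
  u≢v refl = F′.edges-irrefl edge

  private
    ≐⇒γ : ∀ {i p q} → F′.E i p q → (p , q) ≐ (u , v) → i ≡ γ
    ≐⇒γ e (inj₁ (refl , refl)) = F′.disjoint e edge
    ≐⇒γ e (inj₂ (refl , refl)) = F′.disjoint (F′.edges-sym e) edge

  deg-other : ∀ i p → ¬ (i ≡ γ × (p ≡ u ⊎ p ≡ v)) → F.deg i (ι p) ≡ F′.deg i p
  deg-other i p ¬e = sym (#-bij (λ q → F′.part i (p , q)) (λ q → F.part i (ι p , q)) ι ι-inj
    (λ q e → Equivalence.from (old i p q) (e , λ r → ¬e (≐⇒γ e r , Sum.map proj₁ proj₁ r)))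
    onto)
    where
    onto : ∀ y → F.E i (ι p) y → ∃[ q ] ι q ≡ y × F′.E i p q
    onto y e with view y
    ... | inj₁ refl       = contradiction (Equivalence.to (new i p) e) ¬e
    ... | inj₂ (q , refl) = q , refl , proj₁ (Equivalence.to (old i p q) e)

  -- At u the new vertex takes the place of v, so the neighbours correspond under the map that sends
  -- v to `x` and is `ι` elsewhere.
  deg-end : F.deg γ (ι u) ≡ F′.deg γ u
  deg-end = sym (#-bij (λ q → F′.part γ (u , q)) (λ q → F.part γ (ι u , q)) f f-inj there′ onto)
    where
    f : F′.V → F.V
    f q with q ≟ v
    ... | yes _ = x
    ... | no  _ = ι q

    f-inj : Injective _≡_ _≡_ f
    f-inj {p} {q} eq with p ≟ v | q ≟ v
    ... | yes refl | yes refl = refl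
    ... | yes refl | no _     = contradiction (sym eq) (ι≢x q)
    ... | no _     | yes refl = contradiction eq (ι≢x p)
    ... | no _     | no _     = ι-inj eq

    there′ : ∀ q → F′.E γ u q → F.E γ (ι u) (f q)
    there′ q e with q ≟ v
    ... | yes _  = Equivalence.from (new γ u) (refl , inj₁ refl)
    ... | no q≢v = Equivalence.from (old γ u q) (e , λ { (inj₁ (_ , r)) → q≢v r ; (inj₂ (r , _)) → u≢v r })

    f-other : ∀ {q} → q ≢ v → f q ≡ ι q
    f-other {q} q≢v with q ≟ v
    ... | yes r = contradiction r q≢v
    ... | no  _ = refl

    f-v : f v ≡ x
    f-v with v ≟ v
    ... | yes _ = refl
    ... | no  r = contradiction refl r

    onto : ∀ y → F.E γ (ι u) y → ∃[ q ] f q ≡ y × F′.E γ u q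
    onto y e with view y
    ... | inj₁ refl       = v , f-v , edge
    ... | inj₂ (q , refl) = let e′ , ≄ = Equivalence.to (old γ u q) e in
                            q , f-other (λ r → ≄ (inj₁ (refl , r))) , e′

  deg-new : F.deg γ x ≡ 2
  deg-new = #-enum (λ y → F.part γ (x , y)) g g-inj
    (λ { zero → F.edges-sym (Equivalence.from (new γ u) (refl , inj₁ refl))
       ; (suc zero) → F.edges-sym (Equivalence.from (new γ v) (refl , inj₂ refl)) })
    onto
    where
    g : Fin 2 → F.V
    g zero       = ι u
    g (suc zero) = ι v

    g-inj : Injective _≡_ _≡_ g
    g-inj {zero}     {zero}     _  = refl
    g-inj {zero}     {suc zero} eq = contradiction (ι-inj eq) u≢v
    g-inj {suc zero} {zero}     eq = contradiction (sym (ι-inj eq)) u≢v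
    g-inj {suc zero} {suc zero} _  = refl

    onto : ∀ y → F.E γ x y → ∃[ j ] g j ≡ y
    onto y e with view y
    ... | inj₁ refl = contradiction e F.edges-irrefl
    ... | inj₂ (q , refl) with Equivalence.to (new γ q) (F.edges-sym e)
    ...   | _ , inj₁ refl = zero , refl
    ...   | _ , inj₂ refl = suc zero , refl

  deg-new′ : ∀ i → i ≢ γ → F.deg i x ≡ 0
  deg-new′ i i≢γ = #≡0 (λ y → F.part i (x , y)) λ y e → [ (λ { refl → F.edges-irrefl e }) ,
    (λ { (q , refl) → i≢γ (proj₁ (Equivalence.to (new i q) (F.edges-sym e))) }) ]′ (view y)

  Star⁺ : ∀ {i p q} → Star (F′.E i) p q → Star (F.E i) (ι p) (ι q)
  Star⁺ ε = ε
  Star⁺ {i} {p} (_◅_ {j = r} e es) with (p , r) ≐? (u , v)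
  ... | no ≄ = Equivalence.from (old i p r) (e , ≄) ◅ Star⁺ es
  ... | yes ≐ with refl ← ≐⇒γ e ≐ =
        Equivalence.from (new γ p) (refl , Sum.map proj₁ proj₁ ≐) ◅
        F.edges-sym (Equivalence.from (new γ r) (refl , [ inj₂ ∘ proj₂ , inj₁ ∘ proj₂ ]′ ≐)) ◅ Star⁺ es

  private
    end→u : ∀ {p} → p ≡ u ⊎ p ≡ v → Star (F′.E γ) p u
    end→u (inj₁ refl) = ε
    end→u (inj₂ refl) = F′.edges-sym edge ◅ ε

    u→end : ∀ {p} → p ≡ u ⊎ p ≡ v → Star (F′.E γ) u p
    u→end (inj₁ refl) = ε
    u→end (inj₂ refl) = edge ◅ ε

  mutual
    -- A walk in F is replayed in F′. While it stands on `x`, the copy waits at u; the subdivided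
    -- edge connects u with whichever end the walk enters or leaves by.
    Star⁻ : ∀ {i y p q} → ι p ≡ y → Star (F.E i) y (ι q) → Star (F′.E i) p q
    Star⁻ eq ε with refl ← ι-inj eq = ε
    Star⁻ {i} {p = p} refl (_◅_ {j = z} e es) with view z
    ... | inj₁ refl with refl , end ← Equivalence.to (new i p) e = end→u end ◅◅ Starˣ es
    ... | inj₂ (r , refl) = proj₁ (Equivalence.to (old i p r) e) ◅ Star⁻ refl es

    Starˣ : ∀ {q} → Star (F.E γ) x (ι q) → Star (F′.E γ) u q
    Starˣ es = Starˣ′ refl es

    Starˣ′ : ∀ {y q} → y ≡ x → Star (F.E γ) y (ι q) → Star (F′.E γ) u q
    Starˣ′ {q = q} eq ε = contradiction eq (ι≢x q)
    Starˣ′ refl (_◅_ {j = z} e es) with view z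
    ... | inj₁ refl = contradiction e F.edges-irrefl
    ... | inj₂ (r , refl) = u→end (proj₂ (Equivalence.to (new γ r) (F.edges-sym e))) ◅◅ Star⁻ refl es

  neighbour⁺ : ∀ {i p} → ∃ (F′.E i p) → ∃ (F.E i (ι p))
  neighbour⁺ {i} {p} (q , e) with (p , q) ≐? (u , v)
  ... | no ≄ = ι q , Equivalence.from (old i p q) (e , ≄)
  ... | yes ≐ with refl ← ≐⇒γ e ≐ = x , Equivalence.from (new γ p) (refl , Sum.map proj₁ proj₁ ≐)

  neighbour⁻ : ∀ {i p} → ∃ (F.E i (ι p)) → ∃ (F′.E i p)
  neighbour⁻ {i} {p} (y , e) with view y
  ... | inj₂ (q , refl) = q , proj₁ (Equivalence.to (old i p q) e)
  ... | inj₁ refl with Equivalence.to (new i p) e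
  ...   | refl , inj₁ refl = v , edge
  ...   | refl , inj₂ refl = u , F′.edges-sym edge

  ConnOn⁻ : ∀ {i} → ConnOn (F.E i) → ConnOn (F′.E i)
  ConnOn⁻ h p q np nq = Star⁻ refl (h (ι p) (ι q) (neighbour⁺ np) (neighbour⁺ nq))

  private
    reach : ∀ {i} y → ∃ (F.E i y) → ∃[ p ] ∃ (F′.E i p) × Star (F.E i) y (ι p)
    reach {i} y (z , e) with view y
    ... | inj₂ (p , refl) = p , neighbour⁻ (z , e) , ε
    ... | inj₁ refl with view z
    ...   | inj₁ refl       = contradiction e F.edges-irrefl
    ...   | inj₂ (p , refl) = p , neighbour⁻ (x , F.edges-sym e) , e ◅ ε

  ConnOn⁺ : ∀ {i} → ConnOn (F′.E i) → ConnOn (F.E i)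
  ConnOn⁺ h y z ny nz =
    let p , np , y→p = reach y ny
        q , nq , z→q = reach z nz
    in y→p ◅◅ Star⁺ (h p q np nq) ◅◅ reverse F.edges-sym z→q

  underlying-≅ : underlying F ≅ subdivide (underlying F′) u v
  underlying-≅ = record
    { bijection = mk↔ₛ′ to from to-from from-to
    ; preserves = preserves
    }
    where
    to : F.V → Fin (suc F′.order)
    to y = [ (λ _ → zero) , suc ∘ proj₁ ]′ (view y)

    from : Fin (suc F′.order) → F.V
    from zero    = x
    from (suc p) = ι p

    to-from : ∀ y → to (from y) ≡ y
    to-from zero with view x
    ... | inj₁ _        = refl
    ... | inj₂ (p , eq) = contradiction eq (ι≢x p)
    to-from (suc p) with view (ι p)
    ... | inj₁ eq       = contradiction eq (ι≢x p)
    ... | inj₂ (q , eq) = cong suc (ι-inj eq)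

    from-to : ∀ y → from (to y) ≡ y
    from-to y with view y
    ... | inj₁ refl       = refl
    ... | inj₂ (p , refl) = refl

    newAdj : ∀ q → (∃[ i ] F.E i (ι q) x) ⇔ T ⌊ (q ≟ u) ⊎-dec (q ≟ v) ⌋
    newAdj q = mk⇔
      (λ (i , e) → ⌊⌋⁺ ((q ≟ u) ⊎-dec (q ≟ v)) (proj₂ (Equivalence.to (new i q) e)))
      (λ t → γ , Equivalence.from (new γ q) (refl , ⌊⌋⁻ ((q ≟ u) ⊎-dec (q ≟ v)) t))

    preserves : ∀ y z → Adj (underlying F) y z ⇔ Adj (subdivide (underlying F′) u v) (to y) (to z)
    preserves y z with view y | view z
    ... | inj₁ refl | inj₁ refl = mk⇔ (λ a → F.edges-irrefl (proj₂ (Equivalence.to (Adj-underlying F y z) a))) ⊥-elim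
    ... | inj₁ refl | inj₂ (q , refl) = mk⇔
          (λ a → let i , e = Equivalence.to (Adj-underlying F y z) a in Equivalence.to (newAdj q) (i , F.edges-sym e))
          (λ t → let i , e = Equivalence.from (newAdj q) t in Equivalence.from (Adj-underlying F y z) (i , F.edges-sym e))
    ... | inj₂ (p , refl) | inj₁ refl = mk⇔
          (Equivalence.to (newAdj p) ∘ Equivalence.to (Adj-underlying F y z))
          (Equivalence.from (Adj-underlying F y z) ∘ Equivalence.from (newAdj p))
    ... | inj₂ (p , refl) | inj₂ (q , refl) = mk⇔
          (λ a → let i , e = Equivalence.to (Adj-underlying F y z) a
                     e′ , ≄ = Equivalence.to (old i p q) e
                 in Equivalence.from T-∧ (Equivalence.from (Adj-underlying F′ p q) (i , e′) , ⌊⌋⁺ (¬? ((p , q) ≐? (u , v))) ≄))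
          (λ t → let a , ≄ = Equivalence.to T-∧ t
                     i , e′ = Equivalence.to (Adj-underlying F′ p q) a
                 in Equivalence.from (Adj-underlying F y z) (i ,
                      Equivalence.from (old i p q) (e′ , ⌊⌋⁻ (¬? ((p , q) ≐? (u , v))) ≄)))

-- Makes `deg-end` available at v as well.
Subdivided-swap : ∀ {F′ F : ColoredGraph c} {γ u v} → Subdivided F′ F γ u v → Subdivided F′ F γ v u
Subdivided-swap {F′ = F′} S = record
  { x = x ; ι = ι ; ι-inj = ι-inj ; ι≢x = ι≢x ; view = view ; edge = ColoredGraph.edges-sym F′ edge
  ; old = λ i p q → mk⇔ (λ e → let e′ , ≄ = Equivalence.to (old i p q) e in e′ , ≄ ∘ Sum.swap)
                        (λ (e′ , ≄) → Equivalence.from (old i p q) (e′ , ≄ ∘ Sum.swap))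
  ; new = λ i q → mk⇔ (λ e → let r , s = Equivalence.to (new i q) e in r , Sum.swap s)
                      (λ (r , s) → Equivalence.from (new i q) (r , Sum.swap s))
  }
  where open Subdivided S

module _ {F′ F : ColoredGraph (suc n)} {γ u v} (S : Subdivided F′ F γ u v) where
  open Subdivided S
  open SubdividedProperties S
  private
    module F′ = ColoredGraphProperties F′
    module F  = ColoredGraphProperties F

  deg-old : ∀ i p → F.deg i (ι p) ≡ F′.deg i p
  deg-old i p with i ≟ γ | p ≟ u | p ≟ v
  ... | no i≢γ   | _        | _        = deg-other i p (i≢γ ∘ proj₁)
  ... | yes refl | yes refl | _        = deg-end
  ... | yes refl | no _     | yes refl = SubdividedProperties.deg-end (Subdivided-swap S)
  ... | yes refl | no p≢u   | no p≢v   = deg-other i p ([ p≢u , p≢v ]′ ∘ proj₂)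

  Good⁺ : Good F′ → Good F
  Good⁺ g = record
    { mv = ι ∘ mv
    ; mv-inj = mv-inj ∘ ι-inj
    ; degM = λ k i → trans (deg-old i (mv k)) (degM k i)
    ; other = other′
    ; conn = λ i → ConnOn⁺ (conn i)
    }
    where
    open Good g
    other′ : ∀ y → (∃[ k ] ι (mv k) ≡ y) ⊎ (∃[ i ] F.deg i y ≡ 2 × (∀ i′ → i′ ≢ i → F.deg i′ y ≡ 0))
    other′ y with view y
    ... | inj₁ refl = inj₂ (γ , deg-new , deg-new′)
    ... | inj₂ (p , refl) with other p
    ...   | inj₁ (k , refl)        = inj₁ (k , refl)
    ...   | inj₂ (i , two , zeros) = inj₂ (i , trans (deg-old i p) two , λ i′ ne → trans (deg-old i′ p) (zeros i′ ne))

  Good⁻ : (g : Good F) → (∀ k → Good.mv g k ≢ x) → Good F′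
  Good⁻ g mv≢x = record
    { mv = mv′
    ; mv-inj = λ {k} {l} eq → mv-inj (trans (sym (ι-mv′ k)) (trans (cong ι eq) (ι-mv′ l)))
    ; degM = λ k i → trans (sym (deg-old i (mv′ k))) (trans (cong (F.deg i) (ι-mv′ k)) (degM k i))
    ; other = other′
    ; conn = λ i → ConnOn⁻ (conn i)
    }
    where
    open Good g
    lower : ∀ k → ∃[ p ] ι p ≡ mv k
    lower k = [ (λ eq → contradiction eq (mv≢x k)) , id ]′ (view (mv k))
    mv′ : Fin (3 + n) → F′.V
    mv′ k = proj₁ (lower k)
    ι-mv′ : ∀ k → ι (mv′ k) ≡ mv k
    ι-mv′ k = proj₂ (lower k)
    other′ : ∀ p → (∃[ k ] mv′ k ≡ p) ⊎ (∃[ i ] F′.deg i p ≡ 2 × (∀ i′ → i′ ≢ i → F′.deg i′ p ≡ 0))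
    other′ p with other (ι p)
    ... | inj₁ (k , eq)          = inj₁ (k , ι-inj (trans (ι-mv′ k) eq))
    ... | inj₂ (i , two , zeros) = inj₂ (i , trans (sym (deg-old i p)) two ,
                                             λ i′ ne → trans (sym (deg-old i′ p)) (zeros i′ ne))

module _ (F′ : ColoredGraph c) (γ : Fin c) (u v : Fin (ColoredGraph.order F′)) (e : T (ColoredGraph.part F′ γ (u , v))) where
  open ColoredGraphProperties F′

  private
    ends? : ∀ i p → Dec (i ≡ γ × (p ≡ u ⊎ p ≡ v))
    ends? i p = (i ≟ γ) ×-dec ((p ≟ u) ⊎-dec (p ≟ v))

    part⁺ : Fin c → Fin (suc order) × Fin (suc order) → Bool
    part⁺ i (zero  , zero)  = false
    part⁺ i (zero  , suc q) = ⌊ ends? i q ⌋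
    part⁺ i (suc p , zero)  = ⌊ ends? i p ⌋
    part⁺ i (suc p , suc q) = part i (p , q) ∧ ⌊ ¬? ((p , q) ≐? (u , v)) ⌋

    disjoint⁺ : ∀ {i j} pq → T (part⁺ i pq) → T (part⁺ j pq) → i ≡ j
    disjoint⁺ {i} {j} (zero  , suc q) a b = trans (proj₁ (⌊⌋⁻ (ends? i q) a)) (sym (proj₁ (⌊⌋⁻ (ends? j q) b)))
    disjoint⁺ {i} {j} (suc p , zero)  a b = trans (proj₁ (⌊⌋⁻ (ends? i p) a)) (sym (proj₁ (⌊⌋⁻ (ends? j p) b)))
    disjoint⁺ (suc p , suc q) a b = disjoint (proj₁ (Equivalence.to T-∧ a)) (proj₁ (Equivalence.to T-∧ b))

    sym⁺ : ∀ {i} x y → T (part⁺ i (x , y)) → T (part⁺ i (y , x))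
    sym⁺ zero    (suc q) a = a
    sym⁺ (suc p) zero    a = a
    sym⁺ (suc p) (suc q) a =
      let b , ≄ = Equivalence.to T-∧ a
      in Equivalence.from T-∧ (edges-sym b , ⌊⌋⁺ (¬? ((q , p) ≐? (u , v))) (⌊⌋⁻ (¬? ((p , q) ≐? (u , v))) ≄ ∘ ≐-swapˡ))

    irrefl⁺ : ∀ {i} x → ¬ T (part⁺ i (x , x))
    irrefl⁺ (suc p) a = edges-irrefl (proj₁ (Equivalence.to T-∧ a))

  subdivideEdge : ColoredGraph c
  subdivideEdge = record
    { order = suc order
    ; edges = record { part = part⁺ ; disjoint = λ {i} {j} {pq} → disjoint⁺ {i} {j} pq }
    ; edges-sym = λ {i} {x} {y} → sym⁺ {i} x y
    ; edges-irrefl = λ {i} {x} → irrefl⁺ {i} x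
    }

  subdivideEdge-Subdivided : Subdivided F′ subdivideEdge γ u v
  subdivideEdge-Subdivided = record
    { x = zero ; ι = suc ; ι-inj = Fin.suc-injective ; ι≢x = λ _ ()
    ; view = λ { zero → inj₁ refl ; (suc p) → inj₂ (p , refl) }
    ; edge = e
    ; old = λ i p q → mk⇔
        (λ a → let b , ≄ = Equivalence.to T-∧ a in b , ⌊⌋⁻ (¬? ((p , q) ≐? (u , v))) ≄)
        (λ (b , ≄) → Equivalence.from T-∧ (b , ⌊⌋⁺ (¬? ((p , q) ≐? (u , v))) ≄))
    ; new = λ i q → mk⇔ (⌊⌋⁻ (ends? i q)) (⌊⌋⁺ (ends? i q))
    }

module _ {N c : ℕ} (edges : ColoredSubset c (Fin (suc N) × Fin (suc N))) where
  open ColoredSubset edges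
  module _ (edges-sym : ∀ {i u v} → T (part i (u , v)) → T (part i (v , u)))
           (edges-irrefl : ∀ {i u} → ¬ T (part i (u , u)))
           (x : Fin (suc N)) (γ : Fin c) (u v : Fin N) (u≢v : u ≢ v)
           (nonadj : ∀ i → ¬ T (part i (punchIn x u , punchIn x v)))
           (nbrs : ∀ i q → T (part i (punchIn x q , x)) ⇔ (i ≡ γ × (q ≡ u ⊎ q ≡ v))) where

    private
      ι = punchIn x

      F : ColoredGraph c
      F = record { order = suc N ; edges = edges ; edges-sym = λ {i} → edges-sym {i} ; edges-irrefl = λ {i} → edges-irrefl {i} }

      uv? : ∀ i pq → Dec (i ≡ γ × pq ≐ (u , v))
      uv? i pq = (i ≟ γ) ×-dec (pq ≐? (u , v))

      part⁻ : Fin c → Fin N × Fin N → Bool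
      part⁻ i (p , q) = part i (ι p , ι q) ∨ ⌊ uv? i (p , q) ⌋

      split : ∀ i p q → T (part⁻ i (p , q)) → T (part i (ι p , ι q)) ⊎ (i ≡ γ × (p , q) ≐ (u , v))
      split i p q = Sum.map₂ (⌊⌋⁻ (uv? i (p , q))) ∘ Equivalence.to T-∨

      unite : ∀ i p q → T (part i (ι p , ι q)) ⊎ (i ≡ γ × (p , q) ≐ (u , v)) → T (part⁻ i (p , q))
      unite i p q = Equivalence.from T-∨ ∘ Sum.map₂ (⌊⌋⁺ (uv? i (p , q)))

      nonadj′ : ∀ {i p q} → (p , q) ≐ (u , v) → ¬ T (part i (ι p , ι q))
      nonadj′ {i} (inj₁ (refl , refl)) = nonadj i
      nonadj′ {i} (inj₂ (refl , refl)) = nonadj i ∘ edges-sym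

    -- The new edge between u and v gets colour γ. By `nonadj` it coincides with no old edge, which
    -- keeps the colour classes disjoint and lets subdividing it give back F.
    suppress : ColoredGraph c
    suppress = record
      { order = N
      ; edges = record
        { part = part⁻
        ; disjoint = λ {i} {j} {(p , q)} a b → dis (split i p q a) (split j p q b)
        }
      ; edges-sym = λ {i} {p} {q} → unite i q p ∘ Sum.map edges-sym (λ (r , s) → r , ≐-swapˡ s) ∘ split i p q
      ; edges-irrefl = λ {i} {p} → [ edges-irrefl , (λ { (_ , inj₁ (r , s)) → u≢v (trans (sym r) s) ; (_ , inj₂ (r , s)) → u≢v (trans (sym s) r) }) ]′ ∘ split i p p
      }
      where
      dis : ∀ {i j p q} → T (part i (ι p , ι q)) ⊎ (i ≡ γ × (p , q) ≐ (u , v)) →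
            T (part j (ι p , ι q)) ⊎ (j ≡ γ × (p , q) ≐ (u , v)) → i ≡ j
      dis (inj₁ a)          (inj₁ b)          = disjoint a b
      dis (inj₁ a)          (inj₂ (_ , b))    = contradiction a (nonadj′ b)
      dis (inj₂ (_ , a))    (inj₁ b)          = contradiction b (nonadj′ a)
      dis (inj₂ (refl , _)) (inj₂ (refl , _)) = refl

    suppress-Subdivided : Subdivided suppress F γ u v
    suppress-Subdivided = record
      { x = x ; ι = ι ; ι-inj = punchIn-injective x _ _ ; ι≢x = punchInᵢ≢i x
      ; view = view
      ; edge = unite γ u v (inj₂ (refl , inj₁ (refl , refl)))
      ; old = λ i p q → mk⇔
          (λ a → unite i p q (inj₁ a) , λ s → nonadj′ s a)
          (λ (a , ≄) → [ id , (λ (_ , s) → contradiction s ≄) ]′ (split i p q a))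
      ; new = nbrs
      }
      where
      view : ∀ y → y ≡ x ⊎ (∃[ p ] ι p ≡ y)
      view y with y ≟ x
      ... | yes eq = inj₁ eq
      ... | no  ne = inj₂ (punchOut (ne ∘ sym) , punchIn-punchOut (ne ∘ sym))


-- The colouring of the complete graph and of its subdivisions

-- The edge {k , l} has the colour max(k , l) ∸ 2, with vertices and colours counted from 0.
module _ {n : ℕ} where
  private
    has? : ∀ (γ : Fin (suc n)) (k l : Fin (3 + n)) → Dec (k ≢ l × toℕ γ ≡ lev k ⊔ lev l)
    has? γ k l = ¬? (k ≟ l) ×-dec (toℕ γ ℕ.≟ lev k ⊔ lev l)

  completeColored : ColoredGraph (suc n)
  completeColored = record
    { order = 3 + n
    ; edges = record
      { part = λ γ (k , l) → ⌊ has? γ k l ⌋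
      ; disjoint = λ {γ} {γ′} {(k , l)} a b → Fin.toℕ-injective
          (trans (proj₂ (⌊⌋⁻ (has? γ k l) a)) (sym (proj₂ (⌊⌋⁻ (has? γ′ k l) b))))
      }
    ; edges-sym = λ {γ} {k} {l} a → let k≢l , eq = ⌊⌋⁻ (has? γ k l) a in
        ⌊⌋⁺ (has? γ l k) (k≢l ∘ sym , trans eq (ℕ.⊔-comm (lev k) (lev l)))
    ; edges-irrefl = λ {γ} {k} a → proj₁ (⌊⌋⁻ (has? γ k k) a) refl
    }

  open ColoredGraphProperties completeColored

  E-complete : ∀ γ (k l : Fin (3 + n)) → E γ k l ⇔ (k ≢ l × toℕ γ ≡ lev k ⊔ lev l)
  E-complete γ k l = mk⇔ (⌊⌋⁻ (has? γ k l)) (⌊⌋⁺ (has? γ k l))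

module _ {n : ℕ} (l : Fin (3 + n)) where
  private
    bound : 3 + lev l ≤ 3 + n
    bound = s≤s (s≤s (lev< l))

    l′ : Fin (3 + lev l)
    l′ = fromℕ< (s≤s (ℕ.m≤n+m∸n (toℕ l) 2))

    l′≡l : inject≤ l′ bound ≡ l
    l′≡l = Fin.toℕ-injective (trans (Fin.toℕ-inject≤ l′ bound) (Fin.toℕ-fromℕ< _))

  -- The vertices of level at most `lev l` are the first `3 + lev l` ones. Omitting l is done by
  -- `punchIn`, because l need not be the last of them when its level is 0.
  lower : Fin (2 + lev l) → Fin (3 + n)
  lower j = inject≤ (punchIn l′ j) bound

  lower-injective : Injective _≡_ _≡_ lower
  lower-injective {i} {j} eq = punchIn-injective l′ i j (Fin.inject≤-injective bound bound (punchIn l′ i) (punchIn l′ j) eq)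

  lower-≢ : ∀ j → l ≢ lower j
  lower-≢ j eq = punchInᵢ≢i l′ j (Fin.inject≤-injective bound bound (punchIn l′ j) l′ (trans (sym eq) (sym l′≡l)))

  lev-lower : ∀ j → lev (lower j) ≤ lev l
  lev-lower j = ℕ.m≤n+o⇒m∸n≤o _ 2 (subst (_≤ 2 + lev l) (sym (Fin.toℕ-inject≤ (punchIn l′ j) bound)) (Fin.toℕ≤pred[n] (punchIn l′ j)))

  lower-onto : ∀ k → l ≢ k → lev k ≤ lev l → ∃[ j ] lower j ≡ k
  lower-onto k l≢k le = punchOut l′≢k′ , trans (cong (λ i → inject≤ i bound) (punchIn-punchOut l′≢k′)) k′≡k
    where
    k′ : Fin (3 + lev l)
    k′ = fromℕ< (s≤s (ℕ.≤-trans (ℕ.m≤n+m∸n (toℕ k) 2) (ℕ.+-monoʳ-≤ 2 le)))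

    k′≡k : inject≤ k′ bound ≡ k
    k′≡k = Fin.toℕ-injective (trans (Fin.toℕ-inject≤ k′ bound) (Fin.toℕ-fromℕ< _))

    l′≢k′ : l′ ≢ k′
    l′≢k′ eq = l≢k (trans (sym l′≡l) (trans (cong (λ i → inject≤ i bound) eq) k′≡k))

module _ {n : ℕ} where
  open ColoredGraphProperties (completeColored {n})

  deg-complete : ∀ k γ → deg γ k ≡ mdeg k γ
  deg-complete k γ with ℕ.<-cmp (toℕ γ) (lev k)
  ... | tri< γ<k _ _ = trans (#≡0 (λ l → part γ (k , l)) λ l e →
          ℕ.<⇒≱ γ<k (subst (lev k ≤_) (sym (proj₂ (Equivalence.to (E-complete γ k l) e))) (ℕ.m≤m⊔n (lev k) (lev l))))
          (sym (mdeg-< k γ γ<k))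
  ... | tri≈ _ γ≡k _ = trans (#-enum (λ l → part γ (k , l)) (lower k) (lower-injective k)
          (λ j → Equivalence.from (E-complete γ k (lower k j)) (lower-≢ k j , trans γ≡k (sym (ℕ.m≥n⇒m⊔n≡m (lev-lower k j)))))
          (λ l e → let k≢l , eq = Equivalence.to (E-complete γ k l) e
                   in lower-onto k l k≢l (ℕ.m⊔n≡m⇒n≤m (trans (sym eq) γ≡k))))
          (sym (mdeg-≡ k γ γ≡k))
  ... | tri> _ _ γ>k = trans (#-enum (λ l → part γ (k , l)) (λ (_ : Fin 1) → hub γ) (λ { {zero} {zero} _ → refl })
          (λ _ → Equivalence.from (E-complete γ k (hub γ))
            ((λ { refl → ℕ.<-irrefl refl γ>k }) , sym (ℕ.m≤n⇒m⊔n≡n (ℕ.<⇒≤ γ>k))))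
          (λ l e → zero , sym (lev≡⇒hub l γ (ℕ.≤-<-trans z≤n γ>k)
            (max-> {l} (proj₂ (Equivalence.to (E-complete γ k l) e))))))
          (sym (mdeg-> k γ γ>k))
    where
    max-> : ∀ {l} → toℕ γ ≡ lev k ⊔ lev l → lev l ≡ toℕ γ
    max-> {l} eq with ℕ.⊔-sel (lev k) (lev l)
    ... | inj₁ s = contradiction (trans eq s) (ℕ.>⇒≢ γ>k)
    ... | inj₂ s = sym (trans eq s)

  Good-complete : Good (completeColored {n})
  Good-complete = record
    { mv = id ; mv-inj = id ; degM = deg-complete ; other = λ k → inj₁ (k , refl)
    ; conn = λ γ k l nk nl → toHub γ k nk ◅◅ reverse (λ {p} {q} → edges-sym {γ} {p} {q}) (toHub γ l nl)
    }
    where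
    toHub : ∀ γ k → ∃ (E γ k) → Star (E γ) k (hub γ)
    toHub γ k (l , e) with k ≟ hub γ
    ... | yes refl = ε
    ... | no k≢hub = Equivalence.from (E-complete γ k (hub γ)) (k≢hub ,
            sym (ℕ.m≤n⇒m⊔n≡n (subst (lev k ≤_) (sym (proj₂ (Equivalence.to (E-complete γ k l) e))) (ℕ.m≤m⊔n (lev k) (lev l))))) ◅ ε

  underlying-completeColored : underlying (completeColored {n}) ≅ complete (3 + n)
  underlying-completeColored = record
    { bijection = mk↔ₛ′ id id (λ _ → refl) (λ _ → refl)
    ; preserves = λ k l → mk⇔
        (λ a → let γ , e = Equivalence.to (Adj-underlying completeColored k l) a
               in ⌊⌋⁺ (¬? (k ≟ l)) (proj₁ (Equivalence.to (E-complete γ k l) e)))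
        (λ a → Equivalence.from (Adj-underlying completeColored k l)
          (fromℕ< (bound k l) , Equivalence.from (E-complete _ k l) (⌊⌋⁻ (¬? (k ≟ l)) a , Fin.toℕ-fromℕ< (bound k l))))
    }
    where
    bound : ∀ (k l : Fin (3 + n)) → lev k ⊔ lev l < suc n
    bound k l = ℕ.⊔-lub (lev< k) (lev< l)

  colorSubdivision : ∀ {G} → Subdivision (complete (3 + n)) G →
                     Σ[ F ∈ ColoredGraph (suc n) ] underlying F ≅ G × Good F
  colorSubdivision none = completeColored , underlying-completeColored , Good-complete
  colorSubdivision (step {G} S u v a) =
    let F′ , φ , g = colorSubdivision S
        open Inverse (_≅_.bijection φ)
        γ , e = Equivalence.to (Adj-underlying F′ (from u) (from v)) (Equivalence.from (_≅_.preserves φ (from u) (from v))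
                  (subst₂ (Adj G) (sym (strictlyInverseˡ u)) (sym (strictlyInverseˡ v)) a))
        sub = subdivideEdge-Subdivided F′ γ (from u) (from v) e
    in subdivideEdge F′ γ (from u) (from v) e ,
       ≅-trans (SubdividedProperties.underlying-≅ sub)
         (subst₂ (λ u′ v′ → subdivide (underlying F′) (from u) (from v) ≅ subdivide G u′ v′)
           (strictlyInverseˡ u) (strictlyInverseˡ v) (subdivide-≅ φ (from u) (from v))) ,
       Good⁺ sub g

-- From the degrees M back to a subdivision

#≡2-only : (P : Fin n → Bool) → # P ≡ 2 → ∀ {a b} → a ≢ b → T (P a) → T (P b) → ∀ w → T (P w) → w ≡ a ⊎ w ≡ b
#≡2-only P eq {a} {b} a≢b pa pb w pw with #≡2 P eq
... | u , v , u≢v , _ , _ , only with only a pa | only b pb | only w pw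
... | inj₁ refl | inj₁ refl | _         = contradiction refl a≢b
... | inj₂ refl | inj₂ refl | _         = contradiction refl a≢b
... | inj₁ refl | inj₂ refl | s         = s
... | inj₂ refl | inj₁ refl | s         = Sum.swap s

module _ {n : ℕ} {F : ColoredGraph (suc n)} (g : Good F) where
  open ColoredGraphProperties F
  open Good g

  New : V → Set
  New x = ∀ k → mv k ≢ x

  Joined : V → V → Set
  Joined u v = ∃[ i ] E i u v

  data View (x : V) : Set where
    isMv  : ∀ k → mv k ≡ x → View x
    isNew : New x → ∀ γ u v → u ≢ v → E γ x u → E γ x v → (∀ i y → E i x y → i ≡ γ × (y ≡ u ⊎ y ≡ v)) → View x

  view : ∀ x → View x
  view x with any? (λ k → mv k ≟ x) | other x
  ... | yes (k , eq) | _              = isMv k eq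
  ... | no new       | inj₁ is        = contradiction is new
  ... | no new       | inj₂ (γ , two , zeros) =
    let u , v , u≢v , eu , ev , only = #≡2 (λ y → part γ (x , y)) two
        color : ∀ i y → E i x y → i ≡ γ
        color i y e = case-≟ i y e
    in isNew (λ k eq → new (k , eq)) γ u v u≢v eu ev
         λ i y e → color i y e , only y (subst (λ j → E j x y) (color i y e) e)
    where
    case-≟ : ∀ i y → E i x y → i ≡ γ
    case-≟ i y e with i ≟ γ
    ... | yes eq = eq
    ... | no  ne = contradiction e (#≡0⁻ (λ y → part i (x , y)) (zeros i ne) y)

  -- A vertex outside M has a degree in Δ, so all its edges share one colour.
  two-colors : ∀ {i j y z z′} → i ≢ j → E i y z → E j y z′ → ∃[ k ] mv k ≡ y
  two-colors {y = y} i≢j e e′ with view y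
  ... | isMv k eq = k , eq
  ... | isNew _ γ _ _ _ _ _ only = contradiction (trans (proj₁ (only _ _ e)) (sym (proj₁ (only _ _ e′)))) i≢j

  E⇒lev≤ : ∀ {i k y} → E i (mv k) y → lev k ≤ toℕ i
  E⇒lev≤ {i} {k} {y} e = mdeg>0 k i (subst (0 <_) (degM k i) (∈-length (∈-sat⁺ (λ y → part i (mv k , y)) e)))

  lev≤⇒E : ∀ {i k} → lev k ≤ toℕ i → ∃ (E i (mv k))
  lev≤⇒E {i} {k} le = #>0 (λ y → part i (mv k , y)) (subst (0 <_) (sym (degM k i)) pos)
    where
    pos : 0 < mdeg k i
    pos with ℕ.m≤n⇒m<n∨m≡n le
    ... | inj₁ lt = subst (0 <_) (sym (mdeg-> k i lt)) (s≤s z≤n)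
    ... | inj₂ eq = subst (0 <_) (sym (mdeg-≡ k i (sym eq))) (s≤s z≤n)

  hub-E : ∀ i → ∃ (E i (mv (hub i)))
  hub-E i = lev≤⇒E ℕ.≤-refl

  leaf : ∀ {i k y z} → lev k < toℕ i → E i (mv k) y → E i (mv k) z → y ≡ z
  leaf {i} {k} {y} {z} lt e e′ =
    let u , _ , only = #≡1 (λ y → part i (mv k , y)) (trans (degM k i) (mdeg-> k i lt))
    in trans (only y e) (sym (only z e′))

  -- Connectedness in the form used below: a set closed under the edges of colour i contains the
  -- whole colour class as soon as it meets it. Contradictions come from small closed sets that miss
  -- the hub.
  closed : ∀ {i} (S : V → Set) → (∀ {y z} → S y → E i y z → S z) → ∀ {x y} → S x → ∃ (E i x) → ∃ (E i y) → S y
  closed {i} S cl s nx ny = along s (conn i _ _ nx ny)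
    where
    along : ∀ {y z} → S y → Star (E i) y z → S z
    along s ε        = s
    along s (e ◅ es) = along (cl s e) es

  -- Two vertices of M are linked only in the colour of the edge of K_a that they span.
  link-color : ∀ {i k l} (x : V → Set) → (∀ {y} → x y → New y) →
               (lev k < toℕ i → lev l < toℕ i → ∀ {y z} → y ≡ mv k ⊎ y ≡ mv l ⊎ x y → E i y z → z ≡ mv k ⊎ z ≡ mv l ⊎ x z) →
               ∃ (E i (mv k)) → ∃ (E i (mv l)) → toℕ i ≡ lev k ⊔ lev l
  link-color {i} {k} {l} x x-new cl nk nl with ℕ.m≤n⇒m<n∨m≡n (E⇒lev≤ (proj₂ nk)) | ℕ.m≤n⇒m<n∨m≡n (E⇒lev≤ (proj₂ nl))
  ... | inj₂ eq | _ = sym (trans (ℕ.m≥n⇒m⊔n≡m (subst (lev l ≤_) (sym eq) (E⇒lev≤ (proj₂ nl)))) eq)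
  ... | inj₁ lt | inj₂ eq = sym (trans (ℕ.m≤n⇒m⊔n≡n (subst (lev k ≤_) (sym eq) (ℕ.<⇒≤ lt))) eq)
  -- Both vertices have degree 1 in colour i, and the closed set would have to contain the hub of i,
  -- whose level is i itself.
  ... | inj₁ lt | inj₁ lt′
    with closed (λ y → y ≡ mv k ⊎ y ≡ mv l ⊎ x y) (cl lt lt′) (inj₁ refl) nk (hub-E i)
  ...   | inj₁ eq        = contradiction (subst (λ h → lev h < toℕ i) (sym (mv-inj eq)) lt) (ℕ.n≮n _)
  ...   | inj₂ (inj₁ eq) = contradiction (subst (λ h → lev h < toℕ i) (sym (mv-inj eq)) lt′) (ℕ.n≮n _)
  ...   | inj₂ (inj₂ xh) = contradiction refl (x-new xh (hub i))

  -- If j and γ differed, u and v would meet two colours and hence lie in M. The edge between u and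
  -- v and the path through x would then link the same two vertices of M in colours j and γ, and
  -- `link-color` gives both colours the same value.
  same-color : ∀ {x γ j u v} → New x → E γ x u → E γ x v → u ≢ v →
               (∀ i y → E i x y → i ≡ γ × (y ≡ u ⊎ y ≡ v)) → E j u v → j ≡ γ
  same-color {x} {γ} {j} {u} {v} new xu xv u≢v only uv with j ≟ γ
  ... | yes eq = eq
  ... | no j≢γ with two-colors j≢γ uv (edges-sym xu) | two-colors j≢γ (edges-sym uv) (edges-sym xv)
  ... | k , refl | l , refl = Fin.toℕ-injective (trans
    (link-color (λ _ → ⊥) (λ ()) cl₂ (_ , uv) (_ , edges-sym uv))
    (sym (link-color (_≡ x) (λ { refl → new }) cl₃ (_ , edges-sym xu) (_ , edges-sym xv))))
    where
    cl₂ : lev k < toℕ j → lev l < toℕ j → ∀ {y z} → y ≡ mv k ⊎ y ≡ mv l ⊎ ⊥ → E j y z → z ≡ mv k ⊎ z ≡ mv l ⊎ ⊥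
    cl₂ lt _ (inj₁ refl)        e = inj₂ (inj₁ (leaf lt e uv))
    cl₂ _ lt (inj₂ (inj₁ refl)) e = inj₁ (leaf lt e (edges-sym uv))

    cl₃ : lev k < toℕ γ → lev l < toℕ γ → ∀ {y z} → y ≡ mv k ⊎ y ≡ mv l ⊎ y ≡ x → E γ y z → z ≡ mv k ⊎ z ≡ mv l ⊎ z ≡ x
    cl₃ lt _ (inj₁ refl)        e = inj₂ (inj₂ (leaf lt e (edges-sym xu)))
    cl₃ _ lt (inj₂ (inj₁ refl)) e = inj₂ (inj₂ (leaf lt e (edges-sym xv)))
    cl₃ _ _  (inj₂ (inj₂ refl)) e = Sum.map₂ inj₁ (proj₂ (only _ _ e))

  module _ (joined : ∀ {x u v} → New x → u ≢ v → Joined x u → Joined x v → Joined u v) where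

    private
      triangle : ∀ {x γ u v} → New x → E γ x u → E γ x v → u ≢ v →
                 (∀ i y → E i x y → i ≡ γ × (y ≡ u ⊎ y ≡ v)) → E γ u v
      triangle new xu xv u≢v only =
        let j , uv = joined new u≢v (_ , xu) (_ , xv)
        in subst (λ i → E i _ _) (same-color new xu xv u≢v only uv) uv

      pair : ∀ {γ y a b} → deg γ y ≡ 2 → a ≢ b → E γ y a → E γ y b → ∀ w → E γ y w → w ≡ a ⊎ w ≡ b
      pair {γ} {y} two a≢b ya yb = #≡2-only (λ w → part γ (y , w)) two a≢b ya yb

      new-deg : ∀ {γ y z} → New y → E γ y z → deg γ y ≡ 2
      new-deg {γ} {y} new e with view y
      ... | isMv k eq = contradiction eq (new k)
      ... | isNew _ γ′ u v u≢v yu yv only with refl ← proj₁ (only _ _ e) =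
        #-enum (λ w → part γ (y , w)) (λ { zero → u ; (suc zero) → v })
          (λ { {zero} {zero} _ → refl ; {zero} {suc zero} eq → contradiction eq u≢v
             ; {suc zero} {zero} eq → contradiction (sym eq) u≢v ; {suc zero} {suc zero} _ → refl })
          (λ { zero → yu ; (suc zero) → yv })
          (λ w yw → [ (λ eq → zero , sym eq) , (λ eq → suc zero , sym eq) ]′ (proj₂ (only _ w yw)))

      -- Each corner has both its neighbours on the triangle, so the triangle is closed under the
      -- edges of colour γ.
      triangle-closed : ∀ {γ x u v} → u ≢ v → E γ x u → E γ x v → E γ u v →
                        deg γ x ≡ 2 → deg γ u ≡ 2 → deg γ v ≡ 2 → ∀ {y} → ∃ (E γ y) → y ≡ x ⊎ y ≡ u ⊎ y ≡ v
      triangle-closed {γ} {x} {u} {v} u≢v xu xv uv dx du dv = closed _ cl (inj₁ refl) (_ , xu)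
        where
        x≢ : ∀ {y} → E γ x y → x ≢ y
        x≢ e refl = edges-irrefl e
        cl : ∀ {y z} → y ≡ x ⊎ y ≡ u ⊎ y ≡ v → E γ y z → z ≡ x ⊎ z ≡ u ⊎ z ≡ v
        cl (inj₁ refl)        e = inj₂ (pair dx u≢v xu xv _ e)
        cl (inj₂ (inj₁ refl)) e = Sum.map₂ inj₂ (pair du (x≢ xv) (edges-sym xu) uv _ e)
        cl (inj₂ (inj₂ refl)) e = Sum.map₂ inj₁ (pair dv (x≢ xu) (edges-sym xv) (edges-sym uv) _ e)

      pigeonhole : ∀ {u v k l m} → k ≢ l → k ≢ m → l ≢ m →
                   mv k ≡ u ⊎ mv k ≡ v → mv l ≡ u ⊎ mv l ≡ v → mv m ≡ u ⊎ mv m ≡ v → ⊥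
      pigeonhole k≢l _ _ (inj₁ p) (inj₁ q) _        = k≢l (mv-inj (trans p (sym q)))
      pigeonhole k≢l _ _ (inj₂ p) (inj₂ q) _        = k≢l (mv-inj (trans p (sym q)))
      pigeonhole _ k≢m _ (inj₁ p) (inj₂ _) (inj₁ r) = k≢m (mv-inj (trans p (sym r)))
      pigeonhole _ _ l≢m (inj₁ _) (inj₂ q) (inj₂ r) = l≢m (mv-inj (trans q (sym r)))
      pigeonhole _ _ l≢m (inj₂ _) (inj₁ q) (inj₁ r) = l≢m (mv-inj (trans q (sym r)))
      pigeonhole _ k≢m _ (inj₂ p) (inj₁ _) (inj₂ r) = k≢m (mv-inj (trans p (sym r)))

    no-new : ∀ {x} → ¬ New x
    no-new {x} new with view x
    ... | isMv k eq = new k eq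
    ... | isNew _ γ u v u≢v xu xv only with toℕ γ ℕ.≟ 0
    -- In the first colour every non-isolated vertex has degree 2, so the triangle is the whole
    -- class. The three vertices of M with level 0 belong to it and differ from x, which leaves only
    -- u and v for them.
    ...   | yes γ≡0 = pigeonhole {k = zero} {l = suc zero} {m = suc (suc zero)} (λ ()) (λ ()) (λ ()) (at zero refl) (at (suc zero) refl) (at (suc (suc zero)) refl)
      where
      uv = triangle new xu xv u≢v only
      two : ∀ {y z} → E γ y z → deg γ y ≡ 2
      two {y} e with view y
      ... | isNew new′ _ _ _ _ _ _ _ = new-deg new′ e
      ... | isMv k refl = trans (degM k γ) (trans (mdeg-≡ k γ (ℕ.≤-antisym (subst (_≤ lev k) (sym γ≡0) z≤n) (E⇒lev≤ e)))
              (cong (2 +_) (ℕ.n≤0⇒n≡0 (subst (lev k ≤_) γ≡0 (E⇒lev≤ e)))))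
      at : ∀ k → lev k ≡ 0 → mv k ≡ u ⊎ mv k ≡ v
      at k l≡0 with triangle-closed u≢v xu xv uv (two xu) (two (edges-sym xu)) (two (edges-sym xv)) (lev≤⇒E (subst (_≤ toℕ γ) (sym l≡0) z≤n))
      ... | inj₁ eq = contradiction eq (new k)
      ... | inj₂ s  = s
    -- The hub has degree 2 + γ, but x and the 2 + γ other vertices of M with level at most γ would
    -- all be its neighbours.
    ...   | no γ≢0 = ℕ.1+n≰n (subst (3 + toℕ γ ≤_) (trans (degM (hub γ) γ) (mdeg-≡ (hub γ) γ refl))
                       (#-≥ (λ y → part γ (mv (hub γ) , y)) nbr nbr-inj nbr-E))
      where
      uv = triangle new xu xv u≢v only

      data Kind (y : V) : Set where
        center : mv (hub γ) ≡ y → Kind y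
        leaf′  : ∀ k → lev k < toℕ γ → mv k ≡ y → Kind y
        fresh  : New y → Kind y

      kind : ∀ {y z} → E γ y z → Kind y
      kind {y} e with view y
      ... | isNew new′ _ _ _ _ _ _ _ = fresh new′
      ... | isMv k refl with ℕ.m≤n⇒m<n∨m≡n (E⇒lev≤ e)
      ...   | inj₁ lt = leaf′ k lt refl
      ...   | inj₂ eq = center (cong mv (sym (lev≡⇒hub k γ (ℕ.n≢0⇒n>0 γ≢0) eq)))

      -- A neighbour of a new vertex lies on a triangle, so it is not a leaf.
      new-nbr : ∀ {k y} → lev k < toℕ γ → E γ (mv k) y → ¬ New y
      new-nbr {k} {y} lt e new′ with view y
      ... | isMv l eq = new′ l eq
      ... | isNew _ γ′ a b a≢b ya yb only′ with only′ γ (mv k) (edges-sym e)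
      ...   | refl , inj₁ refl = edges-irrefl (subst (E γ y) (leaf lt (triangle new′ ya yb a≢b only′) e) yb)
      ...   | refl , inj₂ refl = edges-irrefl (subst (E γ y) (leaf lt (edges-sym (triangle new′ ya yb a≢b only′)) e) ya)

      -- The neighbour of a leaf is not new by `new-nbr`. It is not a leaf either, because two
      -- adjacent leaves form a closed set without the hub.
      leaf-nbr : ∀ k → lev k < toℕ γ → E γ (mv k) (mv (hub γ))
      leaf-nbr k lt with lev≤⇒E {γ} {k} (ℕ.<⇒≤ lt)
      ... | y , e with kind (edges-sym e)
      ...   | center refl = e
      ...   | fresh new′  = contradiction new′ (new-nbr lt e)
      ...   | leaf′ l lt′ refl with closed (λ z → z ≡ mv k ⊎ z ≡ mv l) cl (inj₁ refl) (_ , e) (hub-E γ)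
        where
        cl : ∀ {y z} → y ≡ mv k ⊎ y ≡ mv l → E γ y z → z ≡ mv k ⊎ z ≡ mv l
        cl (inj₁ refl) e′ = inj₂ (leaf lt e′ e)
        cl (inj₂ refl) e′ = inj₁ (leaf lt′ e′ (edges-sym e))
      ...     | inj₁ eq = contradiction (subst (λ h → lev h < toℕ γ) (sym (mv-inj eq)) lt) (ℕ.n≮n _)
      ...     | inj₂ eq = contradiction (subst (λ h → lev h < toℕ γ) (sym (mv-inj eq)) lt′) (ℕ.n≮n _)

      -- Neither u nor v is a leaf, by `new-nbr`. If both were new, all corners of the triangle
      -- would have degree 2 and the class would miss its hub.
      x-nbr : E γ x (mv (hub γ))
      x-nbr with kind (edges-sym xu) | kind (edges-sym xv)
      ... | center refl | _ = xu
      ... | _ | center refl = xv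
      ... | leaf′ k lt refl | _ = contradiction new (new-nbr lt (edges-sym xu))
      ... | _ | leaf′ k lt refl = contradiction new (new-nbr lt (edges-sym xv))
      ... | fresh nu | fresh nv with triangle-closed u≢v xu xv uv (new-deg new xu) (new-deg nu uv) (new-deg nv (edges-sym uv)) (hub-E γ)
      ...   | inj₁ eq        = contradiction eq (new (hub γ))
      ...   | inj₂ (inj₁ eq) = contradiction eq (nu (hub γ))
      ...   | inj₂ (inj₂ eq) = contradiction eq (nv (hub γ))

      nbr : Fin (3 + toℕ γ) → V
      nbr zero    = x
      nbr (suc j) = mv (lower (hub γ) j)

      nbr-inj : Injective _≡_ _≡_ nbr
      nbr-inj {zero}  {zero}  _  = refl
      nbr-inj {zero}  {suc j} eq = contradiction (sym eq) (new _)
      nbr-inj {suc i} {zero}  eq = contradiction eq (new _)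
      nbr-inj {suc i} {suc j} eq = cong suc (lower-injective (hub γ) (mv-inj eq))

      nbr-E : ∀ j → E γ (mv (hub γ)) (nbr j)
      nbr-E zero    = edges-sym x-nbr
      nbr-E (suc j) = edges-sym (leaf-nbr j′ (ℕ.≤∧≢⇒< (lev-lower (hub γ) j)
          (λ eq → lower-≢ (hub γ) j (sym (lev≡⇒hub j′ γ (ℕ.n≢0⇒n>0 γ≢0) eq)))))
        where j′ = lower (hub γ) j

  -- In its leading colour vertex l has degree `2 + lev l`, and its neighbours there have level at
  -- most `lev l`. There are exactly that many candidates, so l is adjacent to all of them; of any
  -- two vertices, the one of higher level supplies the edge.
  mv-onto⇒≅ : (∀ x → ∃[ k ] mv k ≡ x) → underlying F ≅ complete (3 + n)
  mv-onto⇒≅ onto = record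
    { bijection = mk↔ₛ′ (proj₁ ∘ onto) mv (λ k → mv-inj (proj₂ (onto (mv k)))) (proj₂ ∘ onto)
    ; preserves = λ x y → mk⇔
        (λ a → ⌊⌋⁺ (¬? (proj₁ (onto x) ≟ proj₁ (onto y))) λ eq →
          Graph.adj-irrefl (underlying F) {y} (subst (λ z → Adj (underlying F) z y)
            (trans (sym (proj₂ (onto x))) (trans (cong mv eq) (proj₂ (onto y)))) a))
        (λ a → Equivalence.from (Adj-underlying F x y) (subst₂ Joined (proj₂ (onto x)) (proj₂ (onto y))
          (adjacent (proj₁ (onto x)) (proj₁ (onto y)) (⌊⌋⁻ (¬? (proj₁ (onto x) ≟ proj₁ (onto y))) a))))
    }
    where
    below : ∀ l k → l ≢ k → lev k ≤ lev l → Joined (mv l) (mv k)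
    below l k l≢k le with lower-onto l k l≢k le
    ... | j , refl = γ , #-full-cover (λ y → part γ (mv l , y)) (mv ∘ lower l) cover
                           (trans (degM l γ) (mdeg-≡ l γ γ≡)) j
      where
      γ : Fin (suc n)
      γ = fromℕ< (lev< l)
      γ≡ : toℕ γ ≡ lev l
      γ≡ = Fin.toℕ-fromℕ< (lev< l)
      cover : ∀ y → E γ (mv l) y → ∃[ j ] mv (lower l j) ≡ y
      cover y e with onto y
      ... | k′ , refl =
        let j , eq = lower-onto l k′ (λ { refl → edges-irrefl e }) (subst (lev k′ ≤_) γ≡ (E⇒lev≤ (edges-sym e)))
        in j , cong mv eq

    adjacent : ∀ k l → k ≢ l → Joined (mv k) (mv l)
    adjacent k l k≢l with ℕ.≤-total (lev l) (lev k)
    ... | inj₁ le = below k l k≢l le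
    ... | inj₂ le = let i , e = below l k (k≢l ∘ sym) le in i , edges-sym e

-- Induction on the order, which is kept as a separate variable because `suppress` needs it to be a
-- successor. The search is for a vertex that can be suppressed; its failure is the hypothesis
-- `joined` of `no-new`.
Good⇒∈𝒮 : ∀ {n} N (F : ColoredGraph (suc n)) → ColoredGraph.order F ≡ N → Good F → underlying F ∈𝒮 complete (3 + n)
Good⇒∈𝒮 {n} N F@record { order = .N ; edges = edges ; edges-sym = es ; edges-irrefl = ei } refl g
  with any? (λ x → all? (λ k → ¬? (Good.mv g k ≟ x)) ×-dec any? λ u → any? λ v →
         ¬? (u ≟ v) ×-dec colored? F x u ×-dec colored? F x v ×-dec ¬? (colored? F u v))
... | no none′ = complete (3 + n) , none , mv-onto⇒≅ g onto
  where
  joined : ∀ {x u v} → New g x → u ≢ v → Joined g x u → Joined g x v → Joined g u v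
  joined {x} {u} {v} new u≢v xu xv with colored? F u v
  ... | yes uv = uv
  ... | no ¬uv = contradiction (x , new , u , v , u≢v , xu , xv , ¬uv) none′
  onto : ∀ x → ∃[ k ] Good.mv g k ≡ x
  onto x with any? (λ k → Good.mv g k ≟ x)
  ... | yes p = p
  ... | no ¬p = contradiction (λ k eq → ¬p (k , eq)) (no-new g joined)
Good⇒∈𝒮 {n} (suc N) F@record { order = .(suc N) ; edges = edges ; edges-sym = es ; edges-irrefl = ei } refl g
  | yes (x , new , u , v , u≢v , (i , xu) , (j , xv) , ¬uv) with view g x
... | isMv k eq = contradiction eq (new k)
... | isNew _ γ a b a≢b xa xb only =
  let G , S , φ = Good⇒∈𝒮 N F′ refl (Good⁻ sub g new)
      open _≅_ φ using (bijection; preserves)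
      module φ = Inverse bijection
  in subdivide G (φ.to a′) (φ.to b′) ,
     step S _ _ (Equivalence.to (preserves a′ b′) (Equivalence.from (Adj-underlying F′ a′ b′) (γ , Subdivided.edge sub))) ,
     ≅-trans (SubdividedProperties.underlying-≅ sub) (subdivide-≅ φ a′ b′)
  where
  x≢ : ∀ {i y} → T (ColoredSubset.part edges i (x , y)) → x ≢ y
  x≢ e refl = ei e
  a′ = punchOut (x≢ xa)
  b′ = punchOut (x≢ xb)
  ιa : punchIn x a′ ≡ a
  ιa = punchIn-punchOut (x≢ xa)
  ιb : punchIn x b′ ≡ b
  ιb = punchIn-punchOut (x≢ xb)
  -- The search found distinct non-adjacent neighbours u and v, while `view` calls the two
  -- neighbours a and b; the pairs agree up to order.
  ¬ab : ¬ Joined g a b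
  ¬ab (l , ab) with proj₂ (only i u xu) | proj₂ (only j v xv)
  ... | inj₁ refl | inj₁ refl = u≢v refl
  ... | inj₁ refl | inj₂ refl = ¬uv (l , ab)
  ... | inj₂ refl | inj₁ refl = ¬uv (l , es ab)
  ... | inj₂ refl | inj₂ refl = u≢v refl
  a′≢b′ : a′ ≢ b′
  a′≢b′ eq = a≢b (trans (sym ιa) (trans (cong (punchIn x) eq) ιb))
  nonadj : ∀ l → ¬ T (ColoredSubset.part edges l (punchIn x a′ , punchIn x b′))
  nonadj l e = ¬ab (l , subst₂ (λ y z → T (ColoredSubset.part edges l (y , z))) ιa ιb e)
  nbrs : ∀ l q → T (ColoredSubset.part edges l (punchIn x q , x)) ⇔ (l ≡ γ × (q ≡ a′ ⊎ q ≡ b′))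
  nbrs l q = mk⇔
    (λ e → let eq , s = only l (punchIn x q) (es e)
           in eq , Sum.map (λ r → punchIn-injective x q a′ (trans r (sym ιa))) (λ r → punchIn-injective x q b′ (trans r (sym ιb))) s)
    (λ { (refl , inj₁ refl) → es (subst (λ y → T (ColoredSubset.part edges γ (x , y))) (sym ιa) xa)
       ; (refl , inj₂ refl) → es (subst (λ y → T (ColoredSubset.part edges γ (x , y))) (sym ιb) xb) })
  F′  = suppress edges es ei x γ a′ b′ a′≢b′ nonadj nbrs
  sub = suppress-Subdivided edges es ei x γ a′ b′ a′≢b′ nonadj nbrs

∈𝒮-≅ : ∀ {F G H} → F ≅ G → F ∈𝒮 H → G ∈𝒮 H
∈𝒮-≅ φ (K , S , ψ) = K , S , ≅-trans (≅-sym φ) ψ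

extendedProfile : ∀ n → IsExtendedProfile (M (suc n)) (complete (3 + n))
extendedProfile n F = mk⇔
  (λ (G , S , φ) → let Fᶜ , ψ , g = colorSubdivision S in Fᶜ , ≅-trans ψ (≅-sym φ) , Good⇒𝒞* g)
  (λ (Fᶜ , φ , h) → ∈𝒮-≅ φ (Good⇒∈𝒮 _ Fᶜ refl (𝒞*⇒Good h)))

-- Minimal decision diagrams

T-ext : ∀ {a b} → (T a → T b) → (T b → T a) → a ≡ b
T-ext {true}  {true}  f g = refl
T-ext {false} {false} f g = refl
T-ext {true}  {false} f g = contradiction tt f
T-ext {false} {true}  f g = contradiction tt g

injective-length : ∀ {A : Set} (xs : List A) → Unique xs → (g : A → Fin N) →
                   (∀ {x y} → x ∈ xs → y ∈ xs → g x ≡ g y → x ≡ y) → length xs ≤ N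
injective-length {N} xs u g inj = subst₂ _≤_ (length-map g xs) (length-tabulate {n = N} id)
  (Unique-length (map-unique xs u inj) λ _ → ∈-allFin _)
  where
  map-unique : ∀ xs → Unique xs → (∀ {x y} → x ∈ xs → y ∈ xs → g x ≡ g y → x ≡ y) → Unique (map g xs)
  map-unique []       _        _   = []
  map-unique (x ∷ xs) (x∉ ∷ u) inj =
    All.map⁺ (All.tabulate λ y∈ eq → All.lookup x∉ y∈ (inj (here refl) (there y∈) eq)) ∷
    map-unique xs u λ p q → inj (there p) (there q)

-- The acceptance tree of a language of words of length n; its nodes, up to
-- equality of subtrees, are those of the minimal decision diagram.
module _ (c : ℕ) where
  private
    X = Fin (suc c)

  Tree : ℕ → Set
  Tree zero    = Bool
  Tree (suc n) = Vec (Tree n) (suc c)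

  -- The number is one less than the count of letters still to be read, so keys exist for
  -- non-terminal nodes only.
  Key : Set
  Key = Σ[ n ∈ ℕ ] Tree (suc n)

  Tree-≟ : ∀ n → DecidableEquality (Tree n)
  Tree-≟ zero    = Bool._≟_
  Tree-≟ (suc n) = Vec.≡-dec (Tree-≟ n)

  Key-≟ : DecidableEquality Key
  Key-≟ = Product.≡-dec ℕ._≟_ λ {n} → Tree-≟ (suc n)

module _ {c : ℕ} where
  private
    X = Fin (suc c)

  run : ∀ n → Tree c n → Vec X n → Bool
  run zero    b Vec.[]      = b
  run (suc n) t (x Vec.∷ w) = run n (Vec.lookup t x) w

  build : ∀ n → (List X → Bool) → Tree c n
  build zero    f = f []
  build (suc n) f = Vec.tabulate λ x → build n (f ∘ (x ∷_))

  run-build : ∀ n f w → run n (build n f) w ≡ f (Vec.toList w)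
  run-build zero    f Vec.[]      = refl
  run-build (suc n) f (x Vec.∷ w) = trans
    (cong (λ t → run n t w) (Vec.lookup∘tabulate (λ x → build n (f ∘ (x ∷_))) x)) (run-build n (f ∘ (x ∷_)) w)

  build-cong : ∀ n {f g} → (∀ s → length s ≡ n → f s ≡ g s) → build n f ≡ build n g
  build-cong zero    f≗g = f≗g [] refl
  build-cong (suc n) f≗g = Vec.tabulate-cong λ x → build-cong n λ s eq → f≗g (x ∷ s) (cong suc eq)

  word? : ∀ n (f : List X → Bool) → Dec (∃[ s ] length s ≡ n × T (f s))
  word? zero f with T? (f [])
  ... | yes p = yes ([] , refl , p)
  ... | no ¬p = no λ { ([] , _ , p) → ¬p p }
  word? (suc n) f with any? (λ x → word? n (f ∘ (x ∷_)))
  ... | yes (x , s , eq , p) = yes (x ∷ s , cong suc eq , p)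
  ... | no ¬p = no λ { (x ∷ s , eq , p) → ¬p (x , s , ℕ.suc-injective eq , p) }

  build-empty : ∀ n f → ¬ (∃[ s ] length s ≡ n × T (f s)) → build n f ≡ build n (λ _ → false)
  build-empty n f ¬p = build-cong n λ s eq → T-ext (λ p → ¬p (s , eq , p)) λ ()

  subtrees : ∀ n → Tree c n → List (Key c)
  subtrees zero    _ = []
  subtrees (suc n) t = (n , t) ∷ concat (tabulate λ j → subtrees n (Vec.lookup t j))

  child : Key c → X → Bool ⊎ Key c
  child (zero  , t) j = inj₁ (Vec.lookup t j)
  child (suc n , t) j = inj₂ (n , Vec.lookup t j)

  ∈-subtrees-child : ∀ n t {κ j κ′} → κ ∈ subtrees n t → child κ j ≡ inj₂ κ′ → κ′ ∈ subtrees n t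
  ∈-subtrees-child (suc zero) t (here refl) ()
  ∈-subtrees-child (suc (suc n)) t {j = j} (here refl) refl =
    there (∈-concat⁺′ (here refl) (∈-tabulate⁺ {f = λ j → subtrees (suc n) (Vec.lookup t j)} j))
  ∈-subtrees-child (suc n) t (there p) eq
    with xs , κ∈ , xs∈ ← ∈-concat⁻′ (tabulate λ j → subtrees n (Vec.lookup t j)) p
    with i , refl ← ∈-tabulate⁻ {f = λ j → subtrees n (Vec.lookup t j)} xs∈
    = there (∈-concat⁺′ (∈-subtrees-child n (Vec.lookup t i) κ∈ eq) (∈-tabulate⁺ {f = λ j → subtrees n (Vec.lookup t j)} i))

  subtrees-parent : ∀ n t {κ} → κ ∈ subtrees (suc n) t →
                    κ ≡ (n , t) ⊎ (∃₂ λ κ′ j → κ′ ∈ subtrees (suc n) t × child κ′ j ≡ inj₂ κ)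
  subtrees-parent n t (here refl) = inj₁ refl
  subtrees-parent (suc n) t (there p)
    with xs , κ∈ , xs∈ ← ∈-concat⁻′ (tabulate λ j → subtrees (suc n) (Vec.lookup t j)) p
    with i , refl ← ∈-tabulate⁻ {f = λ j → subtrees (suc n) (Vec.lookup t j)} xs∈
    with subtrees-parent n (Vec.lookup t i) κ∈
  ... | inj₁ refl = inj₂ ((suc n , t) , i , here refl , refl)
  ... | inj₂ (κ′ , j , κ′∈ , eq) = inj₂ (κ′ , j ,
        there (∈-concat⁺′ κ′∈ (∈-tabulate⁺ {f = λ j → subtrees (suc n) (Vec.lookup t j)} i)) , eq)
  subtrees-parent zero t (there p)
    with xs , κ∈ , xs∈ ← ∈-concat⁻′ (tabulate λ j → subtrees zero (Vec.lookup t j)) p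
    with i , refl ← ∈-tabulate⁻ {f = λ j → subtrees zero (Vec.lookup t j)} xs∈
    with () ← κ∈

  ∈-subtrees-build : ∀ n f {r t} → (r , t) ∈ subtrees n (build n f) →
                     ∃[ p ] length p + suc r ≡ n × t ≡ build (suc r) (λ s → f (p ++ s))
  ∈-subtrees-build (suc n) f (here refl) = [] , refl , refl
  ∈-subtrees-build (suc n) f (there q)
    with xs , κ∈ , xs∈ ← ∈-concat⁻′ (tabulate λ j → subtrees n (Vec.lookup (build (suc n) f) j)) q
    with i , refl ← ∈-tabulate⁻ {f = λ j → subtrees n (Vec.lookup (build (suc n) f) j)} xs∈
    rewrite Vec.lookup∘tabulate (λ x → build n (f ∘ (x ∷_))) i
    = let p , eq , eq′ = ∈-subtrees-build n (f ∘ (i ∷_)) κ∈ in i ∷ p , cong suc eq , eq′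

  Codes : ∀ {m} → Vec X m → ColoredSubset c (Fin m) → Set
  Codes w B = ∀ γ e → T (ColoredSubset.part B γ e) ⇔ Vec.lookup w e ≡ suc γ

  module Minimal (m′ : ℕ) (t : Tree c (suc m′)) where
    private
      m = suc m′

    nodes : List (Key c)
    nodes = deduplicate (Key-≟ c) (subtrees m t)

    nodes-unique : Unique nodes
    nodes-unique = DecUnique.deduplicate-! (Key-≟ c) (subtrees m t)

    ∈-nodes⁺ : ∀ {κ} → κ ∈ subtrees m t → κ ∈ nodes
    ∈-nodes⁺ = ∈-deduplicate⁺ (Key-≟ c)

    ∈-nodes⁻ : ∀ {κ} → κ ∈ nodes → κ ∈ subtrees m t
    ∈-nodes⁻ = ∈-deduplicate⁻ (Key-≟ c) (subtrees m t)

    depth-< : ∀ n t {κ} → κ ∈ subtrees n t → proj₁ κ < n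
    depth-< (suc n) t (here refl) = ℕ.≤-refl
    depth-< (suc n) t (there p)
      with xs , κ∈ , xs∈ ← ∈-concat⁻′ (tabulate λ j → subtrees n (Vec.lookup t j)) p
      with i , refl ← ∈-tabulate⁻ {f = λ j → subtrees n (Vec.lookup t j)} xs∈
      = ℕ.m<n⇒m<1+n (depth-< n (Vec.lookup t i) κ∈)

    key : Fin (length nodes) → Key c
    key = lookup nodes

    key∈ : ∀ α → key α ∈ subtrees m t
    key∈ α = ∈-nodes⁻ (∈-lookup α)

    depth : Fin (length nodes) → ℕ
    depth = proj₁ ∘ key

    label< : ∀ α → m ∸ suc (depth α) < m
    label< α = s≤s (ℕ.m∸n≤m m′ (depth α))

    label : Fin (length nodes) → Fin m
    label α = fromℕ< (label< α)

    label+depth : ∀ α → toℕ (label α) + suc (depth α) ≡ m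
    label+depth α = trans (cong (_+ suc (depth α)) (Fin.toℕ-fromℕ< (label< α))) (ℕ.m∸n+n≡m (depth-< m t (key∈ α)))

    -- The child is a separate argument so that it can be matched although the membership proof
    -- depends on it.
    arcTo : (r : Bool ⊎ Key c) → (∀ {κ} → r ≡ inj₂ κ → κ ∈ nodes) → Node (length nodes)
    arcTo (inj₁ true)  _ = ⊤ₙ
    arcTo (inj₁ false) _ = ⊥ₙ
    arcTo (inj₂ κ)     h = inner (Any.index (h refl))

    child∈ : ∀ α j {κ} → child (key α) j ≡ inj₂ κ → κ ∈ nodes
    child∈ α j eq = ∈-nodes⁺ (∈-subtrees-child m t {j = j} (key∈ α) eq)

    arc : Fin (length nodes) → Fin (suc c) → Node (length nodes)
    arc α j = arcTo (child (key α) j) (child∈ α j)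

    arcTo⁻ : ∀ r (h : ∀ {κ} → r ≡ inj₂ κ → κ ∈ nodes) {β} → arcTo r h ≡ inner β → r ≡ inj₂ (key β)
    arcTo⁻ (inj₂ κ) h refl = cong inj₂ (lookup-index (h refl))
    arcTo⁻ (inj₁ true)  h ()
    arcTo⁻ (inj₁ false) h ()

    arcTo⁺ : ∀ r (h : ∀ {κ} → r ≡ inj₂ κ → κ ∈ nodes) {β} → r ≡ inj₂ (key β) → arcTo r h ≡ inner β
    arcTo⁺ (inj₂ κ) h {β} refl = cong inner (lookup-injective nodes-unique (sym (lookup-index (h refl))))

    child-depth : ∀ κ j {κ′} → child κ j ≡ inj₂ κ′ → proj₁ κ ≡ suc (proj₁ κ′)
    child-depth (suc n , t) j refl = refl

    arc-depth : ∀ {α j β} → arc α j ≡ inner β → depth α ≡ suc (depth β)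
    arc-depth {α} {j} eq = child-depth (key α) j (arcTo⁻ _ (child∈ α j) eq)

    rootIndex : ∃[ α ] key α ≡ (m′ , t)
    rootIndex = ∈⇒lookup (∈-nodes⁺ (here refl))

    dd : DD c m
    dd = record
      { inners = length nodes
      ; label = label
      ; arc = arc
      ; arc-label = λ {α} {j} {β} eq → ℕ.+-cancelʳ-≡ (suc (depth β)) _ _ (begin
          toℕ (label β) + suc (depth β)         ≡⟨ label+depth β ⟩
          m                                     ≡⟨ label+depth α ⟨
          toℕ (label α) + suc (depth α)         ≡⟨ cong (λ d → toℕ (label α) + suc d) (arc-depth {α} {j} {β} eq) ⟩
          toℕ (label α) + suc (suc (depth β))   ≡⟨ ℕ.+-suc (toℕ (label α)) (suc (depth β)) ⟩
          suc (toℕ (label α)) + suc (depth β)   ∎)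
      ; root = inner (proj₁ rootIndex)
      ; root-source = λ α j eq → ℕ.<-irrefl
          (trans (arc-depth {α} {j} eq) (cong (suc ∘ proj₁) (proj₂ rootIndex))) (depth-< m t (key∈ α))
      ; root-unique = parent
      }
      where
      open ≡-Reasoning
      parent : ∀ α → inner α ≢ inner (proj₁ rootIndex) → ∃[ β ] ∃[ j ] arc β j ≡ inner α
      parent α ≢root with subtrees-parent m′ t (key∈ α)
      ... | inj₁ eq = contradiction (cong inner (lookup-injective nodes-unique (trans eq (sym (proj₂ rootIndex))))) ≢root
      ... | inj₂ (κ , j , κ∈ , eq) with ∈⇒lookup (∈-nodes⁺ κ∈)
      ...   | β , refl = β , j , arcTo⁺ _ (child∈ β j) eq

    open DD dd using (Path; Uses; _represents_; Represents; width; end; step)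

    -- The invariant along a path: the node stands for a tree of which n letters remain to be read.
    data At : Node (length nodes) → ∀ n → Tree c n → Set where
      at-⊤ : At ⊤ₙ zero true
      at-⊥ : At ⊥ₙ zero false
      at   : ∀ {α n t} → key α ≡ (n , t) → At (inner α) (suc n) t

    arc-At : ∀ {α n t} j → key α ≡ (n , t) → At (arc α j) n (Vec.lookup t j)
    arc-At {α} j eq = go (child (key α) j) (child∈ α j) eq refl
      where
      go : ∀ {n t} r (h : ∀ {κ} → r ≡ inj₂ κ → κ ∈ nodes) → key α ≡ (n , t) → r ≡ child (key α) j → At (arcTo r h) n (Vec.lookup t j)
      go {zero} {t} r h eq eq′ with trans eq′ (cong (λ κ → child κ j) eq)
      ... | refl with Vec.lookup t j
      ...   | true  = at-⊤
      ...   | false = at-⊥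
      go {suc n} r h eq eq′ with trans eq′ (cong (λ κ → child κ j) eq)
      ... | refl = at (sym (lookup-index (h refl)))

    -- The i-th letter of the last n letters belongs to the edge m ∸ n + i, which is written
    -- additively to avoid truncated subtraction.
    Spells : ∀ {ν} → Path ν → ∀ n → Vec X n → Set
    Spells p n w = ∀ j e → Uses p j e ⇔ (∃[ i ] Vec.lookup w i ≡ j × toℕ e + n ≡ m + toℕ i)

    spells-end : Spells end 0 Vec.[]
    spells-end j e = mk⇔ ⊥-elim λ ()

    spells-step : ∀ {α n t} j {p : Path (arc α j)} {w} → key α ≡ (n , t) → Spells p n w →
                  Spells (step α j p) (suc n) (j Vec.∷ w)
    spells-step {α} {n} j {w = w} eq sp j′ e = mk⇔ to from
      where
      here-≡ : toℕ (label α) + suc n ≡ m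
      here-≡ = subst (λ d → toℕ (label α) + suc d ≡ m) (cong proj₁ eq) (label+depth α)
      to : _ → ∃[ i ] Vec.lookup (j Vec.∷ w) i ≡ j′ × toℕ e + suc n ≡ m + toℕ i
      to (inj₁ (refl , refl)) = zero , refl , trans here-≡ (sym (ℕ.+-identityʳ m))
      to (inj₂ u) = let i , r , s = Equivalence.to (sp j′ e) u in
                    suc i , r , trans (ℕ.+-suc (toℕ e) n) (trans (cong suc s) (sym (ℕ.+-suc m (toℕ i))))
      from : ∃[ i ] Vec.lookup (j Vec.∷ w) i ≡ j′ × toℕ e + suc n ≡ m + toℕ i → _
      from (zero , r , s) = inj₁ (r , Fin.toℕ-injective (ℕ.+-cancelʳ-≡ (suc n) _ _
                              (trans here-≡ (sym (trans s (ℕ.+-identityʳ m))))))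
      from (suc i , r , s) = inj₂ (Equivalence.from (sp j′ e) (i , r ,
                              ℕ.suc-injective (trans (sym (ℕ.+-suc (toℕ e) n)) (trans s (ℕ.+-suc m (toℕ i))))))

    toPath : ∀ {ν n t} → At ν n t → (w : Vec X n) → T (run n t w) → Σ[ p ∈ Path ν ] Spells p n w
    toPath at-⊤ Vec.[] _ = end , spells-end
    toPath (at {α} eq) (j Vec.∷ w) ok =
      let p , sp = toPath (arc-At j eq) w ok in step α j p , spells-step j eq sp

    fromPath : ∀ {ν n t} → At ν n t → (p : Path ν) → Σ[ w ∈ Vec X n ] T (run n t w) × Spells p n w
    fromPath at-⊤ end = Vec.[] , tt , spells-end
    fromPath (at eq) (step α j p) =
      let w , ok , sp = fromPath (arc-At j eq) p in j Vec.∷ w , ok , spells-step j eq sp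

    codes : ∀ B → Σ[ w ∈ Vec X m ] Codes w B
    codes B = Vec.tabulate color , λ γ e → subst (λ x → T (part γ e) ⇔ x ≡ suc γ) (sym (Vec.lookup∘tabulate color e)) (spec γ e)
      where
      open ColoredSubset B
      color : Fin m → X
      color e with any? (λ γ → T? (part γ e))
      ... | yes (γ , _) = suc γ
      ... | no _        = zero
      spec : ∀ γ e → T (part γ e) ⇔ color e ≡ suc γ
      spec γ e with any? (λ γ → T? (part γ e))
      ... | yes (γ′ , p) = mk⇔ (λ q → cong suc (disjoint p q)) λ { refl → p }
      ... | no ¬p        = mk⇔ (λ q → contradiction (γ , q) ¬p) λ ()

    spells⇔ : ∀ {ν} {p : Path ν} (w : Vec X m) → Spells p m w → ∀ j e → Uses p j e ⇔ Vec.lookup w e ≡ j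
    spells⇔ w sp j e = mk⇔
      (λ u → let i , r , s = Equivalence.to (sp j e) u
             in trans (cong (Vec.lookup w) (Fin.toℕ-injective (ℕ.+-cancelʳ-≡ m _ _ (trans s (ℕ.+-comm m (toℕ i)))))) r)
      (λ r → Equivalence.from (sp j e) (e , r , ℕ.+-comm (toℕ e) m))

    dd-represents : (𝓕 : ColoredSubset c (Fin m) → Set) → (∀ B w → Codes w B → 𝓕 B ⇔ T (run m t w)) → Represents 𝓕
    dd-represents 𝓕 h B = mk⇔ to from
      where
      to : 𝓕 B → Σ[ p ∈ Path _ ] p represents B
      to f = let w , cd = codes B
                 p , sp = toPath (at (proj₂ rootIndex)) w (Equivalence.to (h B w cd) f)
             in p , λ γ e → mk⇔
               (λ q → Equivalence.from (spells⇔ w sp (suc γ) e) (Equivalence.to (cd γ e) q))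
               (λ u → Equivalence.from (cd γ e) (Equivalence.to (spells⇔ w sp (suc γ) e) u))
      from : (Σ[ p ∈ Path _ ] p represents B) → 𝓕 B
      from (p , rep) =
        let w , ok , sp = fromPath (at (proj₂ rootIndex)) p
        in Equivalence.from (h B w λ γ e → mk⇔
             (λ q → Equivalence.to (spells⇔ w sp (suc γ) e) (Equivalence.to (rep γ e) q))
             (λ eq → Equivalence.from (rep γ e) (Equivalence.from (spells⇔ w sp (suc γ) e) eq))) ok

  -- Nodes of one level with nonempty residuals are told apart by the codes of
  -- prefixes leading to them; at most one further node has an empty residual.
  module MinimalWidth (m′ : ℕ) (f : List X → Bool) where
    open Minimal m′ (build (suc m′) f)
    private
      m = suc m′

    module _ (i : Fin m) (code : List X → Fin N)
      (exchange : ∀ p q → length p ≡ toℕ i → length q ≡ toℕ i → code p ≡ code q →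
                  (∃[ s ] length p + length s ≡ m × T (f (p ++ s))) → (∃[ s ] length q + length s ≡ m × T (f (q ++ s))) →
                  ∀ s → length p + length s ≡ m → T (f (p ++ s)) → T (f (q ++ s))) where

      private
        residual : ∀ α → ∃[ p ] length p + suc (depth α) ≡ m × proj₂ (key α) ≡ build (suc (depth α)) (λ s → f (p ++ s))
        residual α = ∈-subtrees-build m f (key∈ α)

        prefix : Fin (length nodes) → List X
        prefix = proj₁ ∘ residual

        code⁺ : Fin (length nodes) → Fin (suc N)
        code⁺ α with word? (suc (depth α)) (λ s → f (prefix α ++ s))
        ... | yes _ = suc (code (prefix α))
        ... | no _  = zero

        same-label : ∀ {α β} → label α ≡ i → label β ≡ i → depth α ≡ depth β
        same-label {α} {β} refl eq = ℕ.suc-injective (ℕ.+-cancelˡ-≡ (toℕ (label α)) _ _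
          (trans (label+depth α) (sym (trans (cong (λ l → toℕ l + suc (depth β)) (sym eq)) (label+depth β)))))

        prefix-length : ∀ {α} → label α ≡ i → length (prefix α) ≡ toℕ i
        prefix-length {α} refl = ℕ.+-cancelʳ-≡ (suc (depth α)) _ _ (trans (proj₁ (proj₂ (residual α))) (sym (label+depth α)))

        key-≡ : ∀ {κ κ′ : Key c} (eq : proj₁ κ ≡ proj₁ κ′) (g g′ : List X → Bool) →
                proj₂ κ ≡ build _ g → proj₂ κ′ ≡ build _ g′ →
                build (suc (proj₁ κ)) g ≡ build _ g′ → κ ≡ κ′
        key-≡ refl g g′ refl refl e = cong (_ ,_) e

        code⁺-inj : ∀ {α β} → label α ≡ i → label β ≡ i → code⁺ α ≡ code⁺ β → α ≡ β
        code⁺-inj {α} {β} lα lβ eq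
          with word? (suc (depth α)) (λ s → f (prefix α ++ s)) | word? (suc (depth β)) (λ s → f (prefix β ++ s))
        ... | no ¬p | no ¬q = lookup-injective nodes-unique
              (key-≡ (same-label {α} {β} lα lβ) (λ _ → false) (λ _ → false)
                (trans (proj₂ (proj₂ (residual α))) (build-empty _ _ ¬p))
                (trans (proj₂ (proj₂ (residual β))) (build-empty _ _ ¬q)) refl)
        ... | yes (s , ls , p) | yes (s′ , ls′ , q) = lookup-injective nodes-unique
              (key-≡ (same-label {α} {β} lα lβ) (λ s → f (prefix α ++ s)) (λ s → f (prefix β ++ s)) (proj₂ (proj₂ (residual α))) (proj₂ (proj₂ (residual β)))
                (build-cong (suc (depth α)) λ r lr → T-ext
                  (exchange _ _ pα pβ codes≡ aα aβ r (lenα r lr))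
                  (exchange _ _ pβ pα (sym codes≡) aβ aα r (lenβ r (trans lr (cong suc (same-label {α} {β} lα lβ)))))))
              where
              codes≡ = Fin.suc-injective eq
              pα = prefix-length {α} lα
              pβ = prefix-length {β} lβ
              lenα : ∀ r → length r ≡ suc (depth α) → length (prefix α) + length r ≡ m
              lenα r lr = trans (cong (length (prefix α) +_) lr) (proj₁ (proj₂ (residual α)))
              lenβ : ∀ r → length r ≡ suc (depth β) → length (prefix β) + length r ≡ m
              lenβ r lr = trans (cong (length (prefix β) +_) lr) (proj₁ (proj₂ (residual β)))
              aα = s , lenα s ls , p
              aβ = s′ , lenβ s′ ls′ , q

      level-width : length (filter (λ α → label α ≟ i) (allFin (length nodes))) ≤ suc N
      level-width = injective-length _ (Unique.filter⁺ (λ α → label α ≟ i) {xs = allFin (length nodes)} (Unique.allFin⁺ _)) code⁺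
        λ {α} {β} p q → code⁺-inj (proj₂ (∈-filter⁻ (λ α → label α ≟ i) {xs = allFin (length nodes)} p))
                                   (proj₂ (∈-filter⁻ (λ α → label α ≟ i) {xs = allFin (length nodes)} q))

    width-≤ : ∀ {W} → (∀ i → length (filter (λ α → label α ≟ i) (allFin (length nodes))) ≤ W) → DD.width dd ≤ W
    width-≤ h = max≤v⁺ z≤n (All.map⁺ (All.tabulate {xs = allFin m} λ {i} _ → h i))

empty : ∀ {c m} → DD c m
empty = record
  { inners = 0 ; label = λ () ; arc = λ () ; arc-label = λ {α} → contradiction α λ ()
  ; root = ⊥ₙ ; root-source = λ () ; root-unique = λ ()
  }

empty-represents : ∀ {c m} {𝓕 : ColoredSubset c (Fin m) → Set} → (∀ B → ¬ 𝓕 B) → DD.Represents empty 𝓕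
empty-represents ¬𝓕 B = mk⇔ (λ f → contradiction f (¬𝓕 B)) λ { (() , _) }

width-empty : ∀ {c} m → DD.width (empty {c} {m}) ≤ 0
width-empty m = max≤v⁺ z≤n (All.map⁺ (All.tabulate {xs = allFin m} λ _ → z≤n))

-- Junk when m = 0.
minimal : ∀ {c} m → Tree c m → DD c m
minimal zero     t = empty
minimal (suc m′) t = Minimal.dd m′ t

minimal-represents : ∀ {c m} → 0 < m → (f : List (Fin (suc c)) → Bool) {𝓕 : ColoredSubset c (Fin m) → Set} →
                     (∀ B (w : Vec _ m) → Codes w B → 𝓕 B ⇔ T (f (Vec.toList w))) →
                     DD.Represents (minimal m (build m f)) 𝓕
minimal-represents {m = m@(suc m′)} _ f {𝓕} h =
  Minimal.dd-represents m′ (build m f) 𝓕 λ B w cd → subst (λ b → 𝓕 B ⇔ T b) (sym (run-build m f w)) (h B w cd)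

minimal-width : ∀ {c m} → 0 < m → (f : List (Fin (suc c)) → Bool) → ∀ {W} →
  (∀ (i : Fin m) → ∃[ N ] suc N ≤ W × (Σ[ code ∈ (List (Fin (suc c)) → Fin N) ]
    (∀ p q → length p ≡ toℕ i → length q ≡ toℕ i → code p ≡ code q →
      ∃ (λ s → T (f (p ++ s))) → ∃ (λ s → T (f (q ++ s))) → ∀ s → T (f (p ++ s)) → T (f (q ++ s))))) →
  DD.width (minimal m (build m f)) ≤ W
minimal-width {m = suc m′} _ f h = MinimalWidth.width-≤ m′ f λ i →
  let N , N≤W , code , ex = h i
  in ℕ.≤-trans (MinimalWidth.level-width m′ f i code λ p q lp lq e (s₁ , _ , a₁) (s₂ , _ , a₂) s _ a →
       ex p q lp lq e (s₁ , a₁) (s₂ , a₂) s a) N≤W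

-- Exchanging prefixes

-- Reachability, with the intermediate vertices restricted to a list (Warshall).
module Reachability {A : Set} (_≟ₐ_ : DecidableEquality A) {R : Rel A 0ℓ} (R? : Decidable R) where

  Via : List A → A → A → Set
  Via []       u v = u ≡ v ⊎ R u v
  Via (k ∷ ks) u v = Via ks u v ⊎ Via ks u k × Via ks k v

  via? : ∀ ks → Decidable (Via ks)
  via? []       u v = (u ≟ₐ v) ⊎-dec R? u v
  via? (k ∷ ks) u v = via? ks u v ⊎-dec (via? ks u k ×-dec via? ks k v)

  Via⇒Star : ∀ ks {u v} → Via ks u v → Star R u v
  Via⇒Star []       (inj₁ refl)    = ε
  Via⇒Star []       (inj₂ r)       = r ◅ ε
  Via⇒Star (k ∷ ks) (inj₁ p)       = Via⇒Star ks p
  Via⇒Star (k ∷ ks) (inj₂ (p , q)) = Via⇒Star ks p ◅◅ Via⇒Star ks q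

  -- Walks are spliced without growing the list: when both halves pass through the head, everything
  -- between its first and last visit is dropped, and when they meet at the head itself, loops there
  -- are dropped.
  Via-trans : ∀ ks {u k v} → k ∈ ks → Via ks u k → Via ks k v → Via ks u v
  Via-trans (_ ∷ ks) (here refl) p q = inj₂ (to p , from q)
    where
    to : ∀ {u k} → Via ks u k ⊎ Via ks u k × Via ks k k → Via ks u k
    to = [ id , proj₁ ]′
    from : ∀ {k v} → Via ks k v ⊎ Via ks k k × Via ks k v → Via ks k v
    from = [ id , proj₂ ]′
  Via-trans (_ ∷ ks) (there k∈) (inj₁ p)       (inj₁ q)        = inj₁ (Via-trans ks k∈ p q)
  Via-trans (_ ∷ ks) (there k∈) (inj₁ p)       (inj₂ (q , q′)) = inj₂ (Via-trans ks k∈ p q , q′)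
  Via-trans (_ ∷ ks) (there k∈) (inj₂ (p , p′)) (inj₁ q)       = inj₂ (p , Via-trans ks k∈ p′ q)
  Via-trans (_ ∷ ks) (there k∈) (inj₂ (p , _)) (inj₂ (_ , q)) = inj₂ (p , q)

  Via-refl : ∀ ks {u v} → u ≡ v ⊎ R u v → Via ks u v
  Via-refl []       p = p
  Via-refl (k ∷ ks) p = inj₁ (Via-refl ks p)

  module _ (ks : List A) (full : ∀ u → u ∈ ks) where
    Star⇒Via : ∀ {u v} → Star R u v → Via ks u v
    Star⇒Via ε        = Via-refl ks (inj₁ refl)
    Star⇒Via (r ◅ rs) = Via-trans ks (full _) (Via-refl ks (inj₂ r)) (Star⇒Via rs)

    abstract
      star? : Decidable (Star R)
      star? u v = map′ (Via⇒Star ks) Star⇒Via (via? ks u v)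

-- N will be the set of vertices with an edge still to come. The condition `∃ (R x)` excludes
-- isolated vertices, which do not belong to the colour subgraph.
Closed : {A : Set} → (A → Set) → (A → A → Set) → Set
Closed N R = ∃[ x ] ∃ (R x) × (∀ u → N u → ¬ Star R x u)

module _ {A : Set} {P Q S : A → A → Set} {N : A → Set} where

  neighbour-along : Symmetric Q → ∀ {x y} → ∃ (Q x) → Star Q x y → ∃ (Q y)
  neighbour-along Q-sym n ε        = n
  neighbour-along Q-sym n (e ◅ es) = neighbour-along Q-sym (_ , Q-sym e) es

  -- P is the part of a colour built from a prefix, S the part added later and
  -- N the set of the vertices that S may touch.
  ConnOn-exchange :
    Symmetric P → Symmetric Q → Symmetric S → (∀ {u v} → S u v → N u) →
    (∀ {u v} → N u → N v → Star P u v → Star Q u v) →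
    (∀ {u} → N u → ∃ (Q u) → ∃ (P u)) →
    (Closed N Q → Closed N P) → (ConnOn P → ConnOn Q) →
    Closed N Q ⊎ (∀ x → ∃ (Q x) → ∃[ u ] N u × Star Q x u) →
    ConnOn (λ u v → P u v ⊎ S u v) → ConnOn (λ u v → Q u v ⊎ S u v)
  -- P then has a component missing N too. No edge of S can leave it, so it contains everything, S
  -- is empty, and only the connectedness of P itself has to be carried over to Q.
  ConnOn-exchange P-sym Q-sym S-sym S⇒N P⇒Q Q⇒P cl co (inj₁ closed) h x y nx ny =
    gmap id inj₁ (co P-conn x y (only-Q x nx) (only-Q y ny))
    where
    PS QS : A → A → Set
    PS u v = P u v ⊎ S u v
    QS u v = Q u v ⊎ S u v
    x₀ = proj₁ (cl closed)
    n₀ = proj₁ (proj₂ (cl closed))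
    x₀↛N = proj₂ (proj₂ (cl closed))
    stays : ∀ {z y} → Star P x₀ z → Star PS z y → Star P x₀ y
    stays p ε              = p
    stays p (inj₁ e ◅ es) = stays (p ◅◅ e ◅ ε) es
    stays p (inj₂ s ◅ es) = contradiction p (x₀↛N _ (S⇒N s))
    all : ∀ y → ∃ (PS y) → Star P x₀ y
    all y ny = stays ε (h x₀ y (proj₁ n₀ , inj₁ (proj₂ n₀)) ny)
    no-S : ∀ {u v} → ¬ S u v
    no-S s = x₀↛N _ (S⇒N s) (all _ (_ , inj₂ s))
    only-Q : ∀ x → ∃ (QS x) → ∃ (Q x)
    only-Q x (y , inj₁ q) = y , q
    only-Q x (y , inj₂ s) = contradiction s no-S
    P-conn : ConnOn P
    P-conn x y (x′ , p) (y′ , p′) = reverse P-sym (all x (x′ , inj₁ p)) ◅◅ all y (y′ , inj₁ p′)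
  -- Both ends first walk inside Q to a vertex of N. A walk in the union of P and S between such
  -- vertices is then replayed: `simulate` collects a stretch of P in its argument p, trades it for
  -- a walk in Q when it reaches N, and keeps the steps in S.
  ConnOn-exchange P-sym Q-sym S-sym S⇒N P⇒Q Q⇒P cl co (inj₂ open′) h x y nx ny =
    let x′ , Nx′ , x→x′ , nx′ = reach x nx
        y′ , Ny′ , y→y′ , ny′ = reach y ny
    in gmap id inj₁ x→x′ ◅◅ simulate Nx′ Ny′ ε (h x′ y′ nx′ ny′) ◅◅ gmap id inj₁ (reverse Q-sym y→y′)
    where
    PS QS : A → A → Set
    PS u v = P u v ⊎ S u v
    QS u v = Q u v ⊎ S u v
    reach : ∀ x → ∃ (QS x) → ∃[ x′ ] N x′ × Star Q x x′ × ∃ (PS x′)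
    reach x (y , inj₂ s) = x , S⇒N s , ε , (y , inj₂ s)
    reach x (y , inj₁ q) =
      let x′ , Nx′ , x→x′ = open′ x (y , q)
          z , p = Q⇒P Nx′ (neighbour-along Q-sym (y , q) x→x′)
      in x′ , Nx′ , x→x′ , (z , inj₁ p)
    simulate : ∀ {z′ z y} → N z′ → N y → Star P z′ z → Star PS z y → Star QS z′ y
    simulate Nz Ny p ε             = gmap id inj₁ (P⇒Q Nz Ny p)
    simulate Nz Ny p (inj₁ e ◅ es) = simulate Nz Ny (p ◅◅ e ◅ ε) es
    simulate Nz Ny p (inj₂ s ◅ es) =
      gmap id inj₁ (P⇒Q Nz (S⇒N s) p) ◅◅ inj₂ s ◅ simulate (S⇒N (S-sym s)) Ny ε es

-- Matching degrees with M

module Fits {A : Set} (_≟ₐ_ : DecidableEquality A) {Skip : A → Set} (skip? : U.Decidable Skip) where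
  open DecMembership _≟ₐ_ using (_∈?_)

  Fits : List A → List A → Set
  Fits M X = ∃[ L ] All Skip L × X ↭ M ++ L

  Fits-resp-↭ : ∀ {M M′ X X′} → M ↭ M′ → X ↭ X′ → Fits M X → Fits M′ X′
  Fits-resp-↭ p q (L , s , r) = L , s , ↭-trans (↭-sym q) (↭-trans r (↭.++⁺ʳ L p))

  Fits-∷⁻ : ∀ {d M X} → Fits (d ∷ M) (d ∷ X) → Fits M X
  Fits-∷⁻ (L , s , p) = L , s , ↭.drop-∷ p

  Fits-∷⁺ : ∀ {d M X} → Fits M X → Fits (d ∷ M) (d ∷ X)
  Fits-∷⁺ (L , s , p) = L , s , ↭-prep _ p

  Fits-skip⁺ : ∀ {d M X} → Skip d → Fits M X → Fits M (d ∷ X)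
  Fits-skip⁺ {d} {M} sd (L , s , p) = d ∷ L , sd ∷ s , ↭-trans (↭-prep d p) (↭-sym (shift d M L))

  Fits-skip⁻ : ∀ {d M X} → ¬ d ∈ M → Fits M (d ∷ X) → Skip d × Fits M X
  Fits-skip⁻ {d} {M} d∉ (L , s , p) with ∈-++⁻ M (∈-resp-↭ p (here refl))
  ... | inj₁ d∈ = contradiction d∈ d∉
  ... | inj₂ d∈ with ∈-∃++ d∈
  ...   | as , bs , refl = All.lookup s d∈ , as ++ bs ,
          All.++⁺ (All.++⁻ˡ as s) (All.tail (All.++⁻ʳ as s)) ,
          ↭.drop-∷ (↭-trans p (↭-trans (↭.++⁺ˡ M (shift d as bs)) (shift d M (as ++ bs))))

  fits? : ∀ M X → Dec (Fits M X)
  fits? [] X with All.all? skip? X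
  ... | yes s = yes (X , s , ↭-refl)
  ... | no ¬s = no λ (L , s , p) → ¬s (All-resp-↭ (↭-sym p) s)
  fits? (d ∷ M) X with d ∈? X
  ... | no d∉ = no λ (L , s , p) → d∉ (∈-resp-↭ (↭-sym p) (here refl))
  ... | yes d∈ with ∈-∃++ d∈
  ...   | as , bs , refl = map′
          (Fits-resp-↭ ↭-refl (↭-sym (shift d as bs)) ∘ Fits-∷⁺)
          (Fits-∷⁻ ∘ Fits-resp-↭ ↭-refl (shift d as bs)) (fits? M (as ++ bs))

  sel : ∀ {a} → Vec A a → Vec Bool a → List A
  sel Vec.[]       Vec.[]           = []
  sel (d Vec.∷ ds) (true Vec.∷ bs)  = d ∷ sel ds bs
  sel (d Vec.∷ ds) (false Vec.∷ bs) = sel ds bs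

  sel-all : ∀ {a} (ds : Vec A a) → sel ds (Vec.replicate a true) ≡ Vec.toList ds
  sel-all Vec.[]       = refl
  sel-all (d Vec.∷ ds) = cong (d ∷_) (sel-all ds)

  take : ∀ {a} d (ds : Vec A a) bs → (∃[ bs′ ] sel ds bs ↭ d ∷ sel ds bs′) ⊎ ¬ d ∈ sel ds bs
  take d Vec.[] Vec.[] = inj₂ λ ()
  take d (e Vec.∷ ds) (false Vec.∷ bs) =
    Sum.map₁ (λ (bs′ , p) → false Vec.∷ bs′ , p) (take d ds bs)
  take d (e Vec.∷ ds) (true Vec.∷ bs) with d ≟ₐ e
  ... | yes refl = inj₁ (false Vec.∷ bs , ↭-refl)
  ... | no d≢e with take d ds bs
  ...   | inj₁ (bs′ , p) = inj₁ (true Vec.∷ bs′ , ↭-trans (↭-prep e p) (swap e d ↭-refl))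
  ...   | inj₂ d∉ = inj₂ λ { (here eq) → d≢e eq ; (there d∈) → d∉ d∈ }

  module _ {a : ℕ} (ds : Vec A a) where
    -- Matches xs greedily with the members of ds; the mask marks the unmatched ones.
    rest : List A → Vec Bool a → Maybe (Vec Bool a)
    rest []       bs = just bs
    rest (x ∷ xs) bs with take x ds bs
    ... | inj₁ (bs′ , _) = rest xs bs′
    ... | inj₂ _ with skip? x
    ...   | yes _ = rest xs bs
    ...   | no  _ = nothing

    FitsRest : Maybe (Vec Bool a) → List A → Set
    FitsRest nothing   Y = ⊥
    FitsRest (just bs) Y = Fits (sel ds bs) Y

    -- Greed loses nothing: equal degrees are interchangeable, so x may be cancelled against a
    -- member of M even if it could also be skipped. This does occur for a = 3, where the tuple (2)
    -- lies both in M and in Δ.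
    rest-spec : ∀ xs bs Y → Fits (sel ds bs) (xs ++ Y) ⇔ FitsRest (rest xs bs) Y
    rest-spec [] bs Y = mk⇔ id id
    rest-spec (x ∷ xs) bs Y with take x ds bs
    ... | inj₁ (bs′ , p) = mk⇔
          (Equivalence.to (rest-spec xs bs′ Y) ∘ Fits-∷⁻ ∘ Fits-resp-↭ p ↭-refl)
          (Fits-resp-↭ (↭-sym p) ↭-refl ∘ Fits-∷⁺ ∘ Equivalence.from (rest-spec xs bs′ Y))
    ... | inj₂ x∉ with skip? x
    ...   | yes s = mk⇔
            (Equivalence.to (rest-spec xs bs Y) ∘ proj₂ ∘ Fits-skip⁻ x∉)
            (Fits-skip⁺ s ∘ Equivalence.from (rest-spec xs bs Y))
    ...   | no ¬s = mk⇔ (¬s ∘ proj₁ ∘ Fits-skip⁻ x∉) ⊥-elim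

-- Acceptance, stated on all vertices of the host graph

IsZero : Vec ℕ c → Set
IsZero d = ∀ i → Vec.lookup d i ≡ 0

isΔ? : (d : Vec ℕ c) → Dec (IsΔ d)
isΔ? d = any? λ i → (Vec.lookup d i ℕ.≟ 2) ×-dec all? λ j → ¬? (j ≟ i) →-dec (Vec.lookup d j ℕ.≟ 0)

IsΔ₀ : Vec ℕ c → Set
IsΔ₀ d = IsΔ d ⊎ IsZero d

isΔ₀? : (d : Vec ℕ c) → Dec (IsΔ₀ d)
isΔ₀? d = isΔ? d ⊎-dec all? λ i → Vec.lookup d i ℕ.≟ 0

degree-≟ : DecidableEquality (Vec ℕ c)
degree-≟ = Vec.≡-dec ℕ._≟_

module FitsΔ₀ {c : ℕ} = Fits (degree-≟ {c}) isΔ₀?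
module FitsΔ {c : ℕ} = Fits (degree-≟ {c}) isΔ?

abstract
  ConnOn? : {R : Fin n → Fin n → Set} → Decidable R → Dec (ConnOn R)
  ConnOn? R? = all? λ u → all? λ v → any? (R? u) →-dec (any? (R? v) →-dec star? (allFin _) ∈-allFin u v)
    where open Reachability _≟_ R?

-- 𝒞* for the edge-induced subgraph: isolated vertices are tolerated.
Accepted : List (Vec ℕ c) → ColoredGraph c → Set
Accepted M F = FitsΔ₀.Fits M (DS F) × (∀ γ → ConnOn (ColoredGraphProperties.E F γ))

abstract
  accepted? : (M : List (Vec ℕ c)) (F : ColoredGraph c) → Dec (Accepted M F)
  accepted? M F = FitsΔ₀.fits? M (DS F) ×-dec all? λ γ → ConnOn? λ u v → T? (ColoredGraph.part F γ (u , v))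

module _ {c : ℕ} (F : ColoredGraph c) where
  open ColoredGraphProperties F
  private
    G  = underlying F
    vs = nonIsolated G
    f  = lookup vs
    module F′ = ColoredGraphProperties (coloredEdgeInduced F)

    f-inj : Injective _≡_ _≡_ f
    f-inj = lookup-injective (nonIsolated-unique G)

    onto : ∀ {γ u v} → E γ u v → ∃[ a ] f a ≡ u
    onto {γ} {u} {v} e = ∈⇒lookup (∈-nonIsolated⁺ G (Equivalence.from (Adj-underlying F u v) (γ , e)))

    degree-induced : ∀ a → coloredDegree (coloredEdgeInduced F) a ≡ coloredDegree F (f a)
    degree-induced a = Vec.tabulate-cong λ γ → #-bij (λ b → F′.part γ (a , b)) (λ v → part γ (f a , v)) f f-inj
      (λ _ e → e) λ v e → let b , eq = onto (edges-sym e) in b , eq , subst (λ v → E γ (f a) v) (sym eq) e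

    DS-induced : DS (coloredEdgeInduced F) ≡ map (coloredDegree F) vs
    DS-induced = trans (List.map-cong degree-induced (allFin (length vs)))
      (trans (List.map-tabulate id (coloredDegree F ∘ f))
      (trans (sym (List.map-tabulate f (coloredDegree F))) (cong (map (coloredDegree F)) (List.tabulate-lookup vs))))

    compl : ∃[ zs ] allFin order ↭ vs ++ zs
    compl = Unique-complement (nonIsolated-unique G) λ _ → ∈-allFin _

    zs = proj₁ compl

    isolated : ∀ {x} → x ∈ zs → IsZero (coloredDegree F x)
    isolated {x} x∈ γ = trans (lookup-coloredDegree x γ) (#≡0 (λ v → part γ (x , v)) λ v e →
      Unique-++-disjoint (Unique-resp-↭ (proj₂ compl) (Unique.allFin⁺ order))
        (∈-nonIsolated⁺ G (Equivalence.from (Adj-underlying F x v) (γ , e))) x∈)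

    nonzero : ∀ {x} → x ∈ vs → ¬ IsZero (coloredDegree F x)
    nonzero {x} x∈ zero′ with ∈-nonIsolated⁻ G x∈
    ... | v , a with Equivalence.to (Adj-underlying F x v) a
    ...   | γ , e = #≡0⁻ (λ v → part γ (x , v)) (trans (sym (lookup-coloredDegree x γ)) (zero′ γ)) v e

    DS-split : DS F ↭ map (coloredDegree F) vs ++ map (coloredDegree F) zs
    DS-split = ↭-trans (↭.map⁺ (coloredDegree F) (proj₂ compl)) (↭-reflexive (map-++ (coloredDegree F) vs zs))

  module _ {M : List (Vec ℕ c)} (M-nonzero : ∀ {d} → d ∈ M → ¬ IsZero d) where
    private
      fits⁺ : FitsΔ.Fits M (DS (coloredEdgeInduced F)) → FitsΔ₀.Fits M (DS F)
      fits⁺ (L , s , p) = L ++ map (coloredDegree F) zs ,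
        All.++⁺ (All.map inj₁ s) (All.map⁺ (All.tabulate (inj₂ ∘ isolated))) ,
        ↭-trans DS-split (↭-trans (↭.++⁺ʳ _ (↭-trans (↭-reflexive (sym DS-induced)) p)) (↭-reflexive (++-assoc M L _)))

      drop-zeros : ∀ {X} (ws : List V) → (∀ {x} → x ∈ ws → IsZero (coloredDegree F x)) →
                   FitsΔ₀.Fits M (map (coloredDegree F) ws ++ X) → FitsΔ₀.Fits M X
      drop-zeros []       _ h = h
      drop-zeros (w ∷ ws) z h = drop-zeros ws (z ∘ there)
        (proj₂ (FitsΔ₀.Fits-skip⁻ (λ d∈ → M-nonzero d∈ (z (here refl))) h))

      fits⁻ : FitsΔ₀.Fits M (DS F) → FitsΔ.Fits M (DS (coloredEdgeInduced F))
      fits⁻ h with drop-zeros zs isolated (FitsΔ₀.Fits-resp-↭ ↭-refl (↭-trans DS-split (↭.++-comm (map (coloredDegree F) vs) _)) h)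
      ... | L , s , p = L , All.tabulate isΔ , ↭-trans (↭-reflexive DS-induced) p
        where
        isΔ : ∀ {d} → d ∈ L → IsΔ d
        isΔ {d} d∈ with All.lookup s d∈ | ∈-map⁻ (coloredDegree F) (∈-resp-↭ (↭-sym p) (∈-++⁺ʳ M d∈))
        ... | inj₁ Δ | _ = Δ
        ... | inj₂ z | x , x∈ , refl = contradiction z (nonzero x∈)

      conn⇔ : ∀ γ → Connected (colorSubgraph (coloredEdgeInduced F) γ) ⇔ ConnOn (E γ)
      conn⇔ γ = mk⇔
        (Equivalence.from onVs ∘ Equivalence.to (F′.Connected-colorSubgraph γ))
        (Equivalence.from (F′.Connected-colorSubgraph γ) ∘ Equivalence.to onVs)
        where onVs = ConnOn-on f f-inj (E γ) edges-sym onto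

    -- Vertices missed by the chosen edges have degree zero. No tuple of M is zero, so they can only
    -- be absorbed by the skipped part, and no other zero degree occurs there.
    𝒞*-edgeInduced : 𝒞* M (coloredEdgeInduced F) ⇔ Accepted M F
    𝒞*-edgeInduced = mk⇔
      (λ h → fits⁺ (𝒞*.degrees h) , λ γ → Equivalence.to (conn⇔ γ) (𝒞*.connected h γ))
      (λ (h , k) → record { degrees = fits⁻ h ; connected = λ γ → Equivalence.from (conn⇔ γ) (k γ) })

module _ (G : OrderedGraph) where
  open OrderedGraph G

  E-spanning : (D : ColoredSubset c (Fin size)) → ∀ γ u v →
               ColoredGraphProperties.E (spanningSubgraph G D) γ u v ⇔
               (∃[ e ] (u , v) ≐ edge e × T (ColoredSubset.part D γ e))
  E-spanning D γ u v = mk⇔ (⌊⌋⁻ (colorOf? G D γ (u , v))) (⌊⌋⁺ (colorOf? G D γ (u , v)))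

  Accepted-resp : ∀ {M} (D D′ : ColoredSubset c (Fin size)) →
                  (∀ γ e → T (ColoredSubset.part D γ e) ⇔ T (ColoredSubset.part D′ γ e)) →
                  Accepted M (spanningSubgraph G D) → Accepted M (spanningSubgraph G D′)
  Accepted-resp {M = M} D D′ eq (h , k) =
    subst (FitsΔ₀.Fits M) (List.map-cong (λ u → Vec.tabulate-cong λ γ →
      #-cong (λ v → ColoredGraph.part (spanningSubgraph G D) γ (u , v)) (λ v → ColoredGraph.part (spanningSubgraph G D′) γ (u , v))
        λ v → mk⇔ (to γ u v) (from γ u v)) (allFin _)) h ,
    λ γ u v (u′ , a) (v′ , b) → gmap id (λ {x} {y} → to γ x y) (k γ u v (u′ , from γ u u′ a) (v′ , from γ v v′ b))
    where
    to : ∀ γ u v → ColoredGraphProperties.E (spanningSubgraph G D) γ u v → ColoredGraphProperties.E (spanningSubgraph G D′) γ u v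
    to γ u v a = let e , p , t = Equivalence.to (E-spanning D γ u v) a
                 in Equivalence.from (E-spanning D′ γ u v) (e , p , Equivalence.to (eq γ e) t)
    from : ∀ γ u v → ColoredGraphProperties.E (spanningSubgraph G D′) γ u v → ColoredGraphProperties.E (spanningSubgraph G D) γ u v
    from γ u v a = let e , p , t = Equivalence.to (E-spanning D′ γ u v) a
                   in Equivalence.from (E-spanning D γ u v) (e , p , Equivalence.from (eq γ e) t)

  -- A word assigns colours to the edges in order; 0 means not chosen, also
  -- beyond the end of the word.
  at : List (Fin (suc c)) → ℕ → Fin (suc c)
  at []      _       = zero
  at (x ∷ w) zero    = x
  at (x ∷ w) (suc i) = at w i

  at-lookup : ∀ {n} (w : Vec (Fin (suc c)) n) i → Vec.lookup w i ≡ at (Vec.toList w) (toℕ i)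
  at-lookup (x Vec.∷ w) zero    = refl
  at-lookup (x Vec.∷ w) (suc i) = at-lookup w i

  at-< : ∀ (w : List (Fin (suc c))) i {γ : Fin c} → at w i ≡ suc γ → i < length w
  at-< (x ∷ w) zero    eq = s≤s z≤n
  at-< (x ∷ w) (suc i) eq = s≤s (at-< w i eq)

  -- The padding puts a suffix at its place in the edge order, so that prefix and suffix both become
  -- words over the same edges and their colourings can be united.
  late : ℕ → List (Fin (suc c)) → List (Fin (suc c))
  late i s = replicate i zero ++ s

  at-late : ∀ i (s : List (Fin (suc c))) j {γ : Fin c} → at (late i s) j ≡ suc γ → i ≤ j
  at-late zero    s j       eq = z≤n
  at-late (suc i) s (suc j) eq = s≤s (at-late i s j eq)

  at-++ : ∀ (p s : List (Fin (suc c))) j {γ : Fin c} →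
          at (p ++ s) j ≡ suc γ ⇔ (at p j ≡ suc γ ⊎ at (late (length p) s) j ≡ suc γ)
  at-++ []      s j       = mk⇔ inj₂ λ { (inj₁ ()) ; (inj₂ eq) → eq }
  at-++ (x ∷ p) s zero    = mk⇔ inj₁ λ { (inj₁ eq) → eq ; (inj₂ ()) }
  at-++ (x ∷ p) s (suc j) = at-++ p s j

  chosen : List (Fin (suc c)) → ColoredSubset c (Fin size)
  chosen w = record
    { part     = λ γ e → ⌊ at w (toℕ e) ≟ suc γ ⌋
    ; disjoint = λ {γ} {γ′} {e} a b → Fin.suc-injective
        (trans (sym (⌊⌋⁻ (at w (toℕ e) ≟ suc γ) a)) (⌊⌋⁻ (at w (toℕ e) ≟ suc γ′) b))
    }

  module Word {c : ℕ} (w : List (Fin (suc c))) = ColoredGraphProperties (spanningSubgraph G (chosen w))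

  E-word : ∀ {c} (w : List (Fin (suc c))) γ u v → Word.E w γ u v ⇔ (∃[ e ] (u , v) ≐ edge e × at w (toℕ e) ≡ suc γ)
  E-word w γ u v = mk⇔
    (λ a → let e , p , t = Equivalence.to (E-spanning (chosen w) γ u v) a in e , p , ⌊⌋⁻ (at w (toℕ e) ≟ suc γ) t)
    (λ (e , p , t) → Equivalence.from (E-spanning (chosen w) γ u v) (e , p , ⌊⌋⁺ (at w (toℕ e) ≟ suc γ) t))

  module _ {c : ℕ} (p s : List (Fin (suc c))) where
    E-++ : ∀ γ u v → Word.E (p ++ s) γ u v ⇔ (Word.E p γ u v ⊎ Word.E (late (length p) s) γ u v)
    E-++ γ u v = mk⇔
      (λ a → let e , q , t = Equivalence.to (E-word (p ++ s) γ u v) a in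
             Sum.map (λ t → Equivalence.from (E-word p γ u v) (e , q , t))
                     (λ t → Equivalence.from (E-word (late (length p) s) γ u v) (e , q , t))
                     (Equivalence.to (at-++ p s (toℕ e)) t))
      [ (λ a → let e , q , t = Equivalence.to (E-word p γ u v) a in
               Equivalence.from (E-word (p ++ s) γ u v) (e , q , Equivalence.from (at-++ p s (toℕ e)) (inj₁ t)))
      , (λ a → let e , q , t = Equivalence.to (E-word (late (length p) s) γ u v) a in
               Equivalence.from (E-word (p ++ s) γ u v) (e , q , Equivalence.from (at-++ p s (toℕ e)) (inj₂ t))) ]′

    deg-++ : ∀ γ u → Word.deg (p ++ s) γ u ≡ Word.deg p γ u + Word.deg (late (length p) s) γ u
    deg-++ γ u = #-⊎ (λ v → Word.part (p ++ s) γ (u , v)) (λ v → Word.part p γ (u , v))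
      (λ v → Word.part (late (length p) s) γ (u , v)) (E-++ γ u) disj
      where
      disj : ∀ v → Word.E p γ u v → ¬ Word.E (late (length p) s) γ u v
      disj v a b with Equivalence.to (E-word p γ u v) a | Equivalence.to (E-word (late (length p) s) γ u v) b
      ... | e , q , t | e′ , q′ , t′ with refl ← distinct {e} {e′} (≐-unique q q′) =
        ℕ.<⇒≱ (at-< p (toℕ e) t) (at-late (length p) s (toℕ e) t′)

-- Signatures of prefixes

-- Holds for all tuples of M, of Δ and for zero; the largest entry, `suc c`, is the leading degree
-- of the last vertex. It is downward closed and so passes from an accepted word to its prefixes.
Shape : (Fin c → ℕ) → Set
Shape {c} g = (∀ γ → g γ ≤ suc c) × (∀ γ γ′ → 2 ≤ g γ → 2 ≤ g γ′ → γ ≡ γ′)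

Shape-mono : {g h : Fin c → ℕ} → (∀ γ → g γ ≤ h γ) → Shape h → Shape g
Shape-mono g≤h (b , u) = (λ γ → ℕ.≤-trans (g≤h γ) (b γ)) ,
  λ γ γ′ p q → u γ γ′ (ℕ.≤-trans p (g≤h γ)) (ℕ.≤-trans q (g≤h γ′))

Shape-cong : {g h : Fin c → ℕ} → (∀ γ → g γ ≡ h γ) → Shape h → Shape g
Shape-cong eq = Shape-mono λ γ → ℕ.≤-reflexive (eq γ)

module _ {n : ℕ} where
  private
    mdeg≤1 : ∀ k (γ : Fin (suc n)) → toℕ γ ≢ lev k → mdeg k γ ≤ 1
    mdeg≤1 k γ ne with ℕ.<-cmp (toℕ γ) (lev k)
    ... | tri< lt _ _ = subst (_≤ 1) (sym (mdeg-< k γ lt)) z≤n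
    ... | tri≈ _ eq _ = contradiction eq ne
    ... | tri> _ _ gt = ℕ.≤-reflexive (mdeg-> k γ gt)

    ≥2⇒lev : ∀ k (γ : Fin (suc n)) → 2 ≤ mdeg k γ → toℕ γ ≡ lev k
    ≥2⇒lev k γ ge with toℕ γ ℕ.≟ lev k
    ... | yes eq = eq
    ... | no ne  = contradiction (ℕ.≤-trans ge (mdeg≤1 k γ ne)) λ { (s≤s ()) }

  mdeg-Shape : (k : Fin (3 + n)) → Shape (mdeg k)
  mdeg-Shape k = bound , λ γ γ′ p q → Fin.toℕ-injective (trans (≥2⇒lev k γ p) (sym (≥2⇒lev k γ′ q)))
    where
    bound : ∀ γ → mdeg k γ ≤ 2 + n
    bound γ with toℕ γ ℕ.≟ lev k
    ... | yes eq = subst (_≤ 2 + n) (sym (mdeg-≡ k γ eq)) (s≤s (lev< k))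
    ... | no ne  = ℕ.≤-trans (mdeg≤1 k γ ne) (s≤s z≤n)

  ∈-M⁻ : ∀ {d} → d ∈ M (suc n) → ∃[ k ] d ≡ Vec.tabulate (mdeg k)
  ∈-M⁻ {d} d∈ = let k , _ , eq = ∈-map⁻ (Vec.tabulate ∘ mdeg) {xs = allFin (3 + n)} (subst (d ∈_) (M≡mdeg n) d∈) in k , eq

  M-nonzero : ∀ {d} → d ∈ M (suc n) → ¬ IsZero d
  M-nonzero d∈ zero′ with ∈-M⁻ d∈
  ... | k , refl = contradiction (trans (sym (trans (Vec.lookup∘tabulate (mdeg k) γ) (mdeg-≡ k γ (Fin.toℕ-fromℕ< (lev< k))))) (zero′ γ)) λ ()
    where γ = fromℕ< (lev< k)

  M-Shape : ∀ {d} → d ∈ M (suc n) → Shape (Vec.lookup d)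
  M-Shape d∈ with ∈-M⁻ d∈
  ... | k , refl = Shape-cong (Vec.lookup∘tabulate (mdeg k)) (mdeg-Shape k)

  Δ₀-Shape : {d : Vec ℕ (suc n)} → IsΔ₀ d → Shape (Vec.lookup d)
  Δ₀-Shape (inj₂ zero′) = Shape-cong zero′ ((λ _ → z≤n) , λ _ _ ())
  Δ₀-Shape {d} (inj₁ (i , two , zeros)) = bound , λ γ γ′ p q → trans (at-i γ p) (sym (at-i γ′ q))
    where
    bound : ∀ γ → Vec.lookup d γ ≤ 2 + n
    bound γ with γ ≟ i
    ... | yes refl = subst (_≤ 2 + n) (sym two) (s≤s (s≤s z≤n))
    ... | no ne    = subst (_≤ 2 + n) (sym (zeros γ ne)) z≤n
    at-i : ∀ γ → 2 ≤ Vec.lookup d γ → γ ≡ i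
    at-i γ ge with γ ≟ i
    ... | yes eq = eq
    ... | no ne  = contradiction (subst (2 ≤_) (zeros γ ne) ge) λ ()

  Fits-Shape : ∀ {X d} → FitsΔ₀.Fits (M (suc n)) X → d ∈ X → Shape (Vec.lookup d)
  Fits-Shape {d = d} (L , s , p) d∈ with ∈-++⁻ (M (suc n)) (∈-resp-↭ p d∈)
  ... | inj₁ d∈M = M-Shape {d} d∈M
  ... | inj₂ d∈L = Δ₀-Shape {d} (All.lookup s d∈L)

⌊⌋-≡⇒ : {P Q : Set} (P? : Dec P) (Q? : Dec Q) → ⌊ P? ⌋ ≡ ⌊ Q? ⌋ → P → Q
⌊⌋-≡⇒ P? Q? eq p = ⌊⌋⁻ Q? (subst T eq (⌊⌋⁺ P? p))

-- Entries below 2 are settled by the first row of bits. The second row locates the one entry above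
-- 1, and the set of attained values tells how large it is, since in h too a value of at least 2
-- occurs only there.
Shape-≡ : {g h : Fin c → ℕ} → Shape g → Shape h → (∀ γ → ⌊ 1 ℕ.≤? g γ ⌋ ≡ ⌊ 1 ℕ.≤? h γ ⌋) → (∀ γ → ⌊ 2 ℕ.≤? g γ ⌋ ≡ ⌊ 2 ℕ.≤? h γ ⌋) →
          (∀ (t : Fin (2 + c)) → ⌊ any? (λ γ → g γ ℕ.≟ toℕ t) ⌋ ≡ ⌊ any? (λ γ → h γ ℕ.≟ toℕ t) ⌋) →
          ∀ γ → g γ ≡ h γ
Shape-≡ {g = g} {h} (gb , gu) (hb , hu) e₁ e₂ eₜ γ with 2 ℕ.≤? g γ
... | yes g≥2 with ⌊⌋-≡⇒ (any? λ γ′ → g γ′ ℕ.≟ toℕ t) (any? λ γ′ → h γ′ ℕ.≟ toℕ t) (eₜ t) (γ , sym (Fin.toℕ-fromℕ< (s≤s (gb γ))))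
  where t = fromℕ< (s≤s (gb γ))
...   | γ′ , eq with trans eq (Fin.toℕ-fromℕ< (s≤s (gb γ)))
...     | eq′ with hu γ γ′ (⌊⌋-≡⇒ (2 ℕ.≤? g γ) (2 ℕ.≤? h γ) (e₂ γ) g≥2) (subst (2 ≤_) (sym eq′) g≥2)
...       | refl = sym eq′
Shape-≡ {g = g} {h} (gb , gu) (hb , hu) e₁ e₂ eₜ γ | no g≱2 =
  small (ℕ.≰⇒> g≱2) (ℕ.≰⇒> λ h≥2 → g≱2 (⌊⌋-≡⇒ (2 ℕ.≤? h γ) (2 ℕ.≤? g γ) (sym (e₂ γ)) h≥2))
    (⌊⌋-≡⇒ (1 ℕ.≤? g γ) (1 ℕ.≤? h γ) (e₁ γ)) (⌊⌋-≡⇒ (1 ℕ.≤? h γ) (1 ℕ.≤? g γ) (sym (e₁ γ)))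
  where
  small : ∀ {x y} → x < 2 → y < 2 → (1 ≤ x → 1 ≤ y) → (1 ≤ y → 1 ≤ x) → x ≡ y
  small {0} {0} _ _ _ _ = refl
  small {0} {1} _ _ _ f = contradiction (f (s≤s z≤n)) λ ()
  small {1} {0} _ _ f _ = contradiction (f (s≤s z≤n)) λ ()
  small {1} {1} _ _ _ _ = refl
  small {suc (suc _)} (s≤s (s≤s ())) _ _ _
  small {_} {suc (suc _)} _ (s≤s (s≤s ())) _ _

-- The least index satisfying f, provided that d satisfies f; junk otherwise.
first : (Fin n → Bool) → Fin n → Fin n
first f zero    = zero
first f (suc d) = if f zero then zero else suc (first (f ∘ suc) d)

first-sat : (f : Fin n → Bool) (d : Fin n) → T (f d) → T (f (first f d))
first-sat f zero    p = p
first-sat f (suc d) p with f zero in eq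
... | true  = subst T (sym eq) tt
... | false = first-sat (f ∘ suc) d p

first-≡ : (f g : Fin n → Bool) → (∀ i → f i ≡ g i) → ∀ d d′ → T (f d) → T (g d′) → first f d ≡ first g d′
first-≡ f g f≗g zero    zero     p q = refl
first-≡ f g f≗g zero    (suc d′) p q with g zero in eq
... | true  = refl
... | false = contradiction (subst T (trans (f≗g zero) eq) p) id
first-≡ f g f≗g (suc d) zero     p q with f zero in eq
... | true  = refl
... | false = contradiction (subst T (trans (sym (f≗g zero)) eq) q) id
first-≡ f g f≗g (suc d) (suc d′) p q with f zero | g zero | f≗g zero
... | true  | true  | _ = refl
... | false | false | _ = cong suc (first-≡ (f ∘ suc) (g ∘ suc) (f≗g ∘ suc) d d′ p q)

tabulate-≗ : {A : Set} {f g : Fin n → A} → Vec.tabulate f ≡ Vec.tabulate g → ∀ i → f i ≡ g i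
tabulate-≗ {f = f} {g} eq i =
  trans (sym (Vec.lookup∘tabulate f i)) (trans (cong (λ v → Vec.lookup v i) eq) (Vec.lookup∘tabulate g i))

ConnOn-cong : {A : Set} {R R′ : A → A → Set} → (∀ u v → R u v ⇔ R′ u v) → ConnOn R → ConnOn R′
ConnOn-cong eq h u v (u′ , p) (v′ , q) =
  gmap id (λ {x} {y} → Equivalence.to (eq x y)) (h u v (u′ , Equivalence.from (eq u u′) p) (v′ , Equivalence.from (eq v v′) q))

module Signature {n : ℕ} (G : OrderedGraph) (i : Fin (OrderedGraph.size G)) where
  open OrderedGraph G
  private
    C = suc n
    V = Vertex graph
    Wd = List (Fin (suc C))

  E : Wd → Fin C → V → V → Set
  E w = Word.E G w

  deg : Wd → Fin C → V → ℕ
  deg w = Word.deg G w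

  degrees : Wd → V → Vec ℕ C
  degrees w = coloredDegree (spanningSubgraph G (chosen G w))

  Early : V → Set
  Early u = ∃[ j ] toℕ j < toℕ i × Incident u j

  Open : V → Set
  Open u = ∃[ j ] toℕ i ≤ toℕ j × Incident u j

  open? : ∀ u → Dec (Open u)
  open? u = any? λ j → (i Fin.≤? j) ×-dec incident? u j

  F : List V
  F = frontier i

  ℓ : ℕ
  ℓ = length F

  ∈-frontier⁺ : ∀ {u} → Early u → Open u → u ∈ F
  ∈-frontier⁺ e o = ∈-filter⁺ _ (∈-allFin _) (e , o)

  incident : ∀ {u v e} → (u , v) ≐ edge e → Incident u e
  incident (inj₁ (eq , _)) = inj₁ eq
  incident (inj₂ (eq , _)) = inj₂ eq

  E⇒Early : ∀ {p} → length p ≡ toℕ i → ∀ {γ u v} → E p γ u v → Early u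
  E⇒Early {p} len {γ} {u} {v} a = let e , q , t = Equivalence.to (E-word G p γ u v) a in
    e , subst (toℕ e <_) len (at-< G p (toℕ e) t) , incident q

  late⇒Open : ∀ {s γ u v} → E (late G (toℕ i) s) γ u v → Open u
  late⇒Open {s} {γ} {u} {v} a = let e , q , t = Equivalence.to (E-word G (late G (toℕ i) s) γ u v) a in
    e , at-late G (toℕ i) s (toℕ e) t , incident q

  star? : ∀ w γ → Decidable (Star (E w γ))
  star? w γ = Reachability.star? _≟_ (λ u v → T? (Word.part G w γ (u , v))) (allFin _) ∈-allFin

  abstract
    closed? : ∀ w γ → Dec (Closed Open (E w γ))
    closed? w γ = any? λ x → any? (λ y → T? (Word.part G w γ (x , y))) ×-dec all? λ u → open? u →-dec ¬? (star? w γ x u)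

  conn? : ∀ w γ → Dec (ConnOn (E w γ))
  conn? w γ = ConnOn? λ u v → T? (Word.part G w γ (u , v))

  E-sym : ∀ w {γ u v} → E w γ u v → E w γ v u
  E-sym w = Word.edges-sym G w

  -- The least frontier index in the component of j, a canonical name for that component.
  rep : Wd → Fin C → Fin ℓ → Fin ℓ
  rep w γ j = first (λ k → ⌊ star? w γ (lookup F k) (lookup F j) ⌋) j

  -- No later edge touches these vertices, so their degrees are final and can be matched with M at
  -- once.
  settled : List V
  settled = filter (λ u → ¬? (open? u)) (allFin _)

  compl : ∃[ zs ] allFin (Graph.order graph) ↭ settled ++ zs
  compl = Unique-complement (Unique.filter⁺ (λ u → ¬? (open? u)) {xs = allFin _} (Unique.allFin⁺ _)) λ _ → ∈-allFin _

  unsettled : List V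
  unsettled = proj₁ compl

  ∈-settled⁻ : ∀ {u} → u ∈ settled → ¬ Open u
  ∈-settled⁻ u∈ = proj₂ (∈-filter⁻ (λ u → ¬? (open? u)) {xs = allFin _} u∈)

  ∈-unsettled⁻ : ∀ {u} → u ∈ unsettled → Open u
  ∈-unsettled⁻ {u} u∈ with open? u
  ... | yes o = o
  ... | no ¬o = contradiction u∈ (Unique-++-disjoint (Unique-resp-↭ (proj₂ compl) (Unique.allFin⁺ _))
                  (∈-filter⁺ (λ u → ¬? (open? u)) (∈-allFin u) ¬o))

  M′ : Vec (Vec ℕ C) (length (M C))
  M′ = Vec.fromList (M C)

  full : Vec Bool (length (M C))
  full = Vec.replicate _ true

  open FitsΔ₀ {C} using (Fits; Fits-resp-↭; rest; FitsRest; rest-spec; sel; sel-all)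

  sel-full : sel M′ full ≡ M C
  sel-full = trans (sel-all M′) (Vec.toList∘fromList (M C))

  left : Wd → Maybe (Vec Bool (length (M C)))
  left w = rest M′ (map (degrees w) settled) full

  VertexSig = Vec (Bool × Bool × Fin ℓ) C × Vec Bool (2 + C)
  Sig = Vec VertexSig ℓ × Vec (Bool × Bool) C × Vec Bool (length (M C))

  -- What a continuation of a prefix w can see of it.
  vertexColor : Wd → Fin ℓ → Fin C → Bool × Bool × Fin ℓ
  vertexColor w j γ = ⌊ 1 ℕ.≤? deg w γ (lookup F j) ⌋ , ⌊ 2 ℕ.≤? deg w γ (lookup F j) ⌋ , rep w γ j

  hasDegree : Wd → Fin ℓ → Fin (2 + C) → Bool
  hasDegree w j t = ⌊ any? (λ γ → deg w γ (lookup F j) ℕ.≟ toℕ t) ⌋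

  vertexSig : Wd → Fin ℓ → VertexSig
  vertexSig w j = Vec.tabulate (vertexColor w j) , Vec.tabulate (hasDegree w j)

  colorSig : Wd → Fin C → Bool × Bool
  colorSig w γ = ⌊ closed? w γ ⌋ , ⌊ conn? w γ ⌋

  sig : Wd → Sig
  -- The default `full` confuses a failed match with an untouched M. This is harmless, since
  -- prefixes are exchanged only if they have accepted continuations, and then `left` is a `just`.
  sig w = Vec.tabulate (vertexSig w) , Vec.tabulate (colorSig w) , fromMaybe full (left w)

  Accepted′ : Wd → Set
  Accepted′ w = Accepted (M C) (spanningSubgraph G (chosen G w))

  module _ {p : Wd} (len : length p ≡ toℕ i) (s : Wd) where
    private
      s′ = late G (toℕ i) s

    E-split : ∀ γ u v → E (p ++ s) γ u v ⇔ (E p γ u v ⊎ E s′ γ u v)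
    E-split γ u v = subst (λ l → E (p ++ s) γ u v ⇔ (E p γ u v ⊎ E (late G l s) γ u v)) len (E-++ G p s γ u v)

    deg-split : ∀ γ u → deg (p ++ s) γ u ≡ deg p γ u + deg s′ γ u
    deg-split γ u = subst (λ l → deg (p ++ s) γ u ≡ deg p γ u + deg (late G l s) γ u) len (deg-++ G p s γ u)

    degrees-settled : map (degrees (p ++ s)) settled ≡ map (degrees p) settled
    degrees-settled = List.map-cong-local (All.tabulate λ {u} u∈ → Vec.tabulate-cong λ γ →
      trans (deg-split γ u) (trans (cong (deg p γ u +_)
        (#≡0 (λ v → Word.part G s′ γ (u , v)) λ v e → ∈-settled⁻ u∈ (late⇒Open {s} e))) (ℕ.+-identityʳ _)))

    DS-split : DS (spanningSubgraph G (chosen G (p ++ s))) ↭ map (degrees p) settled ++ map (degrees (p ++ s)) unsettled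
    DS-split = ↭-trans (↭.map⁺ (degrees (p ++ s)) (proj₂ compl)) (↭-reflexive
      (trans (map-++ (degrees (p ++ s)) settled unsettled) (cong (_++ map (degrees (p ++ s)) unsettled) degrees-settled)))

    -- Settled degrees are the same in p and in `p ++ s`, so their matching depends on p alone.
    Fits⇔left : Fits (M C) (DS (spanningSubgraph G (chosen G (p ++ s)))) ⇔
                FitsRest M′ (left p) (map (degrees (p ++ s)) unsettled)
    Fits⇔left = mk⇔
      (λ h → Equivalence.to spec (Fits-resp-↭ (↭-reflexive (sym sel-full)) DS-split h))
      (λ h → Fits-resp-↭ (↭-reflexive sel-full) (↭-sym DS-split) (Equivalence.from spec h))
      where spec = rest-spec M′ (map (degrees p) settled) full (map (degrees (p ++ s)) unsettled)

    alive-left : Accepted′ (p ++ s) → ∃[ bs ] left p ≡ just bs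
    alive-left (h , _) = go (left p) (Equivalence.to Fits⇔left h)
      where
      go : ∀ m → FitsRest M′ m (map (degrees (p ++ s)) unsettled) → ∃[ bs ] m ≡ just bs
      go (just bs) _ = bs , refl

    alive-Shape : Accepted′ (p ++ s) → ∀ u → Shape (λ γ → deg p γ u)
    alive-Shape (h , _) u = Shape-mono (λ γ → subst (deg p γ u ≤_)
        (sym (trans (Vec.lookup∘tabulate (λ γ → deg (p ++ s) γ u) γ) (deg-split γ u))) (ℕ.m≤m+n _ _))
      (Fits-Shape h (∈-map⁺ (degrees (p ++ s)) (∈-allFin u)))

  record SameSig (p q : Wd) : Set where
    field
      vertex-≡ : ∀ j γ → vertexColor p j γ ≡ vertexColor q j γ
      degree-≡ : ∀ j t → hasDegree p j t ≡ hasDegree q j t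
      color-≡  : ∀ γ → colorSig p γ ≡ colorSig q γ
      left-≡   : fromMaybe full (left p) ≡ fromMaybe full (left q)

  sig-≡ : ∀ p q → sig p ≡ sig q → SameSig p q
  sig-≡ p q eq = record
    { vertex-≡ = λ j → tabulate-≗ {f = vertexColor p j} {vertexColor q j} (cong proj₁ (vertices j))
    ; degree-≡ = λ j → tabulate-≗ {f = hasDegree p j} {hasDegree q j} (cong proj₂ (vertices j))
    ; color-≡  = tabulate-≗ {f = colorSig p} {colorSig q} (cong (proj₁ ∘ proj₂) eq)
    ; left-≡   = cong (proj₂ ∘ proj₂) eq
    }
    where
    vertices : ∀ j → vertexSig p j ≡ vertexSig q j
    vertices = tabulate-≗ {f = vertexSig p} {vertexSig q} (cong proj₁ eq)

  ∈F? : ∀ u → Dec (u ∈ F)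
  ∈F? u = Any.any? (u ≟_) F

  -- An open vertex off the frontier is incident to no edge before i. The prefix leaves it isolated,
  -- and the signature can be restricted to the frontier.
  no-E : ∀ {w u} → length w ≡ toℕ i → Open u → ¬ u ∈ F → ∀ {γ v} → ¬ E w γ u v
  no-E {w} len o u∉ e = u∉ (∈-frontier⁺ (E⇒Early {w} len e) o)

  hit : Wd → Fin C → Fin ℓ → Fin ℓ → Bool
  hit w γ j r = ⌊ star? w γ (lookup F r) (lookup F j) ⌋

  Star-rep : ∀ w γ j → Star (E w γ) (lookup F (rep w γ j)) (lookup F j)
  Star-rep w γ j = ⌊⌋⁻ (star? w γ (lookup F (rep w γ j)) (lookup F j))
    (first-sat (hit w γ j) j (⌊⌋⁺ (star? w γ (lookup F j) (lookup F j)) ε))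

  rep-≡ : ∀ w γ j k → Star (E w γ) (lookup F j) (lookup F k) → rep w γ j ≡ rep w γ k
  rep-≡ w γ j k es = first-≡ (hit w γ j) (hit w γ k)
    (λ r → T-ext
      (λ t → ⌊⌋⁺ (star? w γ (lookup F r) (lookup F k)) (⌊⌋⁻ (star? w γ (lookup F r) (lookup F j)) t ◅◅ es))
      (λ t → ⌊⌋⁺ (star? w γ (lookup F r) (lookup F j)) (⌊⌋⁻ (star? w γ (lookup F r) (lookup F k)) t ◅◅ reverse (E-sym w) es)))
    j k (⌊⌋⁺ (star? w γ (lookup F j) (lookup F j)) ε) (⌊⌋⁺ (star? w γ (lookup F k) (lookup F k)) ε)

  closed-or-open : ∀ w γ → Closed Open (E w γ) ⊎ (∀ x → ∃ (E w γ x) → ∃[ u ] Open u × Star (E w γ) x u)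
  closed-or-open w γ = go (closed? w γ)
    where
    go′ : ∀ x → ∃ (E w γ x) → ¬ Closed Open (E w γ) → Dec (∃[ u ] Open u × Star (E w γ) x u) → ∃[ u ] Open u × Star (E w γ) x u
    go′ x nx ¬cl (yes r) = r
    go′ x nx ¬cl (no ¬r) = contradiction (x , nx , λ u o st → ¬r (u , o , st)) ¬cl
    go : Dec (Closed Open (E w γ)) → _
    go (yes cl) = inj₁ cl
    go (no ¬cl) = inj₂ λ x nx → go′ x nx ¬cl (any? λ u → open? u ×-dec star? w γ x u)

  module _ {p q : Wd} (lenp : length p ≡ toℕ i) (lenq : length q ≡ toℕ i) (same : SameSig p q)
           (shapep : ∀ u → Shape (λ γ → deg p γ u)) (shapeq : ∀ u → Shape (λ γ → deg q γ u)) where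
    open SameSig same

    deg-≡ : ∀ {u} → Open u → ∀ γ → deg p γ u ≡ deg q γ u
    deg-≡ {u} o γ = go (∈F? u)
      where
      at-frontier : ∀ {u} → ∃[ j ] lookup F j ≡ u → deg p γ u ≡ deg q γ u
      at-frontier (j , refl) = Shape-≡ (shapep (lookup F j)) (shapeq (lookup F j))
        (λ γ → cong proj₁ (vertex-≡ j γ)) (λ γ → cong (proj₁ ∘ proj₂) (vertex-≡ j γ)) (degree-≡ j) γ
      go : Dec (u ∈ F) → deg p γ u ≡ deg q γ u
      go (no u∉)  = trans (#≡0 (λ v → Word.part G p γ (u , v)) λ _ → no-E {p} lenp o u∉)
                      (sym (#≡0 (λ v → Word.part G q γ (u , v)) λ _ → no-E {q} lenq o u∉))
      go (yes u∈) = at-frontier (∈⇒lookup u∈)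

    -- Off the frontier only the trivial walk exists. On it, both ends are joined in q to their
    -- representatives, which coincide because they coincide for p.
    Star-transfer : ∀ {γ u v} → Open u → Open v → Star (E p γ) u v → Star (E q γ) u v
    Star-transfer {γ} {u} {v} ou ov es = go (∈F? u) (∈F? v)
      where
      stuck : ∀ {u v} → Open u → ¬ u ∈ F → Star (E p γ) u v → u ≡ v
      stuck o u∉ ε       = refl
      stuck o u∉ (e ◅ _) = contradiction e (no-E {p} lenp o u∉)
      at-frontier : ∀ {u v} → ∃[ j ] lookup F j ≡ u → ∃[ k ] lookup F k ≡ v → Star (E p γ) u v → Star (E q γ) u v
      at-frontier (j , refl) (k , refl) es = reverse (E-sym q) (Star-rep q γ j) ◅◅
        subst (λ r → Star (E q γ) (lookup F r) (lookup F k)) (sym reps) (Star-rep q γ k)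
        where
        reps : rep q γ j ≡ rep q γ k
        reps = trans (sym (cong (proj₂ ∘ proj₂) (vertex-≡ j γ)))
                 (trans (rep-≡ p γ j k es) (cong (proj₂ ∘ proj₂) (vertex-≡ k γ)))
      go : Dec (u ∈ F) → Dec (v ∈ F) → Star (E q γ) u v
      go (no u∉)  _        = subst (Star (E q γ) u) (stuck ou u∉ es) ε
      go (yes _)  (no v∉)  = subst (λ w → Star (E q γ) w v) (stuck ov v∉ (reverse (E-sym p) es)) ε
      go (yes u∈) (yes v∈) = at-frontier (∈⇒lookup u∈) (∈⇒lookup v∈) es

    neighbour-transfer : ∀ {γ u} → Open u → ∃ (E q γ u) → ∃ (E p γ u)
    neighbour-transfer {γ} {u} o (v , e) = #>0 (λ v → Word.part G p γ (u , v))
      (subst (0 <_) (sym (deg-≡ o γ)) (∈-length (∈-sat⁺ (λ v → Word.part G q γ (u , v)) e)))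

    exchange′ : left p ≡ left q → ∀ s → Accepted′ (p ++ s) → Accepted′ (q ++ s)
    exchange′ left≡ s (h , k) =
      Equivalence.from (Fits⇔left {q} lenq s) (subst₂ (FitsRest M′) left≡ degrees≡ (Equivalence.to (Fits⇔left {p} lenp s) h)) ,
      λ γ → ConnOn-cong (λ u v → mk⇔ (Equivalence.from (E-split {q} lenq s γ u v)) (Equivalence.to (E-split {q} lenq s γ u v)))
        (ConnOn-exchange (E-sym p) (E-sym q) (E-sym s′) (late⇒Open {s})
          Star-transfer neighbour-transfer
          (⌊⌋-≡⇒ (closed? q γ) (closed? p γ) (sym (cong proj₁ (color-≡ γ))))
          (⌊⌋-≡⇒ (conn? p γ) (conn? q γ) (cong proj₂ (color-≡ γ)))
          (closed-or-open q γ)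
          (ConnOn-cong (E-split {p} lenp s γ) (k γ)))
      where
      s′ = late G (toℕ i) s
      degrees≡ : map (degrees (p ++ s)) unsettled ≡ map (degrees (q ++ s)) unsettled
      degrees≡ = List.map-cong-local (All.tabulate λ {u} u∈ → Vec.tabulate-cong λ γ →
        trans (deg-split {p} lenp s γ u) (trans (cong (_+ deg s′ γ u) (deg-≡ (∈-unsettled⁻ u∈) γ)) (sym (deg-split {q} lenq s γ u))))

  exchange : ∀ p q → length p ≡ toℕ i → length q ≡ toℕ i → sig p ≡ sig q →
             ∃ (λ s → Accepted′ (p ++ s)) → ∃ (λ s → Accepted′ (q ++ s)) →
             ∀ s → Accepted′ (p ++ s) → Accepted′ (q ++ s)
  exchange p q lenp lenq eq (s₁ , a₁) (s₂ , a₂) =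
    exchange′ {p} {q} lenp lenq same (alive-Shape {p} lenp s₁ a₁) (alive-Shape {q} lenq s₂ a₂)
      (just-≡ (alive-left {p} lenp s₁ a₁) (alive-left {q} lenq s₂ a₂) (SameSig.left-≡ same))
    where
    same = sig-≡ p q eq
    just-≡ : ∀ {x y : Maybe (Vec Bool (length (M C)))} → ∃[ bs ] x ≡ just bs → ∃[ bs ] y ≡ just bs →
             fromMaybe full x ≡ fromMaybe full y → x ≡ y
    just-≡ (_ , refl) (_ , refl) e = cong just e

-- Counting signatures

Code : Set → ℕ → Set
Code S N = Σ[ f ∈ (S → Fin N) ] Injective _≡_ _≡_ f

code-Bool : Code Bool 2
code-Bool = (λ { false → zero ; true → suc zero }) ,
  λ { {false} {false} _ → refl ; {true} {true} _ → refl ; {false} {true} () ; {true} {false} () }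

code-Fin : Code (Fin N) N
code-Fin = id , id

code-× : {S S′ : Set} → Code S N → Code S′ N′ → Code (S × S′) (N * N′)
code-× (f , f-inj) (g , g-inj) = (λ (x , y) → combine (f x) (g y)) , λ {(x , y)} {(x′ , y′)} eq →
  let e , e′ = Fin.combine-injective (f x) (g y) (f x′) (g y′) eq in cong₂ _,_ (f-inj e) (g-inj e′)

code-Vec : {S : Set} → Code S N → ∀ k → Code (Vec S k) (N ^ k)
code-Vec cS zero    = (λ _ → zero) , λ { {Vec.[]} {Vec.[]} _ → refl }
code-Vec cS (suc k) =
  let f , f-inj = code-× cS (code-Vec cS k)
  in (λ { (x Vec.∷ xs) → f (x , xs) }) , λ { {x Vec.∷ xs} {y Vec.∷ ys} eq → cong (λ (z , zs) → z Vec.∷ zs) (f-inj eq) }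

-- Follows the recursion of `⌈log2⌉`, which passes from 2 + n to 1 + ⌈n/2⌉.
n≤2^⌈log₂n⌉ : ∀ n → n ≤ 2 ^ ⌈log₂ n ⌉
n≤2^⌈log₂n⌉ n = go n (<-wellFounded n)
  where
  go : ∀ n (a : Acc _<_ n) → n ≤ 2 ^ ⌈log2⌉ n a
  go zero          _        = z≤n
  go (suc zero)    _        = s≤s z≤n
  go (suc (suc n)) (acc rs) = begin
    2 + n                   ≡⟨ cong (2 +_) (ℕ.⌊n/2⌋+⌈n/2⌉≡n n) ⟨
    2 + (⌊ n /2⌋ + ⌈ n /2⌉) ≤⟨ ℕ.+-monoʳ-≤ 2 (ℕ.+-monoˡ-≤ ⌈ n /2⌉ (ℕ.⌊n/2⌋≤⌈n/2⌉ n)) ⟩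
    2 + (⌈ n /2⌉ + ⌈ n /2⌉) ≡⟨ double ⌈ n /2⌉ ⟩
    2 * suc ⌈ n /2⌉         ≤⟨ ℕ.*-monoʳ-≤ 2 (go (suc ⌈ n /2⌉) (rs (ℕ.⌈n/2⌉<n n))) ⟩
    2 * 2 ^ ⌈log2⌉ (suc ⌈ n /2⌉) (rs (ℕ.⌈n/2⌉<n n)) ∎
    where
    open ℕ.≤-Reasoning
    double : ∀ x → 2 + (x + x) ≡ 2 * suc x
    double = solve-∀

module _ {n : ℕ} (G : OrderedGraph) where
  open OrderedGraph G
  private
    C = suc n

  -- A bound for the number of signatures when the frontier has ℓ elements.
  signatures : ℕ → ℕ
  signatures ℓ = ((2 * (2 * ℓ)) ^ C * 2 ^ (2 + C)) ^ ℓ * ((2 * 2) ^ C * 2 ^ length (M C))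

  code-Sig : ∀ i → Code (Signature.Sig {n} G i) (signatures (length (frontier i)))
  code-Sig i = code-×
    (code-Vec (code-× (code-Vec (code-× code-Bool (code-× code-Bool code-Fin)) C) (code-Vec code-Bool (2 + C))) ℓ)
    (code-× (code-Vec (code-× code-Bool code-Bool) C) (code-Vec code-Bool (length (M C))))
    where ℓ = length (frontier i)

  length-M : length (M C) ≡ 3 + n
  length-M = trans (cong length (M≡mdeg n)) (trans (length-map (Vec.tabulate ∘ mdeg) (allFin (3 + n))) (length-tabulate {n = 3 + n} id))

  module _ {w : ℕ} (2≤w : 2 ≤ w) where
    private
      a = 3 + n
      L = ⌈log₂ w ⌉

      1≤L : 1 ≤ L
      1≤L = ⌈log₂⌉-mono-≤ 2≤w

      instance
        w≢0 : NonZero w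
        w≢0 = >-nonZero (ℕ.≤-trans (s≤s z≤n) 2≤w)

      X = ((2 + L) * C + (2 + C)) * w + (2 * C + a)

    signatures≤ : ∀ {ℓ} → ℓ ≤ w → signatures ℓ ≤ 2 ^ X
    signatures≤ {ℓ} ℓ≤w = begin
      signatures ℓ
        ≤⟨ ℕ.*-mono-≤ vertexPart colorPart ⟩
      2 ^ (((2 + L) * C + (2 + C)) * w) * 2 ^ (2 * C + a)
        ≡⟨ ℕ.^-distribˡ-+-* 2 (((2 + L) * C + (2 + C)) * w) (2 * C + a) ⟨
      2 ^ X ∎
      where
      open ℕ.≤-Reasoning
      base : 2 * (2 * ℓ) ≤ 2 ^ (2 + L)
      base = ℕ.*-monoʳ-≤ 2 (ℕ.*-monoʳ-≤ 2 (ℕ.≤-trans ℓ≤w (n≤2^⌈log₂n⌉ w)))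
      vertexPart : ((2 * (2 * ℓ)) ^ C * 2 ^ (2 + C)) ^ ℓ ≤ 2 ^ (((2 + L) * C + (2 + C)) * w)
      vertexPart = begin
        ((2 * (2 * ℓ)) ^ C * 2 ^ (2 + C)) ^ ℓ
          ≤⟨ ℕ.^-monoˡ-≤ ℓ (ℕ.*-monoˡ-≤ (2 ^ (2 + C)) (ℕ.^-monoˡ-≤ C base)) ⟩
        ((2 ^ (2 + L)) ^ C * 2 ^ (2 + C)) ^ ℓ
          ≡⟨ cong (λ x → (x * 2 ^ (2 + C)) ^ ℓ) (ℕ.^-*-assoc 2 (2 + L) C) ⟩
        (2 ^ ((2 + L) * C) * 2 ^ (2 + C)) ^ ℓ
          ≡⟨ cong (_^ ℓ) (ℕ.^-distribˡ-+-* 2 ((2 + L) * C) (2 + C)) ⟨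
        (2 ^ ((2 + L) * C + (2 + C))) ^ ℓ
          ≡⟨ ℕ.^-*-assoc 2 ((2 + L) * C + (2 + C)) ℓ ⟩
        2 ^ (((2 + L) * C + (2 + C)) * ℓ)
          ≤⟨ ℕ.^-monoʳ-≤ 2 (ℕ.*-monoʳ-≤ ((2 + L) * C + (2 + C)) ℓ≤w) ⟩
        2 ^ (((2 + L) * C + (2 + C)) * w) ∎
      colorPart : (2 * 2) ^ C * 2 ^ length (M C) ≤ 2 ^ (2 * C + a)
      colorPart = begin
        (2 ^ 2) ^ C * 2 ^ length (M C) ≡⟨ cong₂ (λ x y → x * 2 ^ y) (ℕ.^-*-assoc 2 2 C) length-M ⟩
        2 ^ (2 * C) * 2 ^ a            ≡⟨ ℕ.^-distribˡ-+-* 2 (2 * C) a ⟨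
        2 ^ (2 * C + a)                ∎

    -- The origin of the constant 8: four multiples of a w L pay for the vertices, three for the
    -- colours and the mask of M, and one for the doubling that makes room for the node with an
    -- empty residual. That `L` is at least 1 is where 2 ≤ w enters.
    exponent≤ : suc X ≤ 8 * (a * w * L)
    exponent≤ = begin
      suc (((2 + L) * C + (2 + C)) * w + (2 * C + a))
        ≤⟨ s≤s (ℕ.+-mono-≤ (ℕ.*-monoˡ-≤ w (ℕ.+-mono-≤ (ℕ.*-mono-≤ 2+L≤ C≤a) (ℕ.m≤n*m a L {{>-nonZero 1≤L}})))
             (ℕ.+-monoˡ-≤ a (ℕ.*-monoʳ-≤ 2 C≤a))) ⟩
      suc (((3 * L) * a + L * a) * w + (2 * a + a))
        ≡⟨ rearrange L a w ⟩
      1 + 4 * (a * w * L) + 3 * a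
        ≤⟨ ℕ.+-mono-≤ (ℕ.+-monoˡ-≤ (4 * (a * w * L)) (ℕ.≤-trans (s≤s z≤n) a≤)) (ℕ.*-monoʳ-≤ 3 a≤) ⟩
      a * w * L + 4 * (a * w * L) + 3 * (a * w * L)
        ≡⟨ collect (a * w * L) ⟩
      8 * (a * w * L) ∎
      where
      open ℕ.≤-Reasoning
      C≤a : C ≤ a
      C≤a = ℕ.m≤n+m C 2
      2+L≤ : 2 + L ≤ 3 * L
      2+L≤ = ℕ.≤-trans (ℕ.+-monoˡ-≤ L (ℕ.*-monoʳ-≤ 2 1≤L)) (ℕ.≤-reflexive (three L))
        where
        three : ∀ L → 2 * L + L ≡ 3 * L
        three = solve-∀
      a≤ : a ≤ a * w * L
      a≤ = ℕ.≤-trans (ℕ.m≤m*n a w) (ℕ.m≤m*n (a * w) L {{>-nonZero 1≤L}})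
      rearrange : ∀ L a w → suc (((3 * L) * a + L * a) * w + (2 * a + a)) ≡ 1 + 4 * (a * w * L) + 3 * a
      rearrange = solve-∀
      collect : ∀ P → P + 4 * P + 3 * P ≡ 8 * P
      collect = solve-∀

    signatures-bound : ∀ {ℓ} → ℓ ≤ w → suc (signatures ℓ) ≤ 2 ^ (8 * (a * w * L))
    signatures-bound {ℓ} ℓ≤w = begin
      suc (signatures ℓ)     ≤⟨ ℕ.+-mono-≤ (ℕ.m^n>0 2 X) (signatures≤ ℓ≤w) ⟩
      2 ^ X + 2 ^ X          ≡⟨ cong (2 ^ X +_) (ℕ.+-identityʳ (2 ^ X)) ⟨
      2 ^ suc X              ≤⟨ ℕ.^-monoʳ-≤ 2 exponent≤ ⟩
      2 ^ (8 * (a * w * L))  ∎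
      where open ℕ.≤-Reasoning

  frontier≤ : ∀ i → length (frontier i) ≤ maxFrontier
  frontier≤ i = All.lookup (xs≤max 0 (map (length ∘ frontier) (allFin size))) (∈-map⁺ (length ∘ frontier) (∈-allFin i))

-- Accepted subgraphs force a frontier of size two

first-≤ : ∀ {n} (f : Fin n → Bool) d → T (f d) → ∀ j → T (f j) → toℕ (first f d) ≤ toℕ j
first-≤ f zero    p j       q = z≤n
first-≤ f (suc d) p zero    q with f zero
... | true = z≤n
first-≤ f (suc d) p (suc j) q with f zero
... | true  = z≤n
... | false = s≤s (first-≤ (f ∘ suc) d p j q)

-- Every vertex has degree 0 or 2 in the first colour, so both ends of the
-- first edge of that colour are open afterwards.
module _ {n : ℕ} (G : OrderedGraph) (D : ColoredSubset (suc n) (Fin (OrderedGraph.size G)))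
         (accepted : Accepted (M (suc n)) (spanningSubgraph G D)) where
  open OrderedGraph G
  open ColoredSubset D using (part)
  private
    module S = ColoredGraphProperties (spanningSubgraph G D)
    deg₀ = S.deg zero

    L = proj₁ (proj₁ accepted)
    allΔ₀ = proj₁ (proj₂ (proj₁ accepted))
    perm = proj₂ (proj₂ (proj₁ accepted))

    0-or-2 : ∀ {d} → d ∈ M (suc n) ++ L → Vec.lookup d zero ≡ 0 ⊎ Vec.lookup d zero ≡ 2
    0-or-2 {d} d∈ = [ fromM , fromΔ₀ {d} ∘ All.lookup allΔ₀ ]′ (∈-++⁻ (M (suc n)) d∈)
      where
      fromM : ∀ {d} → d ∈ M (suc n) → Vec.lookup d zero ≡ 0 ⊎ Vec.lookup d zero ≡ 2
      fromM d∈ with ∈-M⁻ d∈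
      ... | k , refl with lev k ℕ.≟ 0
      ...   | yes eq = inj₂ (trans (mdeg-≡ k zero (sym eq)) (cong (2 +_) eq))
      ...   | no ne  = inj₁ (mdeg-< k zero (ℕ.n≢0⇒n>0 ne))
      fromΔ₀ : ∀ {d : Vec ℕ (suc n)} → IsΔ₀ d → Vec.lookup d zero ≡ 0 ⊎ Vec.lookup d zero ≡ 2
      fromΔ₀ (inj₂ z) = inj₁ (z zero)
      fromΔ₀ (inj₁ (i , two , zeros)) with zero ≟ i
      ... | yes refl = inj₂ two
      ... | no ne    = inj₁ (zeros zero ne)

    deg₀≡2 : ∀ {u v} → S.E zero u v → deg₀ u ≡ 2
    deg₀≡2 {u} {v} e with 0-or-2 (∈-resp-↭ perm (∈-map⁺ (coloredDegree (spanningSubgraph G D)) (∈-allFin u)))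
    ... | inj₁ eq = contradiction e (#≡0⁻ (λ v → S.part zero (u , v)) eq v)
    ... | inj₂ eq = eq

    edge₀ : ∃[ e ] T (part zero e)
    edge₀ with ∈-map⁻ (coloredDegree (spanningSubgraph G D)) (∈-resp-↭ (↭-sym perm)
                 (∈-++⁺ˡ (subst (Vec.tabulate (mdeg zero) ∈_) (sym (M≡mdeg n)) (∈-map⁺ (Vec.tabulate ∘ mdeg) (∈-allFin zero)))))
    ... | u , _ , eq =
      let v , e = #>0 (λ v → S.part zero (u , v)) (subst (0 <_) (cong (λ d → Vec.lookup d zero) eq) (s≤s z≤n))
          e′ , _ , t = Equivalence.to (E-spanning G D zero u v) e
      in e′ , t

    abstract
      least : ∃[ e ] T (part zero e) × (∀ e′ → T (part zero e′) → toℕ e ≤ toℕ e′)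
      least = first (part zero) (proj₁ edge₀) , first-sat (part zero) (proj₁ edge₀) (proj₂ edge₀) ,
              first-≤ (part zero) (proj₁ edge₀) (proj₂ edge₀)

    e₀ : Fin size
    e₀ = proj₁ least

    ≐-functional : ∀ {x y z : Vertex graph} {e} → (x , y) ≐ e → (x , z) ≐ e → y ≡ z
    ≐-functional (inj₁ (refl , refl)) (inj₁ (_ , q))  = sym q
    ≐-functional (inj₁ (refl , refl)) (inj₂ (p , q))  = trans (sym p) (sym q)
    ≐-functional (inj₂ (refl , refl)) (inj₂ (_ , q))  = sym q
    ≐-functional (inj₂ (refl , refl)) (inj₁ (p , q))  = trans (sym p) (sym q)

    -- Degree 2 gives x a second edge of the first colour, and `e₀` is the earliest edge of that
    -- colour.
    later : ∀ {x y} → (x , y) ≐ edge e₀ → ∃[ e ] toℕ e₀ < toℕ e × Incident x e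
    later {x} {y} q =
      let a , b , a≢b , xa , xb , _ = #≡2 (λ v → S.part zero (x , v))
            (deg₀≡2 (Equivalence.from (E-spanning G D zero x y) (e₀ , q , proj₁ (proj₂ least))))
      in pick a≢b xa xb (a ≟ y)
      where
      other : ∀ {z} → S.E zero x z → z ≢ y → ∃[ e ] toℕ e₀ < toℕ e × Incident x e
      other {z} xz z≢y =
        let e , r , t = Equivalence.to (E-spanning G D zero x z) xz
        in e , ℕ.≤∧≢⇒< (proj₂ (proj₂ least) e t)
                 (λ eq → z≢y (≐-functional r (subst (λ e → (x , y) ≐ edge e) (Fin.toℕ-injective eq) q))) ,
           Sum.map proj₁ proj₁ r
      pick : ∀ {a b} → a ≢ b → S.E zero x a → S.E zero x b → Dec (a ≡ y) → ∃[ e ] toℕ e₀ < toℕ e × Incident x e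
      pick a≢b xa xb (yes refl) = other xb (a≢b ∘ sym)
      pick a≢b xa xb (no a≢y)   = other xa a≢y

    u v : Vertex graph
    u = proj₁ (edge e₀)
    v = proj₂ (edge e₀)

    u≢v : u ≢ v
    u≢v eq = Graph.adj-irrefl graph (subst (Adj graph u) (sym eq) (sound e₀))

    next : suc (toℕ e₀) < size
    next = let e , lt , _ = later {u} {v} (inj₁ (refl , refl)) in ℕ.≤-<-trans lt (Fin.toℕ<n e)

    -- The level just after `e₀`, which exists because a later edge does.
    i : Fin size
    i = fromℕ< next

    ∈-frontier : ∀ {x y} → (x , y) ≐ edge e₀ → x ∈ frontier i
    ∈-frontier {x} q = let e , lt , inc = later q in
      Signature.∈-frontier⁺ {n} G i
        (e₀ , subst (toℕ e₀ <_) (sym (Fin.toℕ-fromℕ< next)) ℕ.≤-refl , Sum.map proj₁ proj₁ q)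
        (e , subst (_≤ toℕ e) (sym (Fin.toℕ-fromℕ< next)) lt , inc)

  Accepted⇒2≤maxFrontier : 2 ≤ maxFrontier
  Accepted⇒2≤maxFrontier = ℕ.≤-trans
    (Unique-length {xs = u ∷ v ∷ []} ((u≢v ∷ []) ∷ [] ∷ [])
      λ { (here refl) → ∈-frontier {u} {v} (inj₁ (refl , refl))
        ; (there (here refl)) → ∈-frontier {v} {u} (inj₂ (refl , refl)) })
    (frontier≤ {n} G i)

-- The diagram and its width

module _ (n : ℕ) (G : OrderedGraph) where
  open OrderedGraph G
  accepts : List (Fin (suc (suc n))) → Bool
  accepts w = ⌊ accepted? (M (suc n)) (spanningSubgraph G (chosen G w)) ⌋

  accepts⇔ : ∀ w → T (accepts w) ⇔ Accepted (M (suc n)) (spanningSubgraph G (chosen G w))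
  accepts⇔ w = mk⇔ (⌊⌋⁻ (accepted? (M (suc n)) _)) (⌊⌋⁺ (accepted? (M (suc n)) _))

  profile⇔ : ∀ B → 𝒞* (M (suc n)) (coloredSubgraph G B) ⇔ Accepted (M (suc n)) (spanningSubgraph G B)
  profile⇔ B = 𝒞*-edgeInduced (spanningSubgraph G B) M-nonzero

  private
    2≤w? = 2 ℕ.≤? maxFrontier

    0<size : 2 ≤ maxFrontier → 0 < size
    0<size = go (length ∘ frontier)
      where
      go : ∀ {m} (f : Fin m → ℕ) → 2 ≤ max 0 (map f (allFin m)) → 0 < m
      go {suc m} f _ = s≤s z≤n

  -- Taking the decision as an argument lets the proofs about `diagram` match on it.
  diagramIf : Dec (2 ≤ maxFrontier) → DD (suc n) size
  diagramIf (yes _) = minimal size (build size accepts)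
  diagramIf (no _)  = empty

  diagram : DD (suc n) size
  diagram = diagramIf 2≤w?

  diagram-represents : DD.Represents diagram (λ D → 𝒞* (M (suc n)) (coloredSubgraph G D))
  diagram-represents = go 2≤w?
    where
    agree : ∀ B (w : Vec (Fin (suc (suc n))) size) → Codes w B → ∀ γ e →
            T (ColoredSubset.part B γ e) ⇔ T (ColoredSubset.part (chosen G (Vec.toList w)) γ e)
    agree B w cd γ e = mk⇔
      (λ t → ⌊⌋⁺ (at G (Vec.toList w) (toℕ e) ≟ suc γ) (trans (sym (at-lookup G w e)) (Equivalence.to (cd γ e) t)))
      (λ t → Equivalence.from (cd γ e) (trans (at-lookup G w e) (⌊⌋⁻ (at G (Vec.toList w) (toℕ e) ≟ suc γ) t)))

    go : (d : Dec (2 ≤ maxFrontier)) → DD.Represents (diagramIf d) (λ D → 𝒞* (M (suc n)) (coloredSubgraph G D))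
    go (no w≱2) = empty-represents λ B h → w≱2 (Accepted⇒2≤maxFrontier G B (Equivalence.to (profile⇔ B) h))
    go (yes 2≤w) = minimal-represents (0<size 2≤w) accepts λ B w cd → mk⇔
      (λ h → Equivalence.from (accepts⇔ (Vec.toList w)) (Accepted-resp G B (chosen G (Vec.toList w)) (agree B w cd)
        (Equivalence.to (profile⇔ B) h)))
      (λ t → Equivalence.from (profile⇔ B) (Accepted-resp G (chosen G (Vec.toList w)) B
        (λ γ e → mk⇔ (Equivalence.from (agree B w cd γ e)) (Equivalence.to (agree B w cd γ e)))
        (Equivalence.to (accepts⇔ (Vec.toList w)) t)))

  diagram-width : DD.width diagram ≤ 2 ^ (8 * ((3 + n) * maxFrontier * ⌈log₂ maxFrontier ⌉))
  diagram-width = go 2≤w?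
    where
    go : (d : Dec (2 ≤ maxFrontier)) → DD.width (diagramIf d) ≤ 2 ^ (8 * ((3 + n) * maxFrontier * ⌈log₂ maxFrontier ⌉))
    go (no _) = ℕ.≤-trans (width-empty {suc n} size) z≤n
    go (yes 2≤w) = minimal-width (0<size 2≤w) accepts λ i →
      let f , f-inj = code-Sig {n} G i in
      signatures {n} G (length (frontier i)) , signatures-bound {n} G 2≤w (frontier≤ {n} G i) ,
      (λ p → f (Signature.sig G i p)) ,
      λ p q lp lq eq (s₁ , a₁) (s₂ , a₂) s a → Equivalence.from (accepts⇔ (q ++ s))
        (Signature.exchange G i p q lp lq (f-inj eq)
          (s₁ , Equivalence.to (accepts⇔ (p ++ s₁)) a₁) (s₂ , Equivalence.to (accepts⇔ (q ++ s₂)) a₂)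
          s (Equivalence.to (accepts⇔ (p ++ s)) a))

-- Makes the second factor of the stated bound at least 1, so that multiplying `diagram-width` by it
-- is a weakening.
base>0 : ∀ n → 0 < 3 * 2 ^ suc n ∸ (3 + n)
base>0 n = ℕ.m<n⇒0<n∸m (begin
  4 + n           ≤⟨ ℕ.+-mono-≤ (ℕ.m≤n+m 4 2) (ℕ.m≤m*n n 3) ⟩
  6 + n * 3       ≡⟨ triple n ⟩
  3 * (2 + n)     ≤⟨ ℕ.*-monoʳ-≤ 3 (1+n≤2^ (suc n)) ⟩
  3 * 2 ^ suc n   ∎)
  where
  open ℕ.≤-Reasoning
  1+n≤2^ : ∀ n → suc n ≤ 2 ^ n
  1+n≤2^ zero    = s≤s z≤n
  1+n≤2^ (suc n) = ℕ.+-mono-≤ (ℕ.m^n>0 2 n) (ℕ.≤-trans (1+n≤2^ n) (ℕ.≤-reflexive (sym (ℕ.+-identityʳ (2 ^ n)))))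
  triple : ∀ n → 6 + n * 3 ≡ 3 * (2 + n)
  triple = solve-∀

-- Bundles the construction with its properties for one a, so that a single transport along 3 ≤ a
-- serves both and the two projections fit together.
Diagrams : ℕ → ℕ → Set
Diagrams a c = Σ[ Z ∈ (∀ (G : OrderedGraph) → DD c (OrderedGraph.size G)) ] ∀ G →
  let w = OrderedGraph.maxFrontier G in
  DD.Represents (Z G) (λ D → 𝒞* (M c) (coloredSubgraph G D))
  × DD.width (Z G) ≤ 2 ^ (8 * (a * w * ⌈log₂ w ⌉)) * (3 * 2 ^ c ∸ a) ^ w

diagrams : ∀ n → Diagrams (3 + n) (suc n)
diagrams n = diagram n , λ G → diagram-represents n G , widen (OrderedGraph.maxFrontier G) (diagram-width n G)
  where
  widen : ∀ {x y} w → x ≤ y → x ≤ y * (3 * 2 ^ suc n ∸ (3 + n)) ^ w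
  widen {y = y} w x≤y = ℕ.≤-trans x≤y
    (ℕ.m≤m*n y ((3 * 2 ^ suc n ∸ (3 + n)) ^ w) {{ℕ.m^n≢0 (3 * 2 ^ suc n ∸ (3 + n)) w {{>-nonZero (base>0 n)}}}})

-- With P abstract, M (a ∸ 2) and M (1 + n) are not compared by unfolding.
with-3≤ : (P : ℕ → ℕ → Set) → (∀ n → P (3 + n) (suc n)) → ∀ a → 3 ≤ a → P a (a ∸ 2)
with-3≤ P h _ (s≤s (s≤s (s≤s {n = n} _))) = h n

theorem6 :
    (∀ a → 3 ≤ a → IsExtendedProfile (M (a ∸ 2)) (complete a))
    ×
    (Σ[ Z ∈ (∀ a → 3 ≤ a → (G : OrderedGraph) → DD (a ∸ 2) (OrderedGraph.size G)) ]
     ∃[ K ]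
     ∀ a (3≤a : 3 ≤ a) (G : OrderedGraph) →
         let w = OrderedGraph.maxFrontier G in
         DD.Represents (Z a 3≤a G) (λ D → 𝒞* (M (a ∸ 2)) (coloredSubgraph G D))
         × DD.width (Z a 3≤a G) ≤ 2 ^ (K * (a * w * ⌈log₂ w ⌉)) * (3 * 2 ^ (a ∸ 2) ∸ a) ^ w)
theorem6 =
  with-3≤ (λ a c → IsExtendedProfile (M c) (complete a)) extendedProfile ,
  (λ a 3≤a → proj₁ (with-3≤ Diagrams diagrams a 3≤a)) , 8 ,
  λ a 3≤a → proj₂ (with-3≤ Diagrams diagrams a 3≤a)
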